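{- Let $p \in [0,\frac{1}{2})$ be a constant. There is a constant $\alpha \ge 2$ depending only on $p$ such that the following holds. Let $S$ be a sequence of $m$ distinct elements, let $d$ be an integer with $d \ge \max\{\mathrm{disl}(S), \ln m\}$, and let $x \notin S$ be an additional element. Under the error model for approximate noisy binary searching, there exists an algorithm $\mathrm{NoisySearch}(S,x,d)$ that runs in $O(\log m)$ worst-case time and returns an index $\tau_x \in [\mathrm{rank}(x,S) - \alpha d, \mathrm{rank}(x,S) + \alpha d]$ with probability at least $1 - O(m^{ -6})$.
   Context: Elements have a true total order $<$. $\mathrm{rank}(x,S) = 1 + |\{y \in S : y < x\}|$; for $y \in S$, the dislocation of $y$ is $|\mathrm{pos}(y,S) - \mathrm{rank}(y,S)|$ where $\mathrm{pos}(y,S)$ is the position of $y$ in $S$, and $\mathrm{disl}(S)$ is the maximum dislocation over elements of $S$. Error model for approximate noisy binary searching: only comparisons between $x$ and elements of $S$ are allowed; each such comparison reports the wrong order with probability at most $p$, errors for different elements are independent, outcomes are persistent (repeating a comparison gives the same outcome), and the order of the elements in $S$ does not depend on the errors of the comparisons between $x$ and the elements of $S$. Each comparison takes constant time. -}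

module Defs where

open import Data.Bool using (Bool; true; false; if_then_else_; _xor_)
open import Data.Fin using (Fin; toℕ; fromℕ<)
open import Data.Fin.Subset using (Subset; inside; outside)
open import Data.Integer as ℤ using (+_; +[1+_])
import Data.Integer.Properties as ℤ
open import Data.List using (List; []; _∷_; _++_; map; filter; foldr; length; allFin)
open import Data.List.Extrema.Nat using (max)
open import Data.Nat as ℕ using (ℕ; zero; suc; ⌊_/2⌋; z≤n; s≤s)
import Data.Nat.Properties as ℕ
import Data.Nat.Solver
open import Data.Nat.Coprimality using (1-coprimeTo)
open import Data.Product using (∃; _×_; _,_; proj₁; proj₂)
open import Data.Rational as ℚ using (ℚ; mkℚ; 0ℚ; 1ℚ; ½; _/_; ∣_∣; *<*; *≤*)
import Data.Rational.Properties as ℚ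
import Data.Rational.Unnormalised.Properties as ℚᵘ
open import Data.Rational.Unnormalised using (*≡*)
open import Data.Rational.Solver using (module +-*-Solver)
open import Data.Sum using (inj₁; inj₂)
open import Data.Vec using ([]; _∷_; lookup)
open import Level using (Level)
open import Relation.Binary.Bundles using (StrictTotalOrder)
open import Relation.Binary.PropositionalEquality
open import Relation.Nullary using (yes; no; does)
open import Relation.Unary using (Pred; Decidable)

-- Real numbers are Cauchy sequences of rationals with pointwise operations.
-- Two sequences denote the same real when each is ≤ℝ the other.

IsCauchy : (ℕ → ℚ) → Set
IsCauchy s = ∀ ε → 0ℚ ℚ.< ε →
  ∃ λ N → ∀ m n → N ℕ.≤ m → N ℕ.≤ n → ∣ s m ℚ.- s n ∣ ℚ.< ε

record ℝ : Set where
  constructor mkℝ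
  field
    seq    : ℕ → ℚ
    cauchy : IsCauchy seq

open ℝ public

infix  4 _≤ℝ_ _<ℝ_
infixl 6 _+ℝ_ _-ℝ_
infixl 7 _*ℝ_
infix  8 -ℝ_

_≤ℝ_ : ℝ → ℝ → Set
x ≤ℝ y = ∀ ε → 0ℚ ℚ.< ε → ∃ λ N → ∀ n → N ℕ.≤ n → seq x n ℚ.≤ seq y n ℚ.+ ε

_<ℝ_ : ℝ → ℝ → Set
x <ℝ y = ∃ λ ε → 0ℚ ℚ.< ε × ∃ λ N → ∀ n → N ℕ.≤ n → seq x n ℚ.+ ε ℚ.≤ seq y n

fromℚ : ℚ → ℝ
fromℚ q = mkℝ (λ _ → q) λ ε 0<ε → 0 , λ _ _ _ _ →
  subst (λ r → ∣ r ∣ ℚ.< ε) (sym (ℚ.+-inverseʳ q)) 0<ε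

fromℕ : ℕ → ℝ
fromℕ n = fromℚ (+ n / 1)

0ℝ 1ℝ ½ℝ : ℝ
0ℝ = fromℚ 0ℚ
1ℝ = fromℚ 1ℚ
½ℝ = fromℚ ½

private
  open +-*-Solver using (solve; _:=_; _:+_; _:*_; _:-_; :-_)
  module Nat = Data.Nat.Solver.+-*-Solver

  half>0 : ∀ {ε} → 0ℚ ℚ.< ε → 0ℚ ℚ.< ½ ℚ.* ε
  half>0 {ε} 0<ε = subst (ℚ._< ½ ℚ.* ε) (ℚ.*-zeroʳ ½) (ℚ.*-monoʳ-<-pos ½ 0<ε)

  half+half : ∀ ε → ½ ℚ.* ε ℚ.+ ½ ℚ.* ε ≡ ε
  half+half ε = trans (sym (ℚ.*-distribʳ-+ ε ½ ½)) (ℚ.*-identityˡ ε)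

  bounded : ∀ x → ∃ λ B → 0ℚ ℚ.< B × ∃ λ N → ∀ n → N ℕ.≤ n → ∣ seq x n ∣ ℚ.≤ B
  bounded x with cauchy x 1ℚ (*<* (ℤ.+<+ (s≤s z≤n)))
  ... | N , close = ∣ seq x N ∣ ℚ.+ 1ℚ
    , ℚ.+-mono-≤-< {0ℚ} {∣ seq x N ∣} {0ℚ} {1ℚ} (ℚ.0≤∣p∣ (seq x N)) (*<* (ℤ.+<+ (s≤s z≤n)))
    , N , λ n N≤n → begin
      ∣ seq x n ∣
        ≡⟨ cong ∣_∣ (solve 2 (λ a b → a := b :+ (a :- b)) refl (seq x n) (seq x N)) ⟩
      ∣ seq x N ℚ.+ (seq x n ℚ.- seq x N) ∣
        ≤⟨ ℚ.∣p+q∣≤∣p∣+∣q∣ (seq x N) _ ⟩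
      ∣ seq x N ∣ ℚ.+ ∣ seq x n ℚ.- seq x N ∣
        ≤⟨ ℚ.+-monoʳ-≤ ∣ seq x N ∣ (ℚ.<⇒≤ (close n N N≤n ℕ.≤-refl)) ⟩
      ∣ seq x N ∣ ℚ.+ 1ℚ ∎
    where open ℚ.≤-Reasoning

_+ℝ_ : ℝ → ℝ → ℝ
x +ℝ y = mkℝ (λ n → seq x n ℚ.+ seq y n) λ ε 0<ε →
  let (M , p) = cauchy x (½ ℚ.* ε) (half>0 0<ε)
      (N , q) = cauchy y (½ ℚ.* ε) (half>0 0<ε)
      open ℚ.≤-Reasoning
  in M ℕ.⊔ N , λ m n m≥ n≥ → begin-strict
    ∣ (seq x m ℚ.+ seq y m) ℚ.- (seq x n ℚ.+ seq y n) ∣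
      ≡⟨ cong ∣_∣ (solve 4 (λ a b c d → (a :+ b) :- (c :+ d) := (a :- c) :+ (b :- d)) refl
           (seq x m) (seq y m) (seq x n) (seq y n)) ⟩
    ∣ (seq x m ℚ.- seq x n) ℚ.+ (seq y m ℚ.- seq y n) ∣
      ≤⟨ ℚ.∣p+q∣≤∣p∣+∣q∣ (seq x m ℚ.- seq x n) _ ⟩
    ∣ seq x m ℚ.- seq x n ∣ ℚ.+ ∣ seq y m ℚ.- seq y n ∣
      <⟨ ℚ.+-mono-< (p m n (ℕ.m⊔n≤o⇒m≤o M N m≥) (ℕ.m⊔n≤o⇒m≤o M N n≥))
                    (q m n (ℕ.m⊔n≤o⇒n≤o M N m≥) (ℕ.m⊔n≤o⇒n≤o M N n≥)) ⟩
    ½ ℚ.* ε ℚ.+ ½ ℚ.* ε ≡⟨ half+half ε ⟩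
    ε ∎

-ℝ_ : ℝ → ℝ
-ℝ x = mkℝ (λ n → ℚ.- seq x n) λ ε 0<ε →
  let (N , p) = cauchy x ε 0<ε
  in N , λ m n m≥ n≥ → subst (ℚ._< ε)
    (trans (sym (ℚ.∣-p∣≡∣p∣ (seq x m ℚ.- seq x n)))
      (cong ∣_∣ (solve 2 (λ a b → :- (a :- b) := (:- a) :- (:- b)) refl (seq x m) (seq x n))))
    (p m n m≥ n≥)

_-ℝ_ : ℝ → ℝ → ℝ
x -ℝ y = x +ℝ -ℝ y

private
  divide : ∀ c ε → 0ℚ ℚ.< c → 0ℚ ℚ.< ε → ∃ λ δ → 0ℚ ℚ.< δ × c ℚ.* δ ≡ ε
  divide c ε 0<c 0<ε = ℚ.1/ c ℚ.* ε
    , subst (ℚ._< ℚ.1/ c ℚ.* ε) (ℚ.*-zeroʳ (ℚ.1/ c))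
        (ℚ.*-monoʳ-<-pos (ℚ.1/ c) {{ℚ.1/pos⇒pos c}} 0<ε)
    , trans (sym (ℚ.*-assoc c (ℚ.1/ c) ε))
        (trans (cong (ℚ._* ε) (ℚ.*-inverseʳ c)) (ℚ.*-identityˡ ε))
    where
    instance
      c-positive : ℚ.Positive c
      c-positive = ℚ.positive 0<c
      c-nonZero : ℚ.NonZero c
      c-nonZero = ℚ.pos⇒nonZero c

  scale : ∀ {u v a δ} → ∣ u ∣ ℚ.≤ a → 0ℚ ℚ.< a → ∣ v ∣ ℚ.< δ → ∣ u ℚ.* v ∣ ℚ.< a ℚ.* δ
  scale {u} {v} {a} {δ} u≤a 0<a v<δ = begin-strict
    ∣ u ℚ.* v ∣       ≡⟨ ℚ.∣p*q∣≡∣p∣*∣q∣ u v ⟩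
    ∣ u ∣ ℚ.* ∣ v ∣   ≤⟨ ℚ.*-monoʳ-≤-nonNeg ∣ v ∣ {{ℚ.nonNegative (ℚ.0≤∣p∣ v)}} u≤a ⟩
    a ℚ.* ∣ v ∣       <⟨ ℚ.*-monoʳ-<-pos a {{ℚ.positive 0<a}} v<δ ⟩
    a ℚ.* δ           ∎
    where open ℚ.≤-Reasoning

  product-close : ∀ {a b c d A B δ} → 0ℚ ℚ.< A → 0ℚ ℚ.< B → ∣ a ∣ ℚ.≤ A → ∣ d ∣ ℚ.≤ B →
    ∣ a ℚ.- c ∣ ℚ.< δ → ∣ b ℚ.- d ∣ ℚ.< δ →
    ∣ a ℚ.* b ℚ.- c ℚ.* d ∣ ℚ.< (A ℚ.+ B) ℚ.* δ
  product-close {a} {b} {c} {d} {A} {B} {δ} 0<A 0<B a≤A d≤B ac bd = begin-strict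
    ∣ a ℚ.* b ℚ.- c ℚ.* d ∣
      ≡⟨ cong ∣_∣ (solve 4 (λ a b c d → a :* b :- c :* d := a :* (b :- d) :+ d :* (a :- c)) refl
           a b c d) ⟩
    ∣ a ℚ.* (b ℚ.- d) ℚ.+ d ℚ.* (a ℚ.- c) ∣
      ≤⟨ ℚ.∣p+q∣≤∣p∣+∣q∣ (a ℚ.* (b ℚ.- d)) (d ℚ.* (a ℚ.- c)) ⟩
    ∣ a ℚ.* (b ℚ.- d) ∣ ℚ.+ ∣ d ℚ.* (a ℚ.- c) ∣
      <⟨ ℚ.+-mono-< (scale {a} {b ℚ.- d} a≤A 0<A bd) (scale {d} {a ℚ.- c} d≤B 0<B ac) ⟩
    A ℚ.* δ ℚ.+ B ℚ.* δ ≡⟨ ℚ.*-distribʳ-+ δ A B ⟨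
    (A ℚ.+ B) ℚ.* δ     ∎
    where open ℚ.≤-Reasoning

  *-isCauchy : ∀ x y → IsCauchy (λ n → seq x n ℚ.* seq y n)
  *-isCauchy x y ε 0<ε =
    let A , 0<A , Nx , ∣x∣≤A = bounded x
        B , 0<B , Ny , ∣y∣≤B = bounded y
        δ , 0<δ , eq = divide (A ℚ.+ B) ε (ℚ.+-mono-< {0ℚ} {A} {0ℚ} {B} 0<A 0<B) 0<ε
        Mx , close-x = cauchy x δ 0<δ
        My , close-y = cauchy y δ 0<δ
    in (Nx ℕ.⊔ Ny) ℕ.⊔ (Mx ℕ.⊔ My) , λ m n m≥ n≥ →
      let m≥N = ℕ.m⊔n≤o⇒m≤o (Nx ℕ.⊔ Ny) (Mx ℕ.⊔ My) m≥
          m≥M = ℕ.m⊔n≤o⇒n≤o (Nx ℕ.⊔ Ny) (Mx ℕ.⊔ My) m≥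
          n≥N = ℕ.m⊔n≤o⇒m≤o (Nx ℕ.⊔ Ny) (Mx ℕ.⊔ My) n≥
          n≥M = ℕ.m⊔n≤o⇒n≤o (Nx ℕ.⊔ Ny) (Mx ℕ.⊔ My) n≥
      in subst (∣ seq x m ℚ.* seq y m ℚ.- seq x n ℚ.* seq y n ∣ ℚ.<_) eq
        (product-close {seq x m} {seq y m} {seq x n} {seq y n} 0<A 0<B
          (∣x∣≤A m (ℕ.m⊔n≤o⇒m≤o Nx Ny m≥N)) (∣y∣≤B n (ℕ.m⊔n≤o⇒n≤o Nx Ny n≥N))
          (close-x m n (ℕ.m⊔n≤o⇒m≤o Mx My m≥M) (ℕ.m⊔n≤o⇒m≤o Mx My n≥M))
          (close-y m n (ℕ.m⊔n≤o⇒n≤o Mx My m≥M) (ℕ.m⊔n≤o⇒n≤o Mx My n≥M)))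

_*ℝ_ : ℝ → ℝ → ℝ
x *ℝ y = mkℝ (λ n → seq x n ℚ.* seq y n) (*-isCauchy x y)

sumℝ productℝ : List ℝ → ℝ
sumℝ     = foldr _+ℝ_ 0ℝ
productℝ = foldr _*ℝ_ 1ℝ

-- harmonic a l = 1/(a+1) + 1/(a+2) + ⋯ + 1/(a+l)
harmonic : ℕ → ℕ → ℚ
harmonic a zero    = 0ℚ
harmonic a (suc l) = harmonic a l ℚ.+ + 1 / suc (a ℕ.+ l)

private
  unit : ℕ → ℚ
  unit n = + 1 / suc n

  unit-normal : ∀ n → unit n ≡ mkℚ (+ 1) n (1-coprimeTo (suc n))
  unit-normal n = ℚ.normalize-coprime (1-coprimeTo (suc n))

  unit-anti : ∀ {m n} → m ℕ.≤ n → unit n ℚ.≤ unit m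
  unit-anti {m} {n} m≤n rewrite unit-normal m | unit-normal n =
    *≤* (subst₂ ℤ._≤_ (sym (ℤ.*-identityˡ +[1+ m ])) (sym (ℤ.*-identityˡ +[1+ n ]))
      (ℤ.+≤+ (s≤s m≤n)))

  unit>0 : ∀ n → 0ℚ ℚ.< unit n
  unit>0 n rewrite unit-normal n = *<* (ℤ.+<+ (s≤s z≤n))

  p≤p+unit : ∀ p n → p ℚ.≤ p ℚ.+ unit n
  p≤p+unit p n = subst (ℚ._≤ p ℚ.+ unit n) (ℚ.+-identityʳ p)
    (ℚ.+-monoʳ-≤ p (ℚ.<⇒≤ (unit>0 n)))

  dbl : ℕ → ℕ
  dbl n = n ℕ.+ n

  unit-half : ∀ n → unit (suc (dbl n)) ℚ.+ unit (suc (dbl n)) ≡ unit n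
  unit-half n rewrite unit-normal (suc (dbl n)) | unit-normal n =
    ℚ.toℚᵘ-injective (ℚᵘ.≃-trans (ℚ.toℚᵘ-homo-+ u u) (*≡* (cong +_ cross)))
    where
    k = suc (suc (dbl n))
    u = mkℚ (+ 1) (suc (dbl n)) (1-coprimeTo k)
    cross : (1 ℕ.* k ℕ.+ 1 ℕ.* k) ℕ.* suc n ≡ 1 ℕ.* (k ℕ.* k)
    cross = Nat.solve 1 (λ n →
      let k = Nat.con 2 Nat.:+ (n Nat.:+ n) in
      (Nat.con 1 Nat.:* k Nat.:+ Nat.con 1 Nat.:* k) Nat.:* (Nat.con 1 Nat.:+ n)
        Nat.:= Nat.con 1 Nat.:* (k Nat.:* k)) refl n

  -- suc (mesh k) = 2 ^ k
  mesh : ℕ → ℕ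
  mesh zero    = 0
  mesh (suc k) = suc (dbl (mesh k))

  2^k≡suc-mesh : ∀ k → 2 ℕ.^ k ≡ suc (mesh k)
  2^k≡suc-mesh zero = refl
  2^k≡suc-mesh (suc k) rewrite 2^k≡suc-mesh k | ℕ.+-identityʳ (mesh k) =
    cong suc (ℕ.+-suc (mesh k) (mesh k))

  n≤mesh : ∀ n → n ℕ.≤ mesh n
  n≤mesh zero    = z≤n
  n≤mesh (suc n) = s≤s (ℕ.≤-trans (n≤mesh n) (ℕ.m≤m+n _ _))

  archimedean : ∀ ε → 0ℚ ℚ.< ε → ∃ λ N → unit (mesh N) ℚ.< ε
  archimedean (mkℚ +[1+ a ] d c) _ = suc d , lt
    where
    lt : unit (mesh (suc d)) ℚ.< mkℚ +[1+ a ] d c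
    lt rewrite unit-normal (mesh (suc d)) = *<* (ℤ.+<+ (begin-strict
      1 ℕ.* suc d               ≡⟨ ℕ.*-identityˡ (suc d) ⟩
      suc d                     <⟨ s≤s (n≤mesh (suc d)) ⟩
      suc (mesh (suc d))        ≤⟨ ℕ.m≤m+n _ _ ⟩
      suc a ℕ.* suc (mesh (suc d)) ∎))
      where open ℕ.≤-Reasoning
  archimedean (mkℚ (+ 0) d c) (*<* (ℤ.+<+ ()))
  archimedean (mkℚ ℤ.-[1+ a ] d c) (*<* ())

  within : ∀ {x y L δ} → L ℚ.≤ x → x ℚ.≤ L ℚ.+ δ → L ℚ.≤ y → y ℚ.≤ L ℚ.+ δ → ∣ x ℚ.- y ∣ ℚ.≤ δ
  within {x} {y} {L} {δ} L≤x x≤ L≤y y≤ with ℚ.∣p∣≡p∨∣p∣≡-p (x ℚ.- y)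
  ... | inj₁ eq = ℚ.≤-trans (ℚ.≤-reflexive eq) (ℚ.≤-trans
    (ℚ.+-mono-≤ x≤ (ℚ.neg-antimono-≤ L≤y))
    (ℚ.≤-reflexive (solve 2 (λ L d → (L :+ d) :- L := d) refl L δ)))
  ... | inj₂ eq = ℚ.≤-trans (ℚ.≤-reflexive (trans eq
      (solve 2 (λ x y → :- (x :- y) := y :- x) refl x y))) (ℚ.≤-trans
    (ℚ.+-mono-≤ y≤ (ℚ.neg-antimono-≤ L≤x))
    (ℚ.≤-reflexive (solve 2 (λ L d → (L :+ d) :- L := d) refl L δ)))

  dbl-+ : ∀ a l → dbl (a ℕ.+ l) ≡ dbl a ℕ.+ dbl l
  dbl-+ a l = Nat.solve 2 (λ a l → (a Nat.:+ l) Nat.:+ (a Nat.:+ l)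
    Nat.:= (a Nat.:+ a) Nat.:+ (l Nat.:+ l)) refl a l

  harmonic-dbl-step : ∀ a l → harmonic (dbl a) (dbl (suc l)) ≡
    harmonic (dbl a) (dbl l) ℚ.+ (unit (dbl (a ℕ.+ l)) ℚ.+ unit (suc (dbl (a ℕ.+ l))))
  harmonic-dbl-step a l
    rewrite ℕ.+-suc l l | ℕ.+-suc (dbl a) (dbl l) | dbl-+ a l =
    ℚ.+-assoc (harmonic (dbl a) (dbl l)) _ _

  harmonic-dbl-≥ : ∀ a l → harmonic a l ℚ.≤ harmonic (dbl a) (dbl l)
  harmonic-dbl-≥ a zero    = ℚ.≤-refl
  harmonic-dbl-≥ a (suc l) rewrite harmonic-dbl-step a l =
    ℚ.+-mono-≤ (harmonic-dbl-≥ a l) (ℚ.≤-trans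
      (ℚ.≤-reflexive (sym (unit-half (a ℕ.+ l))))
      (ℚ.+-monoˡ-≤ _ (unit-anti (ℕ.n≤1+n (dbl (a ℕ.+ l))))))

  harmonic-dbl-≤ : ∀ a l → harmonic (dbl (suc a)) (dbl l) ℚ.+ unit (suc (dbl (a ℕ.+ l)))
                         ℚ.≤ harmonic (suc a) l ℚ.+ unit (suc (dbl a))
  harmonic-dbl-≤ a zero rewrite ℕ.+-identityʳ a = ℚ.≤-refl
  harmonic-dbl-≤ a (suc l) rewrite harmonic-dbl-step (suc a) l = begin
    (H₂ ℚ.+ (unit (dbl b) ℚ.+ unit (suc (dbl b)))) ℚ.+ unit (suc (dbl (a ℕ.+ suc l)))
      ≡⟨ cong (λ z → (H₂ ℚ.+ (unit (dbl b) ℚ.+ unit (suc (dbl b)))) ℚ.+ unit (suc (dbl z)))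
           (ℕ.+-suc a l) ⟩
    (H₂ ℚ.+ (unit (dbl b) ℚ.+ unit (suc (dbl b)))) ℚ.+ unit (suc (dbl b))
      ≡⟨ solve 3 (λ h u v → (h :+ (u :+ v)) :+ v := (h :+ u) :+ (v :+ v)) refl H₂ _ _ ⟩
    (H₂ ℚ.+ unit (dbl b)) ℚ.+ (unit (suc (dbl b)) ℚ.+ unit (suc (dbl b)))
      ≡⟨ cong (H₂ ℚ.+ unit (dbl b) ℚ.+_) (unit-half b) ⟩
    (H₂ ℚ.+ unit (dbl b)) ℚ.+ unit b
      ≤⟨ ℚ.+-monoˡ-≤ (unit b) (ℚ.+-monoʳ-≤ H₂ (unit-anti
           (s≤s (ℕ.+-monoʳ-≤ (a ℕ.+ l) (ℕ.n≤1+n (a ℕ.+ l)))))) ⟩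
    (H₂ ℚ.+ unit (suc (dbl (a ℕ.+ l)))) ℚ.+ unit b
      ≤⟨ ℚ.+-monoˡ-≤ (unit b) (harmonic-dbl-≤ a l) ⟩
    (harmonic (suc a) l ℚ.+ unit (suc (dbl a))) ℚ.+ unit b
      ≡⟨ solve 3 (λ h u v → (h :+ u) :+ v := (h :+ v) :+ u) refl
           (harmonic (suc a) l) (unit (suc (dbl a))) (unit b) ⟩
    (harmonic (suc a) l ℚ.+ unit b) ℚ.+ unit (suc (dbl a)) ∎
    where
    open ℚ.≤-Reasoning
    b = suc (a ℕ.+ l)
    H₂ = harmonic (dbl (suc a)) (dbl l)

-- ln m is the integral of 1/t over [1, m], as the limit of the lower Riemann
-- sums of mesh 2⁻ᵏ: the (i+1)-st strip has width 2⁻ᵏ and ends at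
-- (2ᵏ + i + 1) / 2ᵏ, so it contributes 1 / (2ᵏ + i + 1).
ln : (m : ℕ) .{{_ : ℕ.NonZero m}} → ℝ
ln m = mkℝ riemann isCauchy
  where
  riemann : ℕ → ℚ
  riemann k = harmonic (2 ℕ.^ k) ((m ℕ.∸ 1) ℕ.* 2 ℕ.^ k)

  strips : ∀ k → (m ℕ.∸ 1) ℕ.* 2 ℕ.^ suc k ≡ dbl ((m ℕ.∸ 1) ℕ.* 2 ℕ.^ k)
  strips k = Nat.solve 2 (λ n t → n Nat.:* (t Nat.:+ (t Nat.:+ Nat.con 0))
    Nat.:= n Nat.:* t Nat.:+ n Nat.:* t) refl (m ℕ.∸ 1) (2 ℕ.^ k)

  refine : ∀ k → riemann (suc k) ≡ harmonic (dbl (2 ℕ.^ k)) (dbl ((m ℕ.∸ 1) ℕ.* 2 ℕ.^ k))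
  refine k = cong₂ harmonic (cong (2 ℕ.^ k ℕ.+_) (ℕ.+-identityʳ (2 ℕ.^ k))) (strips k)

  increasing : ∀ k → riemann k ℚ.≤ riemann (suc k)
  increasing k = ℚ.≤-trans (harmonic-dbl-≥ (2 ℕ.^ k) ((m ℕ.∸ 1) ℕ.* 2 ℕ.^ k)) (ℚ.≤-reflexive (sym (refine k)))

  step : ∀ k → riemann (suc k) ℚ.≤ riemann k ℚ.+ unit (mesh (suc k))
  step k = subst₂ ℚ._≤_ (sym (refine k)) refl (bound (2 ℕ.^ k) (2^k≡suc-mesh k))
    where
    bound : ∀ t → t ≡ suc (mesh k) →
      harmonic (dbl t) (dbl ((m ℕ.∸ 1) ℕ.* t)) ℚ.≤
      harmonic t ((m ℕ.∸ 1) ℕ.* t) ℚ.+ unit (mesh (suc k))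
    bound _ refl = ℚ.≤-trans
      (p≤p+unit (harmonic (dbl (suc (mesh k))) (dbl ((m ℕ.∸ 1) ℕ.* suc (mesh k))))
        (suc (dbl (mesh k ℕ.+ (m ℕ.∸ 1) ℕ.* suc (mesh k)))))
      (harmonic-dbl-≤ (mesh k) ((m ℕ.∸ 1) ℕ.* suc (mesh k)))

  decreasing : ∀ k → riemann (suc k) ℚ.+ unit (mesh (suc k)) ℚ.≤ riemann k ℚ.+ unit (mesh k)
  decreasing k = ℚ.≤-trans (ℚ.+-monoˡ-≤ (unit (mesh (suc k))) (step k))
    (ℚ.≤-reflexive (trans (ℚ.+-assoc (riemann k) _ _)
      (cong (riemann k ℚ.+_) (unit-half (mesh k)))))

  above : ∀ {j k} → j ℕ.≤′ k → riemann j ℚ.≤ riemann k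
  above ℕ.≤′-refl = ℚ.≤-refl
  above {k = suc k} (ℕ.≤′-step j≤k) = ℚ.≤-trans (above j≤k) (increasing k)

  below : ∀ {j k} → j ℕ.≤′ k → riemann k ℚ.+ unit (mesh k) ℚ.≤ riemann j ℚ.+ unit (mesh j)
  below ℕ.≤′-refl = ℚ.≤-refl
  below {k = suc k} (ℕ.≤′-step j≤k) = ℚ.≤-trans (decreasing k) (below j≤k)

  upper : ∀ {j k} → j ℕ.≤′ k → riemann k ℚ.≤ riemann j ℚ.+ unit (mesh j)
  upper {j} {k} j≤k = ℚ.≤-trans
    (p≤p+unit (riemann k) (mesh k)) (below j≤k)

  isCauchy : IsCauchy riemann
  isCauchy ε 0<ε with archimedean ε 0<ε
  ... | N , small = N , λ i j N≤i N≤j → ℚ.≤-<-trans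
    (within (above (ℕ.≤⇒≤′ N≤i)) (upper (ℕ.≤⇒≤′ N≤i)) (above (ℕ.≤⇒≤′ N≤j)) (upper (ℕ.≤⇒≤′ N≤j)))
    small

_^-_ : (m n : ℕ) .{{_ : ℕ.NonZero m}} → ℚ
m ^- n = (+ 1 / m ℕ.^ n) {{ℕ.m^n≢0 m n}}

subsets : ∀ n → List (Subset n)
subsets zero    = [] ∷ []
subsets (suc n) = map (inside ∷_) (subsets n) ++ map (outside ∷_) (subsets n)

-- Independent events, the i-th of probability q i: the probability that
-- exactly those with index in e occur.
weight : ∀ {n} → (Fin n → ℝ) → Subset n → ℝ
weight q e = productℝ (map (λ i → if lookup e i then q i else 1ℝ -ℝ q i) (allFin _))

Pr : ∀ {n ℓ} {E : Pred (Subset n) ℓ} → (Fin n → ℝ) → Decidable E → ℝ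
Pr q E? = sumℝ (map (weight q) (filter E? (subsets _)))

-- Programs for a random-access machine whose memory cells are indexed by ℕ and
-- hold natural numbers. The left side of a ≔ e is an address: mem (lit 2) ≔ e
-- writes to the cell whose address is stored in cell 2. The only access to x and S is the command
-- compare a j, which compares x with the element of S whose 0-based index is
-- the value of j, and sets the cell at address a to 1 if that element is
-- reported to be smaller than x and to 0 otherwise (also if there is no such
-- element).
--
-- Each executed command and each evaluated guard takes one unit of time. As a
-- program is fixed before its input, its expressions have bounded size, so
-- this is the unit-cost measure up to a constant factor. There is no
-- multiplication: t steps enlarge the numbers in use by O(t) bits only, so unit
-- cost is not abused by packing long computations into huge numbers.

data Expr : Set where
  lit     : ℕ → Expr
  mem     : Expr → Expr
  _⊕_ _⊖_ : Expr → Expr → Expr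
  half    : Expr → Expr

data Guard : Set where
  _⊏_ : Expr → Expr → Guard

data Command : Set where
  _≔_     : Expr → Expr → Command
  compare : Expr → Expr → Command
  branch  : Guard → List Command → List Command → Command
  while   : Guard → List Command → Command

Program : Set
Program = List Command

Memory : Set
Memory = ℕ → ℕ

⟦_⟧ : Expr → Memory → ℕ
⟦ lit n ⟧  σ = n
⟦ mem a ⟧  σ = σ (⟦ a ⟧ σ)
⟦ e ⊕ f ⟧  σ = ⟦ e ⟧ σ ℕ.+ ⟦ f ⟧ σ
⟦ e ⊖ f ⟧  σ = ⟦ e ⟧ σ ℕ.∸ ⟦ f ⟧ σ
⟦ half e ⟧ σ = ⌊ ⟦ e ⟧ σ /2⌋

holds : Guard → Memory → Bool
holds (e ⊏ f) σ = ⟦ e ⟧ σ ℕ.<ᵇ ⟦ f ⟧ σ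

update : Memory → ℕ → ℕ → Memory
update σ a v b = if a ℕ.≡ᵇ b then v else σ b

record Config : Set where
  constructor config
  field
    pending : List Command
    memory  : Memory

open Config public

-- The argument reported gives the answers to comparisons with x.
step : (reported : ℕ → Bool) → Config → Config
step reported (config []                   σ) = config [] σ
step reported (config (a ≔ e         ∷ cs) σ) = config cs (update σ (⟦ a ⟧ σ) (⟦ e ⟧ σ))
step reported (config (compare a j   ∷ cs) σ) =
  config cs (update σ (⟦ a ⟧ σ) (if reported (⟦ j ⟧ σ) then 1 else 0))
step reported (config (branch g cs₁ cs₂ ∷ cs) σ) =
  config ((if holds g σ then cs₁ else cs₂) ++ cs) σ
step reported (config (while g body  ∷ cs) σ) =
  config (if holds g σ then body ++ while g body ∷ cs else cs) σ

run : (reported : ℕ → Bool) → ℕ → Config → Config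
run reported zero    κ = κ
run reported (suc t) κ = run reported t (step reported κ)

-- On input m and d, these are in cells 0 and 1, and all other cells contain 0.
start : Program → (m d : ℕ) → Config
start prog m d = config prog λ { 0 → m ; 1 → d ; _ → 0 }

Halted : Config → Set
Halted κ = pending κ ≡ []

output : Config → ℕ
output κ = memory κ 0

module Dislocation {c ℓ₁ ℓ₂ : Level} (O : StrictTotalOrder c ℓ₁ ℓ₂) where
  open StrictTotalOrder O using (Carrier; _≈_) public
  open StrictTotalOrder O using (_<?_)

  rank : ∀ {m} → Carrier → (Fin m → Carrier) → ℕ
  rank x S = 1 ℕ.+ length (filter (λ i → S i <? x) (allFin _))

  pos : ∀ {m} → Fin m → ℕ
  pos i = 1 ℕ.+ toℕ i

  disl : ∀ {m} → (Fin m → Carrier) → ℕ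
  disl S = max 0 (map (λ i → ℕ.∣ pos i - rank (S i) S ∣) (allFin _))

  -- The answers to comparisons of x with S if exactly those with the elements
  -- whose index is in e are wrong.
  answers : ∀ {m} → (Fin m → Carrier) → Carrier → Subset m → ℕ → Bool
  answers {m} S x e j with j ℕ.<? m
  ... | yes j<m = does (S (fromℕ< j<m) <? x) xor lookup e (fromℕ< j<m)
  ... | no  _   = false

{-# OPTIONS --safe #-}
module Submission where

-- Round positions to blocks of w ≥ 2d + (number of queries) elements. Except in
-- the few blocks around x, all elements of a block compare alike with x, and the
-- u-th query at block k asks element wk + u, so every query is fresh. The search
-- walks on a binary tree of overlapping intervals: a majority of constantly many
-- answers decides whether x lies inside the current interval and which child to
-- enter, and the walk backtracks if x appears to lie outside. Children overlap so
-- much that if the current interval passes the test, even by ambiguous answers, the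
-- correct child contains x with a margin. Hence twice the number of intervals on the
-- stack that do not contain x with a margin, plus the number of levels left, drops
-- in each step that is not yet at a good leaf, unless a test is spoiled by errors;
-- a spoiled test raises it by a constant only. So a constant fraction of the 64ℓ
-- steps, for ℓ ≈ log₂ m, is spent at one of 14 leaves near x unless there are ℓ
-- spoiled tests, and any leaf visited more than 4ℓ times is near x. The expectation
-- of M ^ (number of spoiled tests) is at most 8 ^ 64ℓ, since each test is spoiled
-- with probability at most 1/M, so ℓ spoiled tests have probability at most m⁻⁶.

open import Defs
open import Algebra.Bundles using (CommutativeRing)
import Algebra.Properties.Semiring.Exp as Exp
open import Data.Bool using (Bool; true; false; if_then_else_; not; _∧_; _∨_; _xor_; T)
open import Data.Bool.Properties using (∨-zeroʳ; T-≡; ¬-not; xor-identityʳ)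
open import Data.Fin as Fin using (Fin; fromℕ<)
import Data.Fin.Properties as Fin
open import Data.Fin.Subset using (Subset; inside; outside) renaming (⊥ to ∅)
import Data.Integer as ℤ
import Data.Integer.Properties as ℤ
open import Data.List using (List; []; _∷_; _++_; map; filter; foldr; length; drop; allFin)
open import Data.List.Extrema.Nat using (xs≤max)
open import Data.List.Membership.Propositional using (_∈_)
open import Data.List.Membership.Propositional.Properties using (∈-map⁺; ∈-allFin)
open import Data.List.Properties using (map-tabulate; ++-assoc; length-filter; length-tabulate)
import Data.List.Relation.Unary.All as All
import Data.List.Relation.Unary.Any as Any
open import Data.Nat as ℕ using (ℕ; zero; suc; pred; NonZero; _+_; _*_; _∸_; _^_; _≤_; _<_; _≤?_; _≤ᵇ_; _<ᵇ_; _≡ᵇ_;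
  ∣_-_∣; ⌊_/2⌋; z≤n; s≤s)
import Data.Nat.Properties as ℕ
open import Data.Nat.DivMod using (_%_; _/_; m≡m%n+[m/n]*n; m%n<n; m/n*n≤m; [m+kn]%n≡m%n; m<n⇒m%n≡m)
open import Data.Nat.Logarithm using (⌊log₂_⌋; ⌊log₂⌋-mono-≤; ⌊log₂⌊n/2⌋⌋≡⌊log₂n⌋∸1; ⌊log₂[2^n]⌋≡n)
open import Data.Nat.Tactic.RingSolver using (solve-∀) renaming (solve to ring)
open import Data.Product using (Σ; Σ-syntax; ∃; _×_; _,_; proj₁; proj₂)
open import Data.Rational as ℚ using (ℚ; mkℚ; 0ℚ; 1ℚ; ½; *<*; toℚᵘ)
import Data.Rational.Properties as ℚ
open import Data.Rational.Solver using (module +-*-Solver)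
open import Data.Rational.Unnormalised as ℚᵘ using (mkℚᵘ; *≡*; *≤*)
import Data.Rational.Unnormalised.Properties as ℚᵘ
open import Data.Sum using (_⊎_; inj₁; inj₂)
open import Data.Unit using (⊤; tt)
open import Data.Vec using (lookup; _[_]≔_) renaming ([] to []ᵥ; _∷_ to infixr 5 _∷ᵥ_)
open import Data.Vec.Properties using (lookup∘update; lookup∘update′; lookup-replicate)
open import Function using (_∘_)
open import Function.Bundles using (Equivalence)
open import Function.Definitions using (Injective)
open import Relation.Binary.Bundles using (StrictTotalOrder)
open import Relation.Binary.Definitions using (tri<; tri≈; tri>)
open import Relation.Binary.PropositionalEquality
open import Relation.Nullary using (¬_; Dec; yes; no; does; contradiction)
open import Relation.Nullary.Decidable using (_×-dec_; _⊎-dec_; dec-true; dec-false)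
open import Relation.Unary using (Pred; Decidable)

open Exp (CommutativeRing.semiring ℚ.+-*-commutativeRing) using () renaming (_^_ to _^ℚ_)

-- Inequalities and expectations over the real numbers

-- Which element is asked depends on earlier answers, so the tests of a run are not a fixed family
-- of independent events, and conditional probabilities would have to be carried through the whole
-- search. This is avoided by writing the search a second time, as a decision tree `walk` whose
-- leaves also carry a ghost count of the spoiled tests. A bound on an expectation is then certified
-- question by question (`Bounded`), and freshness turns such a certificate into a bound for the
-- product measure. That the machine program computes the same output is a separate, purely
-- deterministic matter.
--
-- Visits are counted because the node at which the walk happens to stop means little: its last
-- tests may be the spoiled ones. The histogram only needs a bound on the total number of spoiled
-- tests, not on when they occur.
--
-- The error probabilities are real numbers. They are replaced at once by a rational bound that is
-- still below one half, so that certificates and constants are arithmetic in `ℚ`; only the final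
-- comparison involves limits.

private
  module Identities where
    open +-*-Solver

    add-sub : ∀ a b → a ≡ b ℚ.+ (a ℚ.- b)
    add-sub = solve 2 (λ a b → a := b :+ (a :- b)) refl

    sub-add : ∀ p q → (q ℚ.- p) ℚ.+ p ≡ q
    sub-add = solve 2 (λ p q → (q :- p) :+ p := q) refl

    add-swap-sub : ∀ a b c → (b ℚ.+ c) ℚ.- a ≡ (b ℚ.- a) ℚ.+ c
    add-swap-sub = solve 3 (λ a b c → (b :+ c) :- a := (b :- a) :+ c) refl

    add-twice : ∀ a b c → (a ℚ.+ c) ℚ.+ (b ℚ.+ c) ≡ (a ℚ.+ b) ℚ.+ (c ℚ.+ c)
    add-twice = solve 3 (λ a b c → (a :+ c) :+ (b :+ c) := (a :+ b) :+ (c :+ c)) refl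

    shifted-product : ∀ x y d → (x ℚ.+ d) ℚ.* (y ℚ.+ d) ≡ x ℚ.* y ℚ.+ (x ℚ.+ y ℚ.+ d) ℚ.* d
    shifted-product = solve 3 (λ x y d → (x :+ d) :* (y :+ d) := x :* y :+ (x :+ y :+ d) :* d) refl

    scaled-sub : ∀ c x y e → c ℚ.* (y ℚ.- x) ℚ.+ e ≡ (c ℚ.* y ℚ.+ e) ℚ.- c ℚ.* x
    scaled-sub = solve 4 (λ c x y e → c :* (y :- x) :+ e := (c :* y :+ e) :- c :* x) refl

    mix-same : ∀ q v → q ℚ.* v ℚ.+ (1ℚ ℚ.- q) ℚ.* v ≡ v
    mix-same = solve 2 (λ q v → q :* v :+ (con 1ℚ :- q) :* v := v) refl

    mix-1- : ∀ q u v → q ℚ.* (1ℚ ℚ.- u) ℚ.+ (1ℚ ℚ.- q) ℚ.* (1ℚ ℚ.- v) ≡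
                       1ℚ ℚ.- (q ℚ.* u ℚ.+ (1ℚ ℚ.- q) ℚ.* v)
    mix-1- = solve 3 (λ q u v → q :* (con 1ℚ :- u) :+ (con 1ℚ :- q) :* (con 1ℚ :- v)
                   := con 1ℚ :- (q :* u :+ (con 1ℚ :- q) :* v)) refl

    mix-mix : ∀ q r a b c d →
      q ℚ.* (r ℚ.* a ℚ.+ (1ℚ ℚ.- r) ℚ.* b) ℚ.+ (1ℚ ℚ.- q) ℚ.* (r ℚ.* c ℚ.+ (1ℚ ℚ.- r) ℚ.* d) ≡
      r ℚ.* (q ℚ.* a ℚ.+ (1ℚ ℚ.- q) ℚ.* c) ℚ.+ (1ℚ ℚ.- r) ℚ.* (q ℚ.* b ℚ.+ (1ℚ ℚ.- q) ℚ.* d)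
    mix-mix = solve 6 (λ q r a b c d →
      q :* (r :* a :+ (con 1ℚ :- r) :* b) :+ (con 1ℚ :- q) :* (r :* c :+ (con 1ℚ :- r) :* d)
        := r :* (q :* a :+ (con 1ℚ :- q) :* c) :+ (con 1ℚ :- r) :* (q :* b :+ (con 1ℚ :- q) :* d)) refl
open Identities

infix 4 _≃ℝ_

-- Finer than equality of reals. The operations act pointwise on sequences, so identities of `ℚ`
-- carry over in this strong form.
_≃ℝ_ : ℝ → ℝ → Set
x ≃ℝ y = ∀ n → seq x n ≡ seq y n

0<½* : ∀ {ε} → 0ℚ ℚ.< ε → 0ℚ ℚ.< ½ ℚ.* ε
0<½* {ε} 0<ε = subst (ℚ._< ½ ℚ.* ε) (ℚ.*-zeroʳ ½) (ℚ.*-monoʳ-<-pos ½ 0<ε)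

½*+½* : ∀ ε → ½ ℚ.* ε ℚ.+ ½ ℚ.* ε ≡ ε
½*+½* ε = trans (sym (ℚ.*-distribʳ-+ ε ½ ½)) (ℚ.*-identityˡ ε)

p≤p+q : ∀ {p q} → 0ℚ ℚ.≤ q → p ℚ.≤ p ℚ.+ q
p≤p+q {p} {q} 0≤q = subst (ℚ._≤ p ℚ.+ q) (ℚ.+-identityʳ p) (ℚ.+-monoʳ-≤ p 0≤q)

0≤* : ∀ {p q} → 0ℚ ℚ.≤ p → 0ℚ ℚ.≤ q → 0ℚ ℚ.≤ p ℚ.* q
0≤* {p} {q} 0≤p 0≤q = subst (ℚ._≤ p ℚ.* q) (ℚ.*-zeroʳ p)
  (ℚ.*-monoˡ-≤-nonNeg p {{ℚ.nonNegative 0≤p}} 0≤q)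

p≤q⇒0≤q-p : ∀ {p q} → p ℚ.≤ q → 0ℚ ℚ.≤ q ℚ.- p
p≤q⇒0≤q-p {p} {q} p≤q = subst (ℚ._≤ q ℚ.- p) (ℚ.+-inverseʳ p) (ℚ.+-monoˡ-≤ (ℚ.- p) p≤q)

0≤q-p⇒p≤q : ∀ {p q} → 0ℚ ℚ.≤ q ℚ.- p → p ℚ.≤ q
0≤q-p⇒p≤q {p} {q} 0≤ = subst₂ ℚ._≤_ (ℚ.+-identityˡ p)
  (sub-add p q) (ℚ.+-monoˡ-≤ p 0≤)

≤ℝ-reflexive : ∀ {x y} → x ≃ℝ y → x ≤ℝ y
≤ℝ-reflexive x≃y ε 0<ε = 0 , λ n _ →
  ℚ.≤-trans (ℚ.≤-reflexive (x≃y n)) (p≤p+q (ℚ.<⇒≤ 0<ε))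

≤ℝ-trans : ∀ {x y z} → x ≤ℝ y → y ≤ℝ z → x ≤ℝ z
≤ℝ-trans {x} {y} {z} x≤y y≤z ε 0<ε with x≤y _ (0<½* 0<ε) | y≤z _ (0<½* 0<ε)
... | M , p | N , q = M ℕ.⊔ N , λ n n≥ → begin
  seq x n                               ≤⟨ p n (ℕ.m⊔n≤o⇒m≤o M N n≥) ⟩
  seq y n ℚ.+ ½ ℚ.* ε                   ≤⟨ ℚ.+-monoˡ-≤ (½ ℚ.* ε) (q n (ℕ.m⊔n≤o⇒n≤o M N n≥)) ⟩
  seq z n ℚ.+ ½ ℚ.* ε ℚ.+ ½ ℚ.* ε       ≡⟨ ℚ.+-assoc (seq z n) _ _ ⟩
  seq z n ℚ.+ (½ ℚ.* ε ℚ.+ ½ ℚ.* ε)     ≡⟨ cong (seq z n ℚ.+_) (½*+½* ε) ⟩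
  seq z n ℚ.+ ε                         ∎
  where open ℚ.≤-Reasoning

+ℝ-mono-≤ : ∀ {x y u v} → x ≤ℝ y → u ≤ℝ v → x +ℝ u ≤ℝ y +ℝ v
+ℝ-mono-≤ {x} {y} {u} {v} x≤y u≤v ε 0<ε with x≤y _ (0<½* 0<ε) | u≤v _ (0<½* 0<ε)
... | M , p | N , q = M ℕ.⊔ N , λ n n≥ → begin
  seq x n ℚ.+ seq u n
    ≤⟨ ℚ.+-mono-≤ (p n (ℕ.m⊔n≤o⇒m≤o M N n≥)) (q n (ℕ.m⊔n≤o⇒n≤o M N n≥)) ⟩
  (seq y n ℚ.+ ½ ℚ.* ε) ℚ.+ (seq v n ℚ.+ ½ ℚ.* ε)
    ≡⟨ add-twice (seq y n) (seq v n) (½ ℚ.* ε) ⟩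
  (seq y n ℚ.+ seq v n) ℚ.+ (½ ℚ.* ε ℚ.+ ½ ℚ.* ε)
    ≡⟨ cong (seq y n ℚ.+ seq v n ℚ.+_) (½*+½* ε) ⟩
  (seq y n ℚ.+ seq v n) ℚ.+ ε ∎
  where
  open ℚ.≤-Reasoning

fromℚ-mono-≤ : ∀ {p q} → p ℚ.≤ q → fromℚ p ≤ℝ fromℚ q
fromℚ-mono-≤ p≤q ε 0<ε = 0 , λ _ _ → ℚ.≤-trans p≤q (p≤p+q (ℚ.<⇒≤ 0<ε))

x≤y⇒0≤y-x : ∀ {x y} → x ≤ℝ y → 0ℝ ≤ℝ y -ℝ x
x≤y⇒0≤y-x {x} {y} x≤y ε 0<ε with x≤y ε 0<ε
... | N , p = N , λ n n≥ → subst (0ℚ ℚ.≤_)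
  (add-swap-sub (seq x n) (seq y n) ε)
  (p≤q⇒0≤q-p (p n n≥))

eventually-bounded : ∀ x → ∃ λ B → 0ℚ ℚ.≤ B × ∃ λ N → ∀ n → N ℕ.≤ n → seq x n ℚ.≤ B
eventually-bounded x with cauchy x 1ℚ (*<* (ℤ.+<+ (ℕ.s≤s ℕ.z≤n)))
... | N , close = ∣xN∣ ℚ.+ 1ℚ
  , ℚ.≤-trans (ℚ.0≤∣p∣ (seq x N)) (p≤p+q (ℚ.<⇒≤ (*<* (ℤ.+<+ (ℕ.s≤s ℕ.z≤n)))))
  , N , λ n n≥ → begin
    seq x n                          ≤⟨ p≤∣p∣ (seq x n) ⟩
    ℚ.∣ seq x n ∣                    ≡⟨ cong ℚ.∣_∣ (add-sub (seq x n) (seq x N)) ⟩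
    ℚ.∣ seq x N ℚ.+ (seq x n ℚ.- seq x N) ∣ ≤⟨ ℚ.∣p+q∣≤∣p∣+∣q∣ (seq x N) _ ⟩
    ∣xN∣ ℚ.+ ℚ.∣ seq x n ℚ.- seq x N ∣ ≤⟨ ℚ.+-monoʳ-≤ ∣xN∣ (ℚ.<⇒≤ (close n N n≥ ℕ.≤-refl)) ⟩
    ∣xN∣ ℚ.+ 1ℚ ∎
  where
  open ℚ.≤-Reasoning
  ∣xN∣ = ℚ.∣ seq x N ∣
  p≤∣p∣ : ∀ p → p ℚ.≤ ℚ.∣ p ∣
  p≤∣p∣ p with ℚ.≤-total 0ℚ p
  ... | inj₁ 0≤p = ℚ.≤-reflexive (sym (ℚ.0≤p⇒∣p∣≡p 0≤p))
  ... | inj₂ p≤0 = ℚ.≤-trans p≤0 (ℚ.0≤∣p∣ p)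

-- xy + δ(x + y + δ) = (x + δ)(y + δ), where δ is so small that the correction
-- is at most ε for bounded x and y.
*ℝ-nonNeg : ∀ {x y} → 0ℝ ≤ℝ x → 0ℝ ≤ℝ y → 0ℝ ≤ℝ x *ℝ y
*ℝ-nonNeg {x} {y} 0≤x 0≤y ε 0<ε =
  let A , 0≤A , Na , x≤A = eventually-bounded x
      B , 0≤B , Nb , y≤B = eventually-bounded y
      C = A ℚ.+ B ℚ.+ 1ℚ
      0<C : 0ℚ ℚ.< C
      0<C = ℚ.+-mono-≤-< {0ℚ} {A ℚ.+ B} {0ℚ} {1ℚ} (ℚ.+-mono-≤ {0ℚ} {A} {0ℚ} {B} 0≤A 0≤B)
              (*<* (ℤ.+<+ (ℕ.s≤s ℕ.z≤n)))
      η , 0<η , Cη≡ε = divide 0<C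
      δ = η ℚ.⊓ 1ℚ
      0<δ = ⊓-pos 0<η
      Nx , -δ≤x = 0≤x δ 0<δ
      Ny , -δ≤y = 0≤y δ 0<δ
      open ℚ.≤-Reasoning
      in (Na ℕ.⊔ Nb) ℕ.⊔ (Nx ℕ.⊔ Ny) , λ n n≥ →
     let n≥ab = ℕ.m⊔n≤o⇒m≤o (Na ℕ.⊔ Nb) (Nx ℕ.⊔ Ny) n≥
         n≥xy = ℕ.m⊔n≤o⇒n≤o (Na ℕ.⊔ Nb) (Nx ℕ.⊔ Ny) n≥
         X = seq x n
         Y = seq y n
     in begin
       0ℚ
         ≤⟨ 0≤* (-δ≤x n (ℕ.m⊔n≤o⇒m≤o Nx Ny n≥xy)) (-δ≤y n (ℕ.m⊔n≤o⇒n≤o Nx Ny n≥xy)) ⟩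
       (X ℚ.+ δ) ℚ.* (Y ℚ.+ δ)
         ≡⟨ shifted-product X Y δ ⟩
       X ℚ.* Y ℚ.+ (X ℚ.+ Y ℚ.+ δ) ℚ.* δ
         ≤⟨ ℚ.+-monoʳ-≤ (X ℚ.* Y) (ℚ.*-monoʳ-≤-nonNeg δ {{ℚ.nonNegative (ℚ.<⇒≤ 0<δ)}}
              (ℚ.+-mono-≤ (ℚ.+-mono-≤ (x≤A n (ℕ.m⊔n≤o⇒m≤o Na Nb n≥ab)) (y≤B n (ℕ.m⊔n≤o⇒n≤o Na Nb n≥ab)))
                (ℚ.p⊓q≤q η 1ℚ))) ⟩
       X ℚ.* Y ℚ.+ C ℚ.* δ
         ≤⟨ ℚ.+-monoʳ-≤ (X ℚ.* Y) (ℚ.*-monoˡ-≤-nonNeg C {{ℚ.nonNegative (ℚ.<⇒≤ 0<C)}} (ℚ.p⊓q≤p η 1ℚ)) ⟩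
       X ℚ.* Y ℚ.+ C ℚ.* η
         ≡⟨ cong (X ℚ.* Y ℚ.+_) Cη≡ε ⟩
       X ℚ.* Y ℚ.+ ε ∎
  where
  divide : ∀ {c} → 0ℚ ℚ.< c → ∃ λ δ → 0ℚ ℚ.< δ × c ℚ.* δ ≡ ε
  divide {c} 0<c = ℚ.1/ c ℚ.* ε
    , subst (ℚ._< ℚ.1/ c ℚ.* ε) (ℚ.*-zeroʳ (ℚ.1/ c))
        (ℚ.*-monoʳ-<-pos (ℚ.1/ c) {{ℚ.1/pos⇒pos c}} 0<ε)
    , trans (sym (ℚ.*-assoc c (ℚ.1/ c) ε))
        (trans (cong (ℚ._* ε) (ℚ.*-inverseʳ c)) (ℚ.*-identityˡ ε))
    where
    instance
      c-positive : ℚ.Positive c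
      c-positive = ℚ.positive 0<c
      c-nonZero : ℚ.NonZero c
      c-nonZero = ℚ.pos⇒nonZero c
  ⊓-pos : ∀ {η} → 0ℚ ℚ.< η → 0ℚ ℚ.< η ℚ.⊓ 1ℚ
  ⊓-pos {η} 0<η with ℚ.⊓-sel η 1ℚ
  ... | inj₁ eq = subst (0ℚ ℚ.<_) (sym eq) 0<η
  ... | inj₂ eq = subst (0ℚ ℚ.<_) (sym eq) (*<* (ℤ.+<+ (ℕ.s≤s ℕ.z≤n)))

*ℝ-monoʳ-≤ : ∀ {c x y} → 0ℝ ≤ℝ c → x ≤ℝ y → c *ℝ x ≤ℝ c *ℝ y
*ℝ-monoʳ-≤ {c} {x} {y} 0≤c x≤y ε 0<ε =
  let N , p = *ℝ-nonNeg {c} {y -ℝ x} 0≤c (x≤y⇒0≤y-x {x} {y} x≤y) ε 0<ε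
  in N , λ n n≥ → 0≤q-p⇒p≤q (subst (0ℚ ℚ.≤_) (scaled-sub (seq c n) (seq x n) (seq y n) ε) (p n n≥))

Ex : ∀ {n} → (Fin n → ℝ) → (Subset n → ℝ) → ℝ
Ex {zero}  q f = f []ᵥ
Ex {suc n} q f = q Fin.zero *ℝ Ex (q ∘ Fin.suc) (λ e → f (inside ∷ᵥ e))
              +ℝ (1ℝ -ℝ q Fin.zero) *ℝ Ex (q ∘ Fin.suc) (λ e → f (outside ∷ᵥ e))

Ex-cong : ∀ {n} (q : Fin n → ℝ) {f g} → (∀ e → f e ≃ℝ g e) → Ex q f ≃ℝ Ex q g
Ex-cong {zero}  q f≃g k = f≃g []ᵥ k
Ex-cong {suc n} q {f} {g} f≃g k = cong₂ (λ a b → seq (q Fin.zero) k ℚ.* a ℚ.+ (1ℚ ℚ.- seq (q Fin.zero) k) ℚ.* b)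
  (Ex-cong (q ∘ Fin.suc) {λ e → f (inside ∷ᵥ e)}  {λ e → g (inside ∷ᵥ e)}  (λ e → f≃g (inside ∷ᵥ e)) k)
  (Ex-cong (q ∘ Fin.suc) {λ e → f (outside ∷ᵥ e)} {λ e → g (outside ∷ᵥ e)} (λ e → f≃g (outside ∷ᵥ e)) k)

IsProbability : ℝ → Set
IsProbability q = 0ℝ ≤ℝ q × q ≤ℝ 1ℝ

mix-mono : ∀ {q a b c d} → IsProbability q → a ≤ℝ c → b ≤ℝ d →
  q *ℝ a +ℝ (1ℝ -ℝ q) *ℝ b ≤ℝ q *ℝ c +ℝ (1ℝ -ℝ q) *ℝ d
mix-mono {q} {a} {b} {c} {d} (0≤q , q≤1) a≤c b≤d =
  +ℝ-mono-≤ {q *ℝ a} {q *ℝ c} {(1ℝ -ℝ q) *ℝ b} {(1ℝ -ℝ q) *ℝ d}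
    (*ℝ-monoʳ-≤ {q} {a} {c} 0≤q a≤c)
    (*ℝ-monoʳ-≤ {1ℝ -ℝ q} {b} {d} (x≤y⇒0≤y-x {q} {1ℝ} q≤1) b≤d)

Ex-mono : ∀ {n} {q : Fin n → ℝ} → (∀ i → IsProbability (q i)) → ∀ {f g} →
  (∀ e → f e ≤ℝ g e) → Ex q f ≤ℝ Ex q g
Ex-mono {zero}      isP         f≤g = f≤g []ᵥ
Ex-mono {suc n} {q} isP {f} {g} f≤g = mix-mono {q Fin.zero}
  {Ex (q ∘ Fin.suc) (λ e → f (inside ∷ᵥ e))} {Ex (q ∘ Fin.suc) (λ e → f (outside ∷ᵥ e))}
  {Ex (q ∘ Fin.suc) (λ e → g (inside ∷ᵥ e))} {Ex (q ∘ Fin.suc) (λ e → g (outside ∷ᵥ e))}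
  (isP Fin.zero) (ih inside) (ih outside)
  where
  ih : ∀ b → Ex (q ∘ Fin.suc) (λ e → f (b ∷ᵥ e)) ≤ℝ Ex (q ∘ Fin.suc) (λ e → g (b ∷ᵥ e))
  ih b = Ex-mono {q = q ∘ Fin.suc} (isP ∘ Fin.suc) {λ e → f (b ∷ᵥ e)} {λ e → g (b ∷ᵥ e)} (λ e → f≤g (b ∷ᵥ e))

Ex-const : ∀ {n} (q : Fin n → ℝ) v → Ex q (λ _ → v) ≃ℝ v
Ex-const {zero}  q v k = refl
Ex-const {suc n} q v k = trans
  (cong₂ (λ a b → seq (q Fin.zero) k ℚ.* a ℚ.+ (1ℚ ℚ.- seq (q Fin.zero) k) ℚ.* b)
    (Ex-const (q ∘ Fin.suc) v k) (Ex-const (q ∘ Fin.suc) v k))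
  (mix-same (seq (q Fin.zero) k) (seq v k))

Ex-1- : ∀ {n} (q : Fin n → ℝ) f → Ex q (λ e → 1ℝ -ℝ f e) ≃ℝ 1ℝ -ℝ Ex q f
Ex-1- {zero}  q f k = refl
Ex-1- {suc n} q f k = trans
  (cong₂ (λ a b → seq (q Fin.zero) k ℚ.* a ℚ.+ (1ℚ ℚ.- seq (q Fin.zero) k) ℚ.* b)
    (Ex-1- (q ∘ Fin.suc) (λ e → f (inside ∷ᵥ e)) k) (Ex-1- (q ∘ Fin.suc) (λ e → f (outside ∷ᵥ e)) k))
  (mix-1-
    (seq (q Fin.zero) k) (seq (Ex (q ∘ Fin.suc) (λ e → f (inside ∷ᵥ e))) k)
    (seq (Ex (q ∘ Fin.suc) (λ e → f (outside ∷ᵥ e))) k))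

-- `f (e [ i ]≔ b)` ignores the value drawn at `i`, so any single coordinate can be drawn first,
-- wherever it stands in the recursion of `Ex`. This allows an error to be drawn at the moment its
-- question is asked.
Ex-split : ∀ {n} (q : Fin n → ℝ) f i → Ex q f ≃ℝ
  q i *ℝ Ex q (λ e → f (e [ i ]≔ inside)) +ℝ (1ℝ -ℝ q i) *ℝ Ex q (λ e → f (e [ i ]≔ outside))
Ex-split q f Fin.zero k =
  sym (cong₂ (λ a b → seq (q Fin.zero) k ℚ.* a ℚ.+ (1ℚ ℚ.- seq (q Fin.zero) k) ℚ.* b)
    (mix-same (seq (q Fin.zero) k) (seq (Ex (q ∘ Fin.suc) (λ e → f (inside ∷ᵥ e))) k))
    (mix-same (seq (q Fin.zero) k) (seq (Ex (q ∘ Fin.suc) (λ e → f (outside ∷ᵥ e))) k)))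
Ex-split q f (Fin.suc i) k = trans
  (cong₂ (λ a b → seq (q Fin.zero) k ℚ.* a ℚ.+ (1ℚ ℚ.- seq (q Fin.zero) k) ℚ.* b)
    (Ex-split (q ∘ Fin.suc) (λ e → f (inside ∷ᵥ e)) i k)
    (Ex-split (q ∘ Fin.suc) (λ e → f (outside ∷ᵥ e)) i k))
  (mix-mix (seq (q Fin.zero) k) (seq (q (Fin.suc i)) k)
    (E inside inside) (E inside outside) (E outside inside) (E outside outside))
  where
  E : Bool → Bool → ℚ
  E b c = seq (Ex (q ∘ Fin.suc) (λ e → f (b ∷ᵥ (e [ i ]≔ c)))) k

sum-of product-of : ∀ {a} {A : Set a} → (A → ℚ) → List A → ℚ
sum-of     f = foldr (λ x s → f x ℚ.+ s) 0ℚ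
product-of f = foldr (λ x s → f x ℚ.* s) 1ℚ

seq-sumℝ : ∀ {a} {A : Set a} (f : A → ℝ) xs k → seq (sumℝ (map f xs)) k ≡ sum-of (λ x → seq (f x) k) xs
seq-sumℝ f []       k = refl
seq-sumℝ f (x ∷ xs) k = cong (seq (f x) k ℚ.+_) (seq-sumℝ f xs k)

seq-productℝ : ∀ {a} {A : Set a} (f : A → ℝ) xs k →
  seq (productℝ (map f xs)) k ≡ product-of (λ x → seq (f x) k) xs
seq-productℝ f []       k = refl
seq-productℝ f (x ∷ xs) k = cong (seq (f x) k ℚ.*_) (seq-productℝ f xs k)

product-of-map : ∀ {a b} {A : Set a} {B : Set b} (f : B → ℚ) (g : A → B) xs →
  product-of f (map g xs) ≡ product-of (f ∘ g) xs
product-of-map f g []       = refl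
product-of-map f g (x ∷ xs) = cong (f (g x) ℚ.*_) (product-of-map f g xs)

sum-of-map : ∀ {a b} {A : Set a} {B : Set b} (f : B → ℚ) (g : A → B) xs →
  sum-of f (map g xs) ≡ sum-of (f ∘ g) xs
sum-of-map f g []       = refl
sum-of-map f g (x ∷ xs) = cong (f (g x) ℚ.+_) (sum-of-map f g xs)

sum-of-++ : ∀ {a} {A : Set a} (f : A → ℚ) xs ys → sum-of f (xs ++ ys) ≡ sum-of f xs ℚ.+ sum-of f ys
sum-of-++ f []       ys = sym (ℚ.+-identityˡ _)
sum-of-++ f (x ∷ xs) ys = trans (cong (f x ℚ.+_) (sum-of-++ f xs ys)) (sym (ℚ.+-assoc (f x) _ _))

sum-of-scale : ∀ {a} {A : Set a} {f g : A → ℚ} c → (∀ x → f x ≡ c ℚ.* g x) → ∀ xs →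
  sum-of f xs ≡ c ℚ.* sum-of g xs
sum-of-scale c eq []       = sym (ℚ.*-zeroʳ c)
sum-of-scale c eq (x ∷ xs) = trans (cong₂ ℚ._+_ (eq x) (sum-of-scale c eq xs)) (sym (ℚ.*-distribˡ-+ c _ _))

indicatorℚ : Bool → ℚ
indicatorℚ b = if b then 1ℚ else 0ℚ

sum-of-filter : ∀ {a ℓ} {A : Set a} {P : Pred A ℓ} (f : A → ℚ) (P? : Decidable P) xs →
  sum-of f (filter P? xs) ≡ sum-of (λ x → f x ℚ.* indicatorℚ (does (P? x))) xs
sum-of-filter f P? []       = refl
sum-of-filter f P? (x ∷ xs) with does (P? x)
... | true  = cong₂ ℚ._+_ (sym (ℚ.*-identityʳ (f x))) (sum-of-filter f P? xs)
... | false = trans (sym (ℚ.+-identityˡ _)) (cong₂ ℚ._+_ (sym (ℚ.*-zeroʳ (f x))) (sum-of-filter f P? xs))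

-- The value of a product of reals or of Ex at index k depends only on the
-- values at k, so identities between them are identities in ℚ.
occurs : ∀ {n} → (Fin n → ℚ) → Subset n → Fin n → ℚ
occurs q e i = if lookup e i then q i else 1ℚ ℚ.- q i

Exℚ : ∀ {n} → (Fin n → ℚ) → (Subset n → ℚ) → ℚ
Exℚ {zero}  q f = f []ᵥ
Exℚ {suc n} q f = q Fin.zero ℚ.* Exℚ (q ∘ Fin.suc) (λ e → f (inside ∷ᵥ e))
              ℚ.+ (1ℚ ℚ.- q Fin.zero) ℚ.* Exℚ (q ∘ Fin.suc) (λ e → f (outside ∷ᵥ e))

seq-Ex : ∀ {n} (q : Fin n → ℝ) f k → seq (Ex q f) k ≡ Exℚ (λ i → seq (q i) k) (λ e → seq (f e) k)
seq-Ex {zero}  q f k = refl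
seq-Ex {suc n} q f k = cong₂ (λ a b → seq (q Fin.zero) k ℚ.* a ℚ.+ (1ℚ ℚ.- seq (q Fin.zero) k) ℚ.* b)
  (seq-Ex (q ∘ Fin.suc) (λ e → f (inside ∷ᵥ e)) k) (seq-Ex (q ∘ Fin.suc) (λ e → f (outside ∷ᵥ e)) k)

seq-if : ∀ b x y k → seq (if b then x else y) k ≡ (if b then seq x k else seq y k)
seq-if true  x y k = refl
seq-if false x y k = refl

product-of-cong : ∀ {a} {A : Set a} {f g : A → ℚ} → (∀ x → f x ≡ g x) → ∀ xs → product-of f xs ≡ product-of g xs
product-of-cong eq []       = refl
product-of-cong eq (x ∷ xs) = cong₂ ℚ._*_ (eq x) (product-of-cong eq xs)

seq-weight : ∀ {n} (q : Fin n → ℝ) e k → seq (weight q e) k ≡ product-of (occurs (λ i → seq (q i) k) e) (allFin n)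
seq-weight q e k = trans (seq-productℝ (λ i → if lookup e i then q i else 1ℝ -ℝ q i) (allFin _) k)
  (product-of-cong (λ i → seq-if (lookup e i) (q i) (1ℝ -ℝ q i) k) (allFin _))

weight-∷ : ∀ {n} (q : Fin (suc n) → ℚ) b e → product-of (occurs q (b ∷ᵥ e)) (allFin (suc n)) ≡
  (if b then q Fin.zero else 1ℚ ℚ.- q Fin.zero) ℚ.* product-of (occurs (q ∘ Fin.suc) e) (allFin n)
weight-∷ q b e = cong ((if b then q Fin.zero else 1ℚ ℚ.- q Fin.zero) ℚ.*_)
  (trans (cong (product-of (occurs q (b ∷ᵥ e))) (sym (map-tabulate (λ i → i) Fin.suc)))
    (product-of-map (occurs q (b ∷ᵥ e)) Fin.suc (allFin _)))

sum-subsets : ∀ {n} (q : Fin n → ℚ) f →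
  sum-of (λ e → product-of (occurs q e) (allFin n) ℚ.* f e) (subsets n) ≡ Exℚ q f
sum-subsets {zero}  q f = trans (ℚ.+-identityʳ _) (ℚ.*-identityˡ _)
sum-subsets {suc n} q f = trans
  (sum-of-++ F (map (inside ∷ᵥ_) (subsets n)) (map (outside ∷ᵥ_) (subsets n)))
  (cong₂ ℚ._+_ (branch-sum inside) (branch-sum outside))
  where
  F : Subset (suc n) → ℚ
  F e = product-of (occurs q e) (allFin (suc n)) ℚ.* f e
  branch-sum : ∀ b → sum-of F (map (b ∷ᵥ_) (subsets n)) ≡
    (if b then q Fin.zero else 1ℚ ℚ.- q Fin.zero) ℚ.* Exℚ (q ∘ Fin.suc) (λ e → f (b ∷ᵥ e))
  branch-sum b = trans (sum-of-map F (b ∷ᵥ_) (subsets n))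
    (trans (sum-of-scale {f = F ∘ (b ∷ᵥ_)} {λ e → product-of (occurs (q ∘ Fin.suc) e) (allFin n) ℚ.* f (b ∷ᵥ e)}
        (if b then q Fin.zero else 1ℚ ℚ.- q Fin.zero)
        (λ e → trans (cong (ℚ._* f (b ∷ᵥ e)) (weight-∷ q b e)) (ℚ.*-assoc (if b then q Fin.zero else 1ℚ ℚ.- q Fin.zero) _ (f (b ∷ᵥ e)))) (subsets n))
      (cong ((if b then q Fin.zero else 1ℚ ℚ.- q Fin.zero) ℚ.*_) (sum-subsets (q ∘ Fin.suc) (λ e → f (b ∷ᵥ e)))))

indicator : Bool → ℝ
indicator b = fromℚ (indicatorℚ b)

sum-of-cong : ∀ {a} {A : Set a} {f g : A → ℚ} → (∀ x → f x ≡ g x) → ∀ xs → sum-of f xs ≡ sum-of g xs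
sum-of-cong eq []       = refl
sum-of-cong eq (x ∷ xs) = cong₂ ℚ._+_ (eq x) (sum-of-cong eq xs)

-- The weight of a subset factors over its first index, which turns the sum over all subsets into
-- the recursion of `Ex`.
Pr≃Ex : ∀ {n ℓ} {E : Pred (Subset n) ℓ} (q : Fin n → ℝ) (E? : Decidable E) →
  Pr q E? ≃ℝ Ex q (λ e → indicator (does (E? e)))
Pr≃Ex q E? k =
  trans (seq-sumℝ (weight q) (filter E? (subsets _)) k)
  (trans (sum-of-filter (λ e → seq (weight q e) k) E? (subsets _))
  (trans (sum-of-cong (λ e → cong (ℚ._* indicatorℚ (does (E? e))) (seq-weight q e k)) (subsets _))
  (trans (sum-subsets (λ i → seq (q i) k) (λ e → indicatorℚ (does (E? e))))
    (sym (seq-Ex q (λ e → indicator (does (E? e))) k)))))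

-- Adaptive queries with independent errors

-- An adaptive algorithm as data, so that expectations over its runs can be bounded by induction on
-- its questions.
data Tree (X : Set) : Set where
  ret : X → Tree X
  ask : ℕ → (Bool → Tree X) → Tree X

eval : ∀ {X} → Tree X → (ℕ → Bool) → X
eval (ret x)   o = x
eval (ask j κ) o = eval (κ (o j)) o

-- Along every path of the tree the keys of the questions strictly increase, so
-- that no question is repeated.
Fresh : ∀ {X} → (ℕ → ℕ) → ℕ → Tree X → Set
Fresh key u (ret x)   = ⊤
Fresh key u (ask j κ) = u ℕ.≤ key j × (∀ b → Fresh key (suc (key j)) (κ b))

eval-cong : ∀ {X} key u (T : Tree X) {o o′} → Fresh key u T →
  (∀ j → u ℕ.≤ key j → o j ≡ o′ j) → eval T o ≡ eval T o′
eval-cong key u (ret x)   _         _  = refl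
eval-cong key u (ask j κ) {o} {o′} (u≤j , f) eq = trans
  (eval-cong key (suc (key j)) (κ (o j)) (f (o j)) (λ i j<i → eq i (ℕ.≤-trans u≤j (ℕ.<⇒≤ j<i))))
  (cong (λ b → eval (κ b) o′) (eq j u≤j))

flips : ∀ {m} → Subset m → ℕ → Bool
flips {m} e j with j ℕ.<? m
... | yes j<m = lookup e (fromℕ< j<m)
... | no  _   = false

oracle : ∀ {m} → (ℕ → Bool) → Subset m → ℕ → Bool
oracle truth e j = truth j xor flips e j

flips-outside : ∀ {m} {j} → m ℕ.≤ j → (e : Subset m) → flips e j ≡ false
flips-outside {m} {j} m≤j e with j ℕ.<? m
... | yes j<m = contradiction j<m (ℕ.≤⇒≯ m≤j)
... | no  _   = refl

flips-≔ : ∀ {m j} (j<m : j ℕ.< m) (e : Subset m) b → flips (e [ fromℕ< j<m ]≔ b) j ≡ b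
flips-≔ {m} {j} j<m e b with j ℕ.<? m
... | yes _   = lookup∘update (fromℕ< j<m) e b
... | no  j≮m = contradiction j<m j≮m

flips-≔′ : ∀ {m j i} (j<m : j ℕ.< m) (e : Subset m) b → i ≢ j → flips (e [ fromℕ< j<m ]≔ b) i ≡ flips e i
flips-≔′ {m} {j} {i} j<m e b i≢j with i ℕ.<? m
... | yes i<m = lookup∘update′ (λ eq → i≢j (Fin.fromℕ<-injective i j i<m j<m eq)) e b
... | no  _   = refl

module _ {X : Set} (truth : ℕ → Bool) (p : ℚ) (h : X → ℚ) where

  -- V bounds the expectation of h at the leaves when each answer is wrong with
  -- probability at most p.
  Bounded : Tree X → ℚ → Set
  Bounded (ret x)   V = h x ℚ.≤ V
  Bounded (ask j κ) V = ∃ λ Vʳ → ∃ λ Vʷ →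
    Bounded (κ (truth j)) Vʳ × Bounded (κ (not (truth j))) Vʷ ×
    Vʳ ℚ.≤ Vʷ × p ℚ.* Vʷ ℚ.+ (1ℚ ℚ.- p) ℚ.* Vʳ ℚ.≤ V

-- The mixture grows with the probability of the larger value. Hence certificates demand that a
-- wrong answer has the larger bound: then the unknown real `q` may be raised to the rational `p`.
mix-≤ : ∀ {q p u v} → q ≤ℝ fromℚ p → u ℚ.≤ v →
  q *ℝ fromℚ v +ℝ (1ℝ -ℝ q) *ℝ fromℚ u ≤ℝ fromℚ (p ℚ.* v ℚ.+ (1ℚ ℚ.- p) ℚ.* u)
mix-≤ {q} {p} {u} {v} q≤p u≤v =
  let c = v ℚ.- u
      ineq = *ℝ-monoʳ-≤ {fromℚ c} {q} {fromℚ p} (fromℚ-mono-≤ (p≤q⇒0≤q-p u≤v)) q≤p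
  in λ ε 0<ε → let N , bound = ineq ε 0<ε in N , λ n n≥ → begin
    seq q n ℚ.* v ℚ.+ (1ℚ ℚ.- seq q n) ℚ.* u ≡⟨ rearrange (seq q n) u v ⟩
    c ℚ.* seq q n ℚ.+ u                      ≤⟨ ℚ.+-monoˡ-≤ u (bound n n≥) ⟩
    (c ℚ.* p ℚ.+ ε) ℚ.+ u                    ≡⟨ rearrange′ p u v ε ⟩
    p ℚ.* v ℚ.+ (1ℚ ℚ.- p) ℚ.* u ℚ.+ ε       ∎
  where
  open ℚ.≤-Reasoning
  open +-*-Solver
  rearrange : ∀ q u v → q ℚ.* v ℚ.+ (1ℚ ℚ.- q) ℚ.* u ≡ (v ℚ.- u) ℚ.* q ℚ.+ u
  rearrange = solve 3 (λ q u v → q :* v :+ (con 1ℚ :- q) :* u := (v :- u) :* q :+ u) refl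
  rearrange′ : ∀ p u v ε → ((v ℚ.- u) ℚ.* p ℚ.+ ε) ℚ.+ u ≡ p ℚ.* v ℚ.+ (1ℚ ℚ.- p) ℚ.* u ℚ.+ ε
  rearrange′ = solve 4 (λ p u v e → ((v :- u) :* p :+ e) :+ u
    := p :* v :+ (con 1ℚ :- p) :* u :+ e) refl

-- Serves questions beyond the end of the sequence: their answers are never wrong, yet the
-- certificate charges them like all others.
≤-mix : ∀ {p u v} → 0ℚ ℚ.≤ p → u ℚ.≤ v → u ℚ.≤ p ℚ.* v ℚ.+ (1ℚ ℚ.- p) ℚ.* u
≤-mix {p} {u} {v} 0≤p u≤v = subst (u ℚ.≤_) (rearrange p u v) (p≤p+q (0≤* 0≤p (p≤q⇒0≤q-p u≤v)))
  where
  open +-*-Solver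
  rearrange : ∀ p u v → u ℚ.+ p ℚ.* (v ℚ.- u) ≡ p ℚ.* v ℚ.+ (1ℚ ℚ.- p) ℚ.* u
  rearrange = solve 3 (λ p u v → u :+ p :* (v :- u) := p :* v :+ (con 1ℚ :- p) :* u) refl

module _ {X : Set} (truth : ℕ → Bool) (h : X → ℚ) (key : ℕ → ℕ)
  {m} (q : Fin m → ℝ) {p} (0≤p : 0ℚ ℚ.≤ p) (p≤1 : p ℚ.≤ 1ℚ)
  (0≤q : ∀ i → 0ℝ ≤ℝ q i) (q≤p : ∀ i → q i ≤ℝ fromℚ p) where

  private
    isP : ∀ i → IsProbability (q i)
    isP i = 0≤q i , ≤ℝ-trans {q i} {fromℚ p} {1ℝ} (q≤p i) (fromℚ-mono-≤ p≤1)

    H : Tree X → Subset m → ℝ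
    H T e = fromℚ (h (eval T (oracle truth e)))

  -- The error at `j` is drawn first. By freshness the subtree never asks `j` again, so overwriting
  -- this coordinate does not change its result, and the induction hypothesis applies with the full
  -- distribution.
  Ex≤Bounded : ∀ u T V → Fresh key u T → Bounded truth p h T V → Ex q (H T) ≤ℝ fromℚ V
  Ex≤Bounded u (ret x) V _ hx≤V = ≤ℝ-trans {Ex q (H (ret x))} {fromℚ (h x)} {fromℚ V}
    (≤ℝ-reflexive {Ex q (H (ret x))} {fromℚ (h x)} (Ex-const q (fromℚ (h x)))) (fromℚ-mono-≤ hx≤V)
  Ex≤Bounded u (ask j κ) V (_ , fresh) (Vʳ , Vʷ , boundʳ , boundʷ , Vʳ≤Vʷ , mix≤V) = by-cases (j ℕ.<? m)
    where
    ihʳ : Ex q (H (κ (truth j))) ≤ℝ fromℚ Vʳ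
    ihʳ = Ex≤Bounded (suc (key j)) (κ (truth j)) Vʳ (fresh _) boundʳ
    ihʷ : Ex q (H (κ (not (truth j)))) ≤ℝ fromℚ Vʷ
    ihʷ = Ex≤Bounded (suc (key j)) (κ (not (truth j))) Vʷ (fresh _) boundʷ

    by-cases : Dec (j ℕ.< m) → Ex q (H (ask j κ)) ≤ℝ fromℚ V
    by-cases (no j≮m) =
      ≤ℝ-trans {Ex q (H (ask j κ))} {Ex q (H (κ (truth j)))} {fromℚ V}
        (≤ℝ-reflexive {Ex q (H (ask j κ))} {Ex q (H (κ (truth j)))}
          (Ex-cong q {H (ask j κ)} {H (κ (truth j))} λ e k → cong (λ b → h (eval (κ b) (oracle truth e)))
            (trans (cong (truth j xor_) (flips-outside (ℕ.≮⇒≥ j≮m) e)) (xor-identityʳ (truth j)))))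
        (≤ℝ-trans {Ex q (H (κ (truth j)))} {fromℚ Vʳ} {fromℚ V} ihʳ
          (fromℚ-mono-≤ (ℚ.≤-trans (≤-mix 0≤p Vʳ≤Vʷ) mix≤V)))
    by-cases (yes j<m) =
      ≤ℝ-trans {Ex q (H (ask j κ))} {q i *ℝ Ex q (H (κ (not (truth j)))) +ℝ (1ℝ -ℝ q i) *ℝ Ex q (H (κ (truth j)))} {fromℚ V}
        (≤ℝ-reflexive {Ex q (H (ask j κ))} {q i *ℝ Ex q (H (κ (not (truth j)))) +ℝ (1ℝ -ℝ q i) *ℝ Ex q (H (κ (truth j)))}
          λ k → trans (Ex-split q (H (ask j κ)) i k)
            (cong₂ (λ a b → seq (q i) k ℚ.* a ℚ.+ (1ℚ ℚ.- seq (q i) k) ℚ.* b)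
              (Ex-cong q {λ e → H (ask j κ) (e [ i ]≔ inside)} {H (κ (not (truth j)))}
                (λ e _ → cong h (flipped e inside (not (truth j)) (xor-true (truth j)))) k)
              (Ex-cong q {λ e → H (ask j κ) (e [ i ]≔ outside)} {H (κ (truth j))}
                (λ e _ → cong h (flipped e outside (truth j) (xor-identityʳ (truth j)))) k)))
      (≤ℝ-trans {q i *ℝ Ex q (H (κ (not (truth j)))) +ℝ (1ℝ -ℝ q i) *ℝ Ex q (H (κ (truth j)))}
                {q i *ℝ fromℚ Vʷ +ℝ (1ℝ -ℝ q i) *ℝ fromℚ Vʳ} {fromℚ V}
        (mix-mono {q i} {Ex q (H (κ (not (truth j))))} {Ex q (H (κ (truth j)))} {fromℚ Vʷ} {fromℚ Vʳ} (isP i) ihʷ ihʳ)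
      (≤ℝ-trans {q i *ℝ fromℚ Vʷ +ℝ (1ℝ -ℝ q i) *ℝ fromℚ Vʳ} {fromℚ (p ℚ.* Vʷ ℚ.+ (1ℚ ℚ.- p) ℚ.* Vʳ)} {fromℚ V}
        (mix-≤ {q i} {p} {Vʳ} {Vʷ} (q≤p i) Vʳ≤Vʷ) (fromℚ-mono-≤ mix≤V)))
      where
      i : Fin m
      i = fromℕ< j<m
      xor-true : ∀ b → b xor true ≡ not b
      xor-true true  = refl
      xor-true false = refl
      flipped : ∀ e b c → truth j xor b ≡ c →
        eval (ask j κ) (oracle truth (e [ i ]≔ b)) ≡ eval (κ c) (oracle truth e)
      flipped e b c eq = trans
        (cong (λ a → eval (κ a) (oracle truth (e [ i ]≔ b)))
          (trans (cong (truth j xor_) (flips-≔ j<m e b)) eq))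
        (eval-cong key (suc (key j)) (κ c) (fresh c) λ j′ j<j′ →
          cong (truth j′ xor_) (flips-≔′ j<m e b (λ { refl → ℕ.<-irrefl refl j<j′ })))

-- The random walk

-- Linear arithmetic: the equation is an identity left to the ring solver.
≤-by : ∀ {x y} a b s → x ≤ y → (a + y) + s ≡ b + x → a ≤ b
≤-by {x} {y} a b s x≤y eq = ℕ.+-cancelʳ-≤ x a b
  (ℕ.≤-trans (ℕ.+-monoʳ-≤ a x≤y) (ℕ.≤-trans (ℕ.m≤m+n (a + y) s) (ℕ.≤-reflexive eq)))

≤-respˡ : ∀ {x y z} → x ≤ z → y ≡ x → y ≤ z
≤-respˡ x≤z refl = x≤z

bit : Bool → ℕ
bit b = if b then 1 else 0

bit≤1 : ∀ b → bit b ≤ 1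
bit≤1 true  = s≤s z≤n
bit≤1 false = z≤n

width : ℕ → ℕ
width zero    = 0
width (suc v) = 2 ^ v

-- The extra 1 is needed only where width 1 is followed by width 0.
width≤ : ∀ v → width v ≤ width (pred v) + width (pred v) + 1
width≤ zero          = z≤n
width≤ (suc zero)    = ℕ.≤-refl
width≤ (suc (suc v)) = subst (_≤ 2 ^ v + 2 ^ v + 1) (cong (2 ^ v +_) (sym (ℕ.+-identityʳ (2 ^ v)))) (ℕ.m≤m+n _ 1)

record Node : Set where
  constructor ⟨_,_⟩
  field
    block level : ℕ

open Node public

-- The bare halves are moved apart by 3 blocks, but intervals are probed 5 blocks beyond their ends.
-- Unless truncated, the widened children overlap by 4 blocks around the middle and reach at least 2
-- blocks past the widened parent.
child : Bool → Node → Node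
child true  ⟨ k , v ⟩ = ⟨ k + width (pred v) + 3 , pred v ⟩
child false ⟨ k , v ⟩ = ⟨ k ∸ 3 , pred v ⟩

level-child : ∀ b x → level (child b x) ≡ pred (level x)
level-child true  x = refl
level-child false x = refl

node : ℕ → List Bool → Node
node ℓ []      = ⟨ 0 , suc ℓ ⟩
node ℓ (b ∷ p) = child b (node ℓ p)

record State : Set where
  constructor state
  field
    path : List Bool
    hist : List ℕ
    out  : ℕ

open State public

count : ℕ → List ℕ → ℕ
count k []       = 0
count k (k′ ∷ H) = bit (k ≡ᵇ k′) + count k H

majority : ℕ → ℕ → Bool
majority c v = c <ᵇ v + v

-- A tie already counts as spoiled, whereas `majority` needs strictly more than half. An unspoiled
-- test is therefore right whichever answer is the true one.
spoiled : ℕ → ℕ → ℕ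
spoiled c ε = bit (c ≤ᵇ ε + ε)

move : Bool → Bool → List Bool → List Bool
move pass g p = if pass then g ∷ p else drop 1 p

module Search (c w ℓ thr : ℕ) (truth : ℕ → Bool) where

  poll : ∀ {X} → ℕ → ℕ → ℕ → ℕ → (ℕ → ℕ → Tree X) → Tree X
  poll zero    j v ε κ = κ v ε
  poll (suc n) j v ε κ = ask j λ b → poll n (suc j) (v + bit b) (ε + bit (b xor truth j)) κ

  ups errs : (ℕ → Bool) → ℕ → ℕ → ℕ → ℕ
  ups o zero    j v = v
  ups o (suc n) j v = ups o n (suc j) (v + bit (o j))
  errs o zero    j ε = ε
  errs o (suc n) j ε = errs o n (suc j) (ε + bit (o j xor truth j))

  eval-poll : ∀ {X} o n j v ε (κ : ℕ → ℕ → Tree X) →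
    eval (poll n j v ε κ) o ≡ eval (κ (ups o n j v) (errs o n j ε)) o
  eval-poll o zero    j v ε κ = refl
  eval-poll o (suc n) j v ε κ = eval-poll o n (suc j) _ _ κ

  here : State → Node
  here s = node ℓ (path s)

  lo-index hi-index mid-index : ℕ → State → ℕ
  lo-index  u s = w * (block (here s) ∸ 5) + u
  hi-index  u s = w * (block (here s) + width (level (here s)) + 5) + u
  mid-index u s = w * (block (here s) + width (pred (level (here s)))) + u

  -- Up to block 5 the left probe is truncated to block 0, which need not lie below `x`; the left
  -- end then passes without a vote.
  passes : Node → ℕ → ℕ → Bool
  passes x a b = ((block x ≤ᵇ 5) ∨ majority c a) ∧ not (majority c b)

  record-out : ℕ → List ℕ → ℕ → ℕ
  record-out k H o = if thr <ᵇ count k H then w * k else o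

  advance : State → ℕ → ℕ → ℕ → State
  advance s a b g = state (move (passes (here s) a b) (majority c g) (path s))
    (block (here s) ∷ hist s)
    (record-out (block (here s)) (block (here s) ∷ hist s) (out s))

  -- The second component of a leaf counts the spoiled tests; it depends on truth
  -- and is not available to the algorithm.
  walk : ℕ → ℕ → State → ℕ → Tree (State × ℕ)
  walk zero    u s B = ret (s , B)
  walk (suc t) u s B =
    poll c (lo-index u s) 0 0 λ a εa →
    poll c (hi-index (u + c) s) 0 0 λ b εb →
    poll c (mid-index (u + c + c) s) 0 0 λ g εg →
    walk t (u + c + c + c) (advance s a b g) (B + spoiled c εa + spoiled c εb + spoiled c εg)

  module _ (o : ℕ → Bool) (u : ℕ) (s : State) where
    lo-ups hi-ups mid-ups lo-errs hi-errs mid-errs : ℕ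
    lo-ups  = ups o c (lo-index u s) 0
    hi-ups  = ups o c (hi-index (u + c) s) 0
    mid-ups = ups o c (mid-index (u + c + c) s) 0
    lo-errs  = errs o c (lo-index u s) 0
    hi-errs  = errs o c (hi-index (u + c) s) 0
    mid-errs = errs o c (mid-index (u + c + c) s) 0

    next : State
    next = advance s lo-ups hi-ups mid-ups

  eval-walk : ∀ o t u s B → eval (walk (suc t) u s B) o ≡
    eval (walk t (u + c + c + c) (next o u s)
      (B + spoiled c (lo-errs o u s) + spoiled c (hi-errs o u s) + spoiled c (mid-errs o u s))) o
  eval-walk o t u s B =
    trans (eval-poll o c _ 0 0 _) (trans (eval-poll o c _ 0 0 _) (eval-poll o c _ 0 0 _))

  module _ .{{_ : NonZero w}} where

    -- Blocks are probed in an order that depends on the answers, but the offset inside the block is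
    -- the number of questions asked so far. The index modulo `w` is thus an increasing key as long
    -- as the questions fit into one block.
    poll-fresh : ∀ {X} n k u v ε (κ : ℕ → ℕ → Tree X) → u + n ≤ w →
      (∀ v ε → Fresh (_% w) (u + n) (κ v ε)) → Fresh (_% w) u (poll n (w * k + u) v ε κ)
    poll-fresh zero k u v ε κ _ fresh = subst (λ u → Fresh (_% w) u (κ v ε)) (ℕ.+-identityʳ u) (fresh v ε)
    poll-fresh (suc n) k u v ε κ u+n≤w fresh =
      ℕ.≤-reflexive (sym key≡u) , λ b →
      subst₂ (λ x j → Fresh (_% w) (suc x) (poll n j (v + bit b) (ε + bit (b xor truth (w * k + u))) κ)) (sym key≡u) (ℕ.+-suc (w * k) u)
        (poll-fresh n k (suc u) _ _ κ (subst (_≤ w) (ℕ.+-suc u n) u+n≤w)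
          (λ v ε → subst (λ u → Fresh (_% w) u (κ v ε)) (ℕ.+-suc u n) (fresh v ε)))
      where
      key≡u : (w * k + u) % w ≡ u
      key≡u = trans (cong (_% w) (trans (ℕ.+-comm (w * k) u) (cong (u +_) (ℕ.*-comm w k))))
        (trans ([m+kn]%n≡m%n u k w)
          (m<n⇒m%n≡m (ℕ.≤-trans (s≤s (ℕ.m≤m+n u n)) (subst (_≤ w) (ℕ.+-suc u n) u+n≤w))))

    walk-fresh : ∀ t u s B → u + t * (c + c + c) ≤ w → Fresh (_% w) u (walk t u s B)
    walk-fresh zero    u s B _   = tt
    walk-fresh (suc t) u s B fit =
      poll-fresh c _ u 0 0 _ (ℕ.≤-trans (ℕ.m≤m+n _ _) fit₁) λ a εa →
      poll-fresh c _ (u + c) 0 0 _ (ℕ.≤-trans (ℕ.m≤m+n _ _) fit₂) λ b εb →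
      poll-fresh c _ (u + c + c) 0 0 _ (ℕ.≤-trans (ℕ.m≤m+n _ _) fit₃) λ g εg →
      walk-fresh t (u + c + c + c) _ _ fit₃
      where
      fit₃ : u + c + c + c + t * (c + c + c) ≤ w
      fit₃ = ≤-respˡ fit (ring (u ∷ c ∷ t ∷ []))
      fit₂ : u + c + c + (c + t * (c + c + c)) ≤ w
      fit₂ = ≤-respˡ fit (ring (u ∷ c ∷ t ∷ []))
      fit₁ : u + c + (c + c + t * (c + c + c)) ≤ w
      fit₁ = ≤-respˡ fit (ring (u ∷ c ∷ t ∷ []))

<ᵇ-true : ∀ {m n} → m < n → (m <ᵇ n) ≡ true
<ᵇ-true m<n = Equivalence.to T-≡ (ℕ.<⇒<ᵇ m<n)

<ᵇ-false : ∀ {m n} → n ≤ m → (m <ᵇ n) ≡ false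
<ᵇ-false {m} {n} n≤m = ¬-not λ eq → ℕ.≤⇒≯ n≤m (ℕ.<ᵇ⇒< m n (Equivalence.from T-≡ eq))

<ᵇ-true⁻¹ : ∀ m n → (m <ᵇ n) ≡ true → m < n
<ᵇ-true⁻¹ m n eq = ℕ.<ᵇ⇒< m n (Equivalence.from T-≡ eq)

<ᵇ-false⁻¹ : ∀ m n → (m <ᵇ n) ≡ false → n ≤ m
<ᵇ-false⁻¹ m n eq = ℕ.≮⇒≥ λ m<n → contradiction (trans (sym (<ᵇ-true m<n)) eq) λ ()

≤ᵇ-true : ∀ {m n} → m ≤ n → (m ≤ᵇ n) ≡ true
≤ᵇ-true m≤n = Equivalence.to T-≡ (ℕ.≤⇒≤ᵇ m≤n)

≤ᵇ-true⁻¹ : ∀ m n → (m ≤ᵇ n) ≡ true → m ≤ n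
≤ᵇ-true⁻¹ m n eq = ℕ.≤ᵇ⇒≤ m n (Equivalence.from T-≡ eq)

≤ᵇ-false⁻¹ : ∀ m n → (m ≤ᵇ n) ≡ false → n < m
≤ᵇ-false⁻¹ m n eq = ℕ.≰⇒> λ m≤n → contradiction (trans (sym (≤ᵇ-true m≤n)) eq) λ ()

∣-∣-≤ : ∀ {a b} c → a ≤ b + c → b ≤ a + c → ℕ.∣ a - b ∣ ≤ c
∣-∣-≤ {a} {b} c a≤ b≤ with ℕ.≤-total a b
... | inj₁ a≤b = ℕ.≤-trans (ℕ.≤-reflexive (ℕ.m≤n⇒∣m-n∣≡n∸m a≤b)) (ℕ.m≤n+o⇒m∸n≤o b a b≤)
... | inj₂ b≤a = ℕ.≤-trans (ℕ.≤-reflexive (ℕ.m≤n⇒∣n-m∣≡n∸m b≤a)) (ℕ.m≤n+o⇒m∸n≤o a b a≤)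

-- Progress of the walk

-- Here r is the number of elements below x.
module Geometry (w d r : ℕ) .{{_ : NonZero w}} (d+d≤w : d + d ≤ w) where

  -- The margin `d` absorbs the dislocation: every element of such a block truly lies on the stated
  -- side of `x`. For blocks that are neither, answers may be mixed and a test promises nothing.
  Below Above : ℕ → Set
  Below k = w * k + w + d ≤ r
  Above k = r + d ≤ w * k

  Inside : Node → Set
  Inside x = (block x ≤ 5 ⊎ Below (block x ∸ 5)) × Above (block x + width (level x) + 5)

  Inside? : ∀ x → Dec (Inside x)
  Inside? x = ((block x ℕ.≤? 5) ⊎-dec (_ ℕ.≤? r)) ×-dec (_ ℕ.≤? _)

  -- What a test of block k with few wrong answers guarantees.
  Sound : ℕ → Bool → Set
  Sound k b = (Below k → b ≡ true) × (Above k → b ≡ false)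

  private
    -- Since `d + d ≤ w`, `¬ Above k` gives `Below (k - 2)`, and `¬ Below k` gives `Above (k + 2)`.
    -- This exchange at the cost of two blocks yields the four bounds on the ends of the children.
    lower-left : ∀ k → (k ≤ 5 ⊎ ¬ Above (k ∸ 5)) → k ∸ 3 ≤ 5 ⊎ Below (k ∸ 3 ∸ 5)
    lower-left k h with k ℕ.≤? 8
    ... | yes k≤8 = inj₁ (ℕ.∸-monoˡ-≤ 3 k≤8)
    ... | no  k≰8 with ℕ.m≤n⇒∃[o]m+o≡n (ℕ.<⇒≤ (ℕ.≰⇒> k≰8)) | h
    ...   | x , refl | inj₁ k≤5 = contradiction (ℕ.≤-trans k≤5 (ℕ.m≤m+n 5 3)) k≰8
    ...   | x , refl | inj₂ ¬above = inj₂ (≤-by (w * x + w + d) r (suc w)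
            (ℕ.+-mono-≤ (ℕ.≰⇒> ¬above) d+d≤w) (eq x))
      where
      eq : ∀ x → w * x + w + d + (r + d + w) + suc w ≡ r + (suc (w * (3 + x)) + (d + d))
      eq x = ring (w ∷ x ∷ d ∷ r ∷ [])

    lower-right : ∀ k → ¬ Above k → k + 3 ≤ 5 ⊎ Below (k + 3 ∸ 5)
    lower-right zero          _      = inj₁ (ℕ.m≤m+n 3 2)
    lower-right (suc zero)    _      = inj₁ (ℕ.m≤m+n 4 1)
    lower-right (suc (suc x)) ¬above = inj₂ (subst Below eq′ (≤-by (w * x + w + d) r 1
      (ℕ.+-mono-≤ (ℕ.≰⇒> ¬above) d+d≤w) (eq x)))
      where
      eq′ : x ≡ x + 3 ∸ 3
      eq′ = sym (ℕ.m+n∸n≡m x 3)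
      eq : ∀ x → w * x + w + d + (r + d + w) + 1 ≡ r + (suc (w * (2 + x)) + (d + d))
      eq x = ring (w ∷ x ∷ d ∷ r ∷ [])

    upper-left : ∀ k h → ¬ Below (k + h) → Above (k ∸ 3 + h + 5)
    upper-left k h ¬below = ℕ.≤-trans
      (≤-by (r + d) (w * (k + h + 2)) 1 (ℕ.+-mono-≤ (ℕ.≰⇒> ¬below) d+d≤w) eq)
      (ℕ.*-monoʳ-≤ w (ℕ.≤-trans (ℕ.+-monoˡ-≤ 2 (ℕ.+-monoˡ-≤ h (ℕ.m≤n+m∸n k 3))) (ℕ.≤-reflexive eq′)))
      where
      eq : r + d + (w * (k + h) + w + d + w) + 1 ≡ w * (k + h + 2) + (suc r + (d + d))
      eq = ring (w ∷ k ∷ h ∷ d ∷ r ∷ [])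
      shift : ∀ j → 3 + j + h + 2 ≡ j + h + 5
      shift j = ring (j ∷ h ∷ [])
      eq′ : 3 + (k ∸ 3) + h + 2 ≡ k ∸ 3 + h + 5
      eq′ = shift (k ∸ 3)

    upper-right : ∀ k V h → V ≤ h + h + 1 → ¬ Below (k + V + 5) → Above (k + h + 3 + h + 5)
    upper-right k V h V≤ ¬below = ℕ.≤-trans
      (≤-by (r + d) (w * (k + V + 7)) 1 (ℕ.+-mono-≤ (ℕ.≰⇒> ¬below) d+d≤w) eq)
      (ℕ.*-monoʳ-≤ w (≤-by (k + V + 7) (k + h + 3 + h + 5) 0 V≤ eq′))
      where
      eq : r + d + (w * (k + V + 5) + w + d + w) + 1 ≡ w * (k + V + 7) + (suc r + (d + d))
      eq = ring (w ∷ k ∷ V ∷ d ∷ r ∷ [])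
      eq′ : k + V + 7 + (h + h + 1) + 0 ≡ k + h + 3 + h + 5 + V
      eq′ = ring (k ∷ V ∷ h ∷ [])

  -- The parent may have passed on ambiguous answers, so only negations are known at its ends; the
  -- wider reach of the children makes up for that. If the middle test is ambiguous, `x` lies in the
  -- overlap and either child will do.
  child-inside : ∀ x g → (block x ≤ 5 ⊎ ¬ Above (block x ∸ 5)) → ¬ Below (block x + width (level x) + 5) →
    Sound (block x + width (pred (level x))) g → Inside (child g x)
  child-inside ⟨ k , v ⟩ true  lower upper (_ , mid) =
    lower-right (k + width (pred v)) (λ above → contradiction (mid above) λ ()) ,
    upper-right k (width v) (width (pred v)) (width≤ v) upper
  child-inside ⟨ k , v ⟩ false lower upper (mid , _) =
    lower-left k lower ,
    upper-left k (width (pred v)) (λ below → contradiction (mid below) λ ())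

  β : ℕ
  β = r / w ∸ 7

  private
    r<w*[1+r/w] : suc r ≤ w * suc (r / w)
    r<w*[1+r/w] = ℕ.≤-trans (s≤s (ℕ.≤-reflexive (m≡m%n+[m/n]*n r w)))
      (ℕ.≤-trans (ℕ.+-monoˡ-≤ (r / w * w) (m%n<n r w)) (ℕ.≤-reflexive (ℕ.*-comm (suc (r / w)) w)))

    w*[r/w]≤r : w * (r / w) ≤ r
    w*[r/w]≤r = subst (_≤ r) (ℕ.*-comm (r / w) w) (m/n*n≤m r w)

  InRange : ℕ → Set
  InRange k = β ≤ k × k < β + 14

  -- At width 0 the two negations pin the block down to `r / w - 7 ≤ k ≤ r / w + 6`, which is where
  -- the number 14 comes from.
  leaf-in-range : ∀ k → (k ≤ 5 ⊎ ¬ Above (k ∸ 5)) → ¬ Below (k + 0 + 5) → InRange k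
  leaf-in-range k lower upper = ℕ.m≤n+o⇒m∸n≤o (r / w) 7 r/w≤ , hi k lower
    where
    eq : ∀ k → suc (w * (r / w)) + (w * (k + 0 + 5) + w + d + w) + d ≡ w * (7 + k) + (d + d) + suc (w * (r / w))
    eq k = go (r / w)
      where
      go : ∀ ρ → suc (w * ρ) + (w * (k + 0 + 5) + w + d + w) + d ≡ w * (7 + k) + (d + d) + suc (w * ρ)
      go ρ = ring (w ∷ k ∷ d ∷ ρ ∷ [])
    r/w≤ : r / w ≤ 7 + k
    r/w≤ = ℕ.*-cancelˡ-≤ w (ℕ.≤-trans w*[r/w]≤r
      (≤-by r (w * (7 + k)) (suc d) (ℕ.+-mono-≤ (ℕ.≰⇒> upper) d+d≤w) eq₁))
      where
      eq₁ : r + (w * (k + 0 + 5) + w + d + w) + suc d ≡ w * (7 + k) + (suc r + (d + d))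
      eq₁ = ring (w ∷ k ∷ d ∷ r ∷ [])
    ρ+7≤ : r / w + 7 ≤ β + 14
    ρ+7≤ = ℕ.≤-trans (ℕ.+-monoˡ-≤ 7 (ℕ.m≤n+m∸n (r / w) 7)) (ℕ.≤-reflexive (go β))
      where
      go : ∀ b → 7 + b + 7 ≡ b + 14
      go b = ring (b ∷ [])
    hi : ∀ k → (k ≤ 5 ⊎ ¬ Above (k ∸ 5)) → k < β + 14
    hi k (inj₁ k≤5) = ℕ.≤-trans (s≤s k≤5) (ℕ.≤-trans (ℕ.m≤m+n 6 8) (ℕ.m≤n+m 14 β))
    hi k (inj₂ ¬above) with k ℕ.≤? 5
    ... | yes k≤5 = hi k (inj₁ k≤5)
    ... | no  k≰5 with ℕ.m≤n⇒∃[o]m+o≡n (ℕ.≰⇒> k≰5)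
    ...   | x , refl = ℕ.≤-trans (ℕ.≤-trans (ℕ.≤-reflexive (go x)) (ℕ.+-monoˡ-≤ 7 x≤)) ρ+7≤
      where
      go : ∀ x → suc (6 + x) ≡ x + 7
      go x = ring (x ∷ [])
      eq₂ : ∀ ρ → suc (w * (1 + x)) + (r + d + w + w * suc ρ) + (1 + d) ≡
        w * (2 + ρ) + (suc (w * (1 + x)) + (d + d) + suc r)
      eq₂ ρ = ring (w ∷ x ∷ d ∷ r ∷ ρ ∷ [])
      x≤ : x ≤ r / w
      x≤ = ℕ.s≤s⁻¹ (ℕ.s≤s⁻¹ (ℕ.*-cancelˡ-< w (1 + x) (2 + r / w)
        (≤-by (suc (w * (1 + x))) (w * (2 + r / w)) (1 + d)
          (ℕ.+-mono-≤ (ℕ.+-mono-≤ (ℕ.≰⇒> ¬above) d+d≤w) r<w*[1+r/w]) (eq₂ (r / w)))))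

  in-range-close : ∀ k → InRange k → ℕ.∣ w * k - suc r ∣ ≤ w * 15
  in-range-close k (β≤k , k<) = ∣-∣-≤ (w * 15) upper lower
    where
    -- The offset is 13 and not 6 because `β` is truncated to 0 when `r / w < 7`.
    k≤ : k ≤ r / w + 13
    k≤ = ℕ.s≤s⁻¹ (ℕ.≤-trans k< (ℕ.≤-trans (ℕ.+-monoˡ-≤ 14 (ℕ.m∸n≤m (r / w) 7)) (ℕ.≤-reflexive (ℕ.+-suc (r / w) 13))))
    upper : w * k ≤ suc r + w * 15
    upper = ℕ.≤-trans (ℕ.*-monoʳ-≤ w k≤) (≤-by (w * (r / w + 13)) (suc r + w * 15) (1 + w * 2) w*[r/w]≤r (go (r / w)))
      where
      go : ∀ ρ → w * (ρ + 13) + r + (1 + w * 2) ≡ suc r + w * 15 + w * ρ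
      go ρ = ring (w ∷ r ∷ ρ ∷ [])
    lower : suc r ≤ w * k + w * 15
    lower = ℕ.≤-trans r<w*[1+r/w] (ℕ.≤-trans
      (ℕ.*-monoʳ-≤ w (s≤s (ℕ.≤-trans (ℕ.m≤n+m∸n (r / w) 7) (ℕ.+-monoʳ-≤ 7 β≤k))))
      (≤-by (w * (8 + k)) (w * k + w * 15) (w * 7) (ℕ.≤-refl {0}) (ring (w ∷ k ∷ []))))

-- Counting the visits to blocks inside and outside an interval

inInterval : ℕ → ℕ → ℕ → Bool
inInterval b n k = (b ≤ᵇ k) ∧ (k <ᵇ b + n)

outside-count : ℕ → ℕ → List ℕ → ℕ
outside-count b n []      = 0
outside-count b n (k ∷ H) = bit (not (inInterval b n k)) + outside-count b n H

inInterval-true : ∀ {b n k} → b ≤ k → k < b + n → inInterval b n k ≡ true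
inInterval-true {b} {n} {k} b≤k k< rewrite ≤ᵇ-true b≤k = <ᵇ-true k<

inInterval-true⁻¹ : ∀ b n k → inInterval b n k ≡ true → b ≤ k × k < b + n
inInterval-true⁻¹ b n k eq with b ≤ᵇ k in b≤k
... | true = ≤ᵇ-true⁻¹ b k b≤k , <ᵇ-true⁻¹ k (b + n) eq

≡ᵇ-refl : ∀ k → (k ≡ᵇ k) ≡ true
≡ᵇ-refl k = Equivalence.to T-≡ (ℕ.≡⇒≡ᵇ k k refl)

≡ᵇ-true⁻¹ : ∀ j k → (j ≡ᵇ k) ≡ true → j ≡ k
≡ᵇ-true⁻¹ j k eq = ℕ.≡ᵇ⇒≡ j k (Equivalence.from T-≡ eq)

count≤outside : ∀ b n k → inInterval b n k ≡ false → ∀ H → count k H ≤ outside-count b n H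
count≤outside b n k out []       = z≤n
count≤outside b n k out (k′ ∷ H) = ℕ.+-mono-≤ head (count≤outside b n k out H)
  where
  head : bit (k ≡ᵇ k′) ≤ bit (not (inInterval b n k′))
  head with k ≡ᵇ k′ in eq
  ... | false = z≤n
  ... | true  rewrite sym (≡ᵇ-true⁻¹ k k′ eq) | out = s≤s z≤n

outside≤outside+count : ∀ b n H → outside-count b n H ≤ outside-count b (suc n) H + count (b + n) H
outside≤outside+count b n []      = z≤n
outside≤outside+count b n (k ∷ H) = ℕ.≤-trans (ℕ.+-mono-≤ head (outside≤outside+count b n H))
  (ℕ.≤-reflexive (swap (bit (not (inInterval b (suc n) k))) (bit (b + n ≡ᵇ k)) _ _))
  where
  swap : ∀ x y u v → x + y + (u + v) ≡ x + u + (y + v)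
  swap = solve-∀
  head : bit (not (inInterval b n k)) ≤ bit (not (inInterval b (suc n) k)) + bit (b + n ≡ᵇ k)
  head with b + n ≡ᵇ k in eq
  ... | true  = ℕ.≤-trans (bit≤1 _) (ℕ.m≤n+m 1 _)
  ... | false with inInterval b (suc n) k in eq′
  ...   | false = ℕ.≤-trans (bit≤1 (not (inInterval b n k))) (ℕ.m≤m+n 1 0)
  ...   | true  with inInterval-true⁻¹ b (suc n) k eq′
  ...     | b≤k , k< rewrite inInterval-true {b} {n} b≤k (ℕ.≤∧≢⇒< (ℕ.s≤s⁻¹ (subst (k <_) (ℕ.+-suc b n) k<))
              (λ k≡ → contradiction (trans (sym eq) (trans (cong (b + n ≡ᵇ_) k≡) (≡ᵇ-refl (b + n)))) λ ())) = z≤n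

-- Pigeonhole over the n values in the interval.
length≤outside : ∀ b t H → (∀ k → count k H ≤ t) → ∀ n → length H ≤ outside-count b n H + n * t
length≤outside b t H few zero = subst (length H ≤_) (sym (ℕ.+-identityʳ _)) (all-outside H)
  where
  all-outside : ∀ H → length H ≤ outside-count b 0 H
  all-outside []      = z≤n
  all-outside (k ∷ H) = ℕ.+-mono-≤ head (all-outside H)
    where
    head : 1 ≤ bit (not (inInterval b 0 k))
    head with inInterval b 0 k in eq
    ... | false = s≤s z≤n
    ... | true with inInterval-true⁻¹ b 0 k eq
    ...   | b≤k , k<b = contradiction b≤k (ℕ.<⇒≱ (subst (k <_) (ℕ.+-identityʳ b) k<b))
length≤outside b t H few (suc n) = ℕ.≤-trans (length≤outside b t H few n)
  (ℕ.≤-trans (ℕ.+-monoˡ-≤ (n * t) (ℕ.≤-trans (outside≤outside+count b n H) (ℕ.+-monoʳ-≤ _ (few (b + n)))))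
    (ℕ.≤-reflexive (ℕ.+-assoc (outside-count b (suc n) H) t (n * t))))

-- The potential of the search path, for fixed answers

module Analysis (c w ℓ thr : ℕ) (truth : ℕ → Bool) (d r : ℕ) .{{_ : NonZero w}} (d+d≤w : d + d ≤ w)
  (truth-below : ∀ j → j + d < r → truth j ≡ true)
  (truth-above : ∀ j → r + d ≤ j → truth j ≡ false)
  (r≤ : r ≤ w * 2 ^ ℓ)
  (o : ℕ → Bool) where

  open Search c w ℓ thr truth
  open Geometry w d r d+d≤w

  all-true : ∀ n j v ε → (∀ i → j ≤ i → i < j + n → truth i ≡ true) →
    ups o n j v + errs o n j ε ≡ v + ε + n
  all-true zero    j v ε _     = sym (ℕ.+-identityʳ _)
  all-true (suc n) j v ε tt≡ rewrite tt≡ j ℕ.≤-refl (ℕ.m<m+n j (s≤s z≤n)) =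
    trans (all-true n (suc j) (v + bit (o j)) (ε + bit (o j xor true))
            (λ i j<i i< → tt≡ i (ℕ.<⇒≤ j<i) (subst (i <_) (sym (ℕ.+-suc j n)) i<)))
      (one (o j))
    where
    one : ∀ b → v + bit b + (ε + bit (b xor true)) + n ≡ v + ε + suc n
    one true  = ring (v ∷ ε ∷ n ∷ [])
    one false = ring (v ∷ ε ∷ n ∷ [])

  all-false : ∀ n j v ε → (∀ i → j ≤ i → i < j + n → truth i ≡ false) →
    ups o n j v + ε ≡ errs o n j ε + v
  all-false zero    j v ε _     = ℕ.+-comm v ε
  all-false (suc n) j v ε ff≡ rewrite ff≡ j ℕ.≤-refl (ℕ.m<m+n j (s≤s z≤n)) =
    ℕ.+-cancelʳ-≡ (bit (o j)) _ _ (trans (ℕ.+-assoc _ ε (bit (o j)))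
      (trans (cong (λ b → ups o n (suc j) (v + bit (o j)) + (ε + bit b)) (sym (xor-false (o j))))
      (trans (all-false n (suc j) (v + bit (o j)) (ε + bit (o j xor false))
              (λ i j<i i< → ff≡ i (ℕ.<⇒≤ j<i) (subst (i <_) (sym (ℕ.+-suc j n)) i<)))
        (sym (ℕ.+-assoc (errs o n (suc j) (ε + bit (o j xor false))) v (bit (o j)))))))
    where
    xor-false : ∀ b → b xor false ≡ b
    xor-false true  = refl
    xor-false false = refl

  -- In a `Below` block each missing vote is an error, in an `Above` block each vote is one. Fewer
  -- than half errors therefore decide the majority.
  poll-sound : ∀ k u → u + c ≤ w → spoiled c (errs o c (w * k + u) 0) ≡ 0 →
    Sound k (majority c (ups o c (w * k + u) 0))
  poll-sound k u fit unspoiled = below , above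
    where
    j = w * k + u
    few : ∀ e → bit (c ≤ᵇ e + e) ≡ 0 → e + e < c
    few e eq with c ≤ᵇ e + e in eq′
    ... | false = ≤ᵇ-false⁻¹ c (e + e) eq′
    below : Below k → majority c (ups o c j 0) ≡ true
    below b = <ᵇ-true (≤-by (suc c) (ups o c j 0 + ups o c j 0) 0 (few (errs o c j 0) unspoiled) (eq (ups o c j 0) (errs o c j 0)
      (all-true c j 0 0 λ i _ i< → truth-below i (ℕ.≤-trans (ℕ.+-monoˡ-≤ d (ℕ.≤-trans i< bound)) b))))
      where
      bound : j + c ≤ w * k + w
      bound = ℕ.≤-trans (ℕ.≤-reflexive (ℕ.+-assoc (w * k) u c)) (ℕ.+-monoʳ-≤ (w * k) fit)
      eq : ∀ x y → x + y ≡ c → suc c + c + 0 ≡ x + x + suc (y + y)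
      eq x y refl = ring (x ∷ y ∷ [])
    above : Above k → majority c (ups o c j 0) ≡ false
    above a = <ᵇ-false (ℕ.<⇒≤ (subst (λ x → x + x < c) (sym ups≡errs) (few (errs o c j 0) unspoiled)))
      where
      ups≡errs : ups o c j 0 ≡ errs o c j 0
      ups≡errs = trans (sym (ℕ.+-identityʳ _)) (trans
        (all-false c j 0 0 λ i j≤i _ → truth-above i (ℕ.≤-trans a (ℕ.≤-trans (ℕ.m≤m+n (w * k) u) j≤i)))
        (ℕ.+-identityʳ _))

  -- The root is not counted, since it always contains `x` with a margin.
  excess : List Bool → ℕ
  excess []      = 0
  excess (b ∷ p) = bit (not (does (Inside? (node ℓ (b ∷ p))))) + excess p

  potential : List Bool → ℕ
  potential p = excess p + excess p + level (node ℓ p)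

  outlier : ℕ → ℕ
  outlier k = bit (not (inInterval β 14 k))

  outliers : List ℕ → ℕ
  outliers = outside-count β 14

  level-pred : ∀ v → v ≤ suc (pred v)
  level-pred zero    = z≤n
  level-pred (suc v) = ℕ.≤-refl

  -- Whatever the tests say, a push adds at most one bad node, which weighs 2, and a pop regains at
  -- most one level.
  any-step : ∀ pass g p → potential (move pass g p) + 1 ≤ potential p + 3
  any-step true g p = ≤-by (potential (g ∷ p) + 1) (potential p + 3) 0
    (ℕ.+-mono-≤ (ℕ.+-mono-≤ (bit≤1 i) (bit≤1 i)) (ℕ.≤-trans (ℕ.≤-reflexive (level-child g (node ℓ p))) ℕ.pred[n]≤n))
    (eq (bit i) (excess p) (level (child g (node ℓ p))) (level (node ℓ p)))
    where
    i = not (does (Inside? (node ℓ (g ∷ p))))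
    eq : ∀ i e l l′ → i + e + (i + e) + l + 1 + (1 + 1 + l′) + 0 ≡ e + e + l′ + 3 + (i + i + l)
    eq = solve-∀
  any-step false g []      = ℕ.+-monoʳ-≤ (suc ℓ) (s≤s z≤n)
  any-step false g (b ∷ p) = ≤-by (potential p + 1) (potential (b ∷ p) + 3) (1 + (i + i)) (level-pred (level (node ℓ p)))
    (trans (eq i (excess p) (level (node ℓ p)) (pred (level (node ℓ p))))
      (cong (λ l → i + excess p + (i + excess p) + l + 3 + level (node ℓ p)) (sym (level-child b (node ℓ p)))))
    where
    i = bit (not (does (Inside? (node ℓ (b ∷ p)))))
    eq : ∀ i e l l′ → e + e + l + 1 + suc l′ + (1 + (i + i)) ≡ i + e + (i + e) + l′ + 3 + l
    eq = solve-∀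

  module _ (p : List Bool) (a b g : ℕ) where
    private
      x = node ℓ p
      k = block x
    module _ (sound-lo  : Sound (k ∸ 5) (majority c a))
             (sound-hi  : Sound (k + width (level x) + 5) (majority c b))
             (sound-mid : Sound (k + width (pred (level x))) (majority c g)) where

      inside-passes : Inside x → passes x a b ≡ true
      inside-passes (inj₁ k≤5 , above) rewrite ≤ᵇ-true k≤5 | proj₂ sound-hi above = refl
      inside-passes (inj₂ below , above)
        rewrite proj₁ sound-lo below | proj₂ sound-hi above | ∨-zeroʳ (k ≤ᵇ 5) = refl

      passes-lower : passes x a b ≡ true → k ≤ 5 ⊎ ¬ Above (k ∸ 5)
      passes-lower eq with k ≤ᵇ 5 in k≤5
      ... | true  = inj₁ (≤ᵇ-true⁻¹ k 5 k≤5)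
      ... | false = inj₂ λ above → contradiction
        (trans (sym eq) (cong (_∧ not (majority c b)) (proj₂ sound-lo above))) λ ()

      passes-upper : passes x a b ≡ true → ¬ Below (k + width (level x) + 5)
      passes-upper eq below rewrite proj₁ sound-hi below with (k ≤ᵇ 5) ∨ majority c a
      passes-upper () below | true
      passes-upper () below | false

      sound-step : potential (move (passes x a b) (majority c g) p) + outlier k ≤ potential p
      sound-step with passes x a b in eq
      ... | true = ℕ.≤-trans (ℕ.+-monoˡ-≤ (outlier k) (ℕ.≤-reflexive descended)) (ℕ.≤-trans
          (ℕ.≤-reflexive (ℕ.+-assoc (excess p + excess p) _ _)) (ℕ.+-monoʳ-≤ (excess p + excess p) shallow))
        where
        lower = passes-lower eq
        upper = passes-upper eq
        g′ = majority c g
        descended : potential (g′ ∷ p) ≡ excess p + excess p + pred (level x)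
        descended rewrite dec-true (Inside? (child g′ x)) (child-inside x g′ lower upper sound-mid) =
          cong (excess p + excess p +_) (level-child g′ x)
        shallow : pred (level x) + outlier k ≤ level x
        shallow with level x | upper
        ... | suc v | _ = ℕ.≤-trans (ℕ.+-monoʳ-≤ v (bit≤1 _)) (ℕ.≤-reflexive (ℕ.+-comm v 1))
        -- The walk keeps pushing at level 0, where no level can be lost. But a node of width 0 that
        -- passes lies in the good range, so there is no outlier to pay for.
        ... | zero  | upper₀ with leaf-in-range k lower upper₀
        ...   | β≤k , k< rewrite inInterval-true β≤k k< = z≤n
      ... | false = popped p refl
        where
        not-inside : ¬ Inside x
        not-inside inx = contradiction (trans (sym eq) (inside-passes inx)) λ ()
        root-inside : Inside (node ℓ [])
        root-inside = inj₁ z≤n , ℕ.≤-trans (ℕ.+-mono-≤ r≤ d≤) (ℕ.≤-reflexive (sym (ℕ.*-distribˡ-+ w (2 ^ ℓ) 5)))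
          where
          d≤ : d ≤ w * 5
          d≤ = ℕ.≤-trans (ℕ.m≤m+n d d) (ℕ.≤-trans d+d≤w (ℕ.m≤m*n w 5))
        popped : ∀ p′ → p ≡ p′ → potential (drop 1 p′) + outlier k ≤ potential p′
        popped []       refl = contradiction root-inside not-inside
        -- The removed node was bad and releases 2: one unit for the level regained, one for a
        -- possible outlier.
        popped (b′ ∷ p′) refl = ≤-by (potential p′ + outlier k) _ 0
          (ℕ.+-mono-≤ (bit≤1 (not (inInterval β 14 k))) (level-pred (level (node ℓ p′))))
          (trans (eq′ (excess p′) (level (node ℓ p′)) (pred (level (node ℓ p′))) (outlier k))
            (cong (_+ (outlier k + level (node ℓ p′))) (sym potential-child)))
          where
          eq′ : ∀ e l l′ t → e + e + l + t + (1 + suc l′) + 0 ≡ suc e + suc e + l′ + (t + l)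
          eq′ = solve-∀
          potential-child : potential (b′ ∷ p′) ≡ suc (excess p′) + suc (excess p′) + pred (level (node ℓ p′))
          potential-child = cong₂ (λ b l → bit (not b) + excess p′ + (bit (not b) + excess p′) + l)
            (dec-false (Inside? (node ℓ (b′ ∷ p′))) not-inside) (level-child b′ (node ℓ p′))

  -- The output may be overwritten many times, so it is followed by a three-way invariant. A block
  -- outside the range can become the output only after more than `thr` visits, and these alone give
  -- the third alternative, which the potential later rules out.
  Settled : State → Set
  Settled s = (∃ λ k → InRange k × out s ≡ w * k) ⊎ (∀ k → count k (hist s) ≤ thr) ⊎ thr < outliers (hist s)

  settled-advance : ∀ s a b g → Settled s → Settled (advance s a b g)
  settled-advance s a b g settled = visited _ refl
    where
    k = block (here s)
    H = k ∷ hist s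
    few-grow : count k H ≤ thr → (∀ k → count k (hist s) ≤ thr) → ∀ k′ → count k′ H ≤ thr
    few-grow fewₖ few k′ with k′ ≡ᵇ k in eq
    ... | false = few k′
    ... | true  rewrite ≡ᵇ-true⁻¹ k′ k eq = subst (λ b → bit b + count k (hist s) ≤ thr) (≡ᵇ-refl k) fewₖ
    often : ∀ b → inInterval β 14 k ≡ b → thr < count k H →
      (∃ λ k′ → InRange k′ × w * k ≡ w * k′) ⊎ (∀ k′ → count k′ H ≤ thr) ⊎ thr < outliers H
    often true  eq _     = inj₁ (k , inInterval-true⁻¹ β 14 k eq , refl)
    often false eq thr<  = inj₂ (inj₂ (ℕ.<-≤-trans thr< (count≤outside β 14 k eq H)))
    seldom : count k H ≤ thr → Settled s →
      (∃ λ k′ → InRange k′ × out s ≡ w * k′) ⊎ (∀ k′ → count k′ H ≤ thr) ⊎ thr < outliers H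
    seldom fewₖ (inj₁ good)        = inj₁ good
    seldom fewₖ (inj₂ (inj₁ few))  = inj₂ (inj₁ (few-grow fewₖ few))
    seldom fewₖ (inj₂ (inj₂ many)) = inj₂ (inj₂ (ℕ.<-≤-trans many (ℕ.m≤n+m _ (outlier k))))
    visited : ∀ b → (thr <ᵇ count k H) ≡ b →
      (∃ λ k′ → InRange k′ × (if b then w * k else out s) ≡ w * k′) ⊎ (∀ k′ → count k′ H ≤ thr) ⊎ thr < outliers H
    visited true  eq = often _ refl (<ᵇ-true⁻¹ thr _ eq)
    visited false eq = seldom (<ᵇ-false⁻¹ thr _ eq) settled

  -- `suc ℓ` is the potential of the bare root. A spoiled test is charged 3: at most 2 for the
  -- potential and 1 for an outlier in the same step.
  Invariant : State → ℕ → Set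
  Invariant s B = outliers (hist s) + potential (path s) ≤ suc ℓ + B * 3

  invariant-next : ∀ u s B → u + c + c + c ≤ w → Invariant s B → Invariant (next o u s)
    (B + spoiled c (lo-errs o u s) + spoiled c (hi-errs o u s) + spoiled c (mid-errs o u s))
  invariant-next u s B fit inv =
    subst (λ B → t + h + potential p′ ≤ suc ℓ + B * 3) (sym (assoc B x y z)) (by-cases (x + y + z) refl)
    where
    p = path s
    t = outlier (block (here s))
    h = outliers (hist s)
    p′ = path (next o u s)
    eq : ∀ t h φ′ φ B ℓ → t + h + φ′ + (suc ℓ + B * 3 + φ) + 0 ≡ suc ℓ + (B + 0) * 3 + (h + φ + (φ′ + t))
    eq = solve-∀
    eq′ : ∀ t h φ′ φ B C ℓ → t + h + φ′ + ((suc ℓ + B * 3) + (φ + 3) + 1 + 3 * C) + 0 ≡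
      suc ℓ + (B + C) * 3 + (h + φ + (φ′ + 1) + t + 3)
    eq′ = solve-∀
    spoiled-step : ∀ C → 1 ≤ C → t + h + potential p′ ≤ suc ℓ + (B + C) * 3
    spoiled-step C 1≤C = ≤-by _ (suc ℓ + (B + C) * 3) 0
      (ℕ.+-mono-≤ (ℕ.+-mono-≤ (ℕ.+-mono-≤ inv (any-step (passes (here s) (lo-ups o u s) (hi-ups o u s)) (majority c (mid-ups o u s)) p))
        (bit≤1 (not (inInterval β 14 (block (here s)))))) (ℕ.*-monoʳ-≤ 3 1≤C))
      (eq′ t h (potential p′) (potential p) B C ℓ)
    x = spoiled c (lo-errs o u s)
    y = spoiled c (hi-errs o u s)
    z = spoiled c (mid-errs o u s)
    assoc : ∀ B x y z → B + x + y + z ≡ B + (x + y + z)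
    assoc = solve-∀
    by-cases : ∀ C → x + y + z ≡ C → t + h + potential p′ ≤ suc ℓ + (B + C) * 3
    by-cases (suc C) _  = spoiled-step (suc C) (s≤s z≤n)
    by-cases zero    x+y+z≡0 = ≤-by _ (suc ℓ + (B + 0) * 3) 0
      (ℕ.+-mono-≤ inv (sound-step p (lo-ups o u s) (hi-ups o u s) (mid-ups o u s)
        (poll-sound _ u (ℕ.≤-trans (ℕ.≤-trans (ℕ.m≤m+n (u + c) c) (ℕ.m≤m+n (u + c + c) c)) fit)
          (ℕ.m+n≡0⇒m≡0 x (ℕ.m+n≡0⇒m≡0 (x + y) x+y+z≡0)))
        (poll-sound _ (u + c) (ℕ.≤-trans (ℕ.m≤m+n (u + c + c) c) fit)
          (ℕ.m+n≡0⇒n≡0 x (ℕ.m+n≡0⇒m≡0 (x + y) x+y+z≡0)))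
        (poll-sound _ (u + c + c) fit (ℕ.m+n≡0⇒n≡0 (x + y) x+y+z≡0))))
      (eq t h (potential p′) (potential p) B ℓ)

  length-walk : ∀ t u s B → length (hist (proj₁ (eval (walk t u s B) o))) ≡ t + length (hist s)
  length-walk zero    u s B = refl
  length-walk (suc t) u s B = trans (cong (λ x → length (hist (proj₁ x))) (eval-walk o t u s B))
    (trans (length-walk t _ (next o u s) _) (ℕ.+-suc t _))

  invariants-walk : ∀ t u s B → u + t * (c + c + c) ≤ w → Invariant s B → Settled s →
    let s′ , B′ = eval (walk t u s B) o in Invariant s′ B′ × Settled s′
  invariants-walk zero    u s B _   inv settled = inv , settled
  invariants-walk (suc t) u s B fit inv settled rewrite eval-walk o t u s B =
    invariants-walk t (u + c + c + c) (next o u s) _ fit₃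
      (invariant-next u s B (ℕ.≤-trans (ℕ.m≤m+n _ _) fit₃) inv)
      (settled-advance s (lo-ups o u s) (hi-ups o u s) (mid-ups o u s) settled)
    where
    fit₃ : u + c + c + c + t * (c + c + c) ≤ w
    fit₃ = ≤-respˡ fit (ring (u ∷ c ∷ t ∷ []))

  walk-correct : ∀ t x → t * (c + c + c) ≤ w → 15 * thr < t →
    let s′ , B′ = eval (walk t 0 (state [] [] x) 0) o in
    suc ℓ + B′ * 3 ≤ thr → ℕ.∣ out s′ - suc r ∣ ≤ w * 15
  walk-correct t x fit long few = conclude (invariants-walk t 0 (state [] [] x) 0 fit
    (ℕ.≤-reflexive (sym (ℕ.+-identityʳ (suc ℓ)))) (inj₂ (inj₁ λ _ → z≤n)))
    where
    s′ = proj₁ (eval (walk t 0 (state [] [] x) 0) o)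
    B′ = proj₂ (eval (walk t 0 (state [] [] x) 0) o)
    conclude : Invariant s′ B′ × Settled s′ → ℕ.∣ out s′ - suc r ∣ ≤ w * 15
    conclude (inv , inj₁ (k , range , eq)) = subst (λ y → ℕ.∣ y - suc r ∣ ≤ w * 15) (sym eq) (in-range-close k range)
    conclude (inv , inj₂ (inj₂ many)) = contradiction (ℕ.≤-trans (ℕ.m+n≤o⇒m≤o (outliers (hist s′)) inv) few) (ℕ.<⇒≱ many)
    -- At most `thr` outliers and at most `thr` visits to each of the 14 good blocks account for
    -- only `15 * thr` of the `t` steps.
    conclude (inv , inj₂ (inj₁ seldom)) = contradiction
      (ℕ.≤-trans (ℕ.≤-reflexive (sym (trans (length-walk t 0 (state [] [] x) 0) (ℕ.+-identityʳ t))))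
        (ℕ.≤-trans (length≤outside β thr (hist s′) seldom 14)
          (ℕ.+-monoˡ-≤ (14 * thr) (ℕ.≤-trans (ℕ.m+n≤o⇒m≤o (outliers (hist s′)) inv) few))))
      (ℕ.<⇒≱ long)

-- The number of spoiled tests

ι : ℕ → ℚ
ι n = ℤ.+ n ℚ./ 1

private
  toℚᵘ-ι : ∀ n → toℚᵘ (ι n) ℚᵘ.≃ mkℚᵘ (ℤ.+ n) 0
  toℚᵘ-ι n = ℚ.toℚᵘ-fromℚᵘ (mkℚᵘ (ℤ.+ n) 0)

ι-+ : ∀ m n → ι (m ℕ.+ n) ≡ ι m ℚ.+ ι n
ι-+ m n = ℚ.toℚᵘ-injective (ℚᵘ.≃-trans (toℚᵘ-ι (m ℕ.+ n)) (ℚᵘ.≃-trans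
  (*≡* (cong (ℤ._* ℤ.+ 1) (sym (cong₂ ℤ._+_ (ℤ.*-identityʳ (ℤ.+ m)) (ℤ.*-identityʳ (ℤ.+ n))))))
  (ℚᵘ.≃-sym (ℚᵘ.≃-trans (ℚ.toℚᵘ-homo-+ (ι m) (ι n)) (ℚᵘ.+-cong (toℚᵘ-ι m) (toℚᵘ-ι n))))))

ι-* : ∀ m n → ι (m ℕ.* n) ≡ ι m ℚ.* ι n
ι-* m n = ℚ.toℚᵘ-injective (ℚᵘ.≃-trans (toℚᵘ-ι (m ℕ.* n)) (ℚᵘ.≃-trans
  (*≡* (cong (ℤ._* ℤ.+ 1) (ℤ.pos-* m n)))
  (ℚᵘ.≃-sym (ℚᵘ.≃-trans (ℚ.toℚᵘ-homo-* (ι m) (ι n)) (ℚᵘ.*-cong (toℚᵘ-ι m) (toℚᵘ-ι n))))))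

ι-mono-≤ : ∀ {m n} → m ℕ.≤ n → ι m ℚ.≤ ι n
ι-mono-≤ {m} {n} m≤n = ℚ.toℚᵘ-cancel-≤ (ℚᵘ.≤-respˡ-≃ (ℚᵘ.≃-sym (toℚᵘ-ι m)) (ℚᵘ.≤-respʳ-≃ (ℚᵘ.≃-sym (toℚᵘ-ι n))
  (*≤* (ℤ.*-monoʳ-≤-nonNeg (ℤ.+ 1) (ℤ.+≤+ m≤n)))))

1/n*ιn : ∀ n .{{_ : NonZero n}} → (ℤ.+ 1 ℚ./ n) ℚ.* ι n ≡ 1ℚ
1/n*ιn (suc n) = ℚ.toℚᵘ-injective (ℚᵘ.≃-trans (ℚ.toℚᵘ-homo-* (ℤ.+ 1 ℚ./ suc n) (ι (suc n)))
  (ℚᵘ.≃-trans (ℚᵘ.*-cong (ℚ.toℚᵘ-fromℚᵘ (mkℚᵘ (ℤ.+ 1) n)) (toℚᵘ-ι (suc n)))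
    (*≡* (trans (ℤ.*-identityʳ _) (trans (ℤ.*-identityˡ (ℤ.+ suc n))
      (sym (trans (ℤ.*-identityˡ _) (cong ℤ.+_ (ℕ.*-identityʳ (suc n))))))))))

0≤ι : ∀ n → 0ℚ ℚ.≤ ι n
0≤ι n = ι-mono-≤ {0} {n} z≤n

*-monoˡ : ∀ {p q r} → 0ℚ ℚ.≤ r → p ℚ.≤ q → r ℚ.* p ℚ.≤ r ℚ.* q
*-monoˡ {r = r} 0≤r = ℚ.*-monoˡ-≤-nonNeg r {{ℚ.nonNegative 0≤r}}

*-monoʳ : ∀ {p q r} → 0ℚ ℚ.≤ r → p ℚ.≤ q → p ℚ.* r ℚ.≤ q ℚ.* r
*-monoʳ {r = r} 0≤r = ℚ.*-monoʳ-≤-nonNeg r {{ℚ.nonNegative 0≤r}}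

0≤^ : ∀ {p} n → 0ℚ ℚ.≤ p → 0ℚ ℚ.≤ p ^ℚ n
0≤^ zero    0≤p = ℚ.<⇒≤ (ℚ.positive⁻¹ 1ℚ)
0≤^ (suc n) 0≤p = 0≤* 0≤p (0≤^ n 0≤p)

-- Each factor `b` cancels against one `a`. This is the exponential-moment test for a spoiled
-- majority: at least as many wrong answers (`ε`) as right ones (`s`).
1≤a^*b^ : ∀ {a b} → 0ℚ ℚ.≤ b → 1ℚ ℚ.≤ a → a ℚ.* b ≡ 1ℚ → ∀ {s ε} → s ℕ.≤ ε → 1ℚ ℚ.≤ a ^ℚ ε ℚ.* b ^ℚ s
1≤a^*b^ {a} {b} 0≤b 1≤a ab≡1 {ε = ε} z≤n = subst (1ℚ ℚ.≤_) (sym (ℚ.*-identityʳ (a ^ℚ ε))) (1≤a^ ε)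
  where
  0≤a : 0ℚ ℚ.≤ a
  0≤a = ℚ.≤-trans (ℚ.<⇒≤ (ℚ.positive⁻¹ 1ℚ)) 1≤a
  1≤a^ : ∀ n → 1ℚ ℚ.≤ a ^ℚ n
  1≤a^ zero    = ℚ.≤-refl
  1≤a^ (suc n) = ℚ.≤-trans 1≤a (subst (ℚ._≤ a ℚ.* a ^ℚ n) (ℚ.*-identityʳ a) (*-monoˡ 0≤a (1≤a^ n)))
1≤a^*b^ {a} {b} 0≤b 1≤a ab≡1 {suc s} {suc ε} (s≤s s≤ε) = subst (1ℚ ℚ.≤_)
  (trans (sym (ℚ.*-identityˡ _)) (trans (cong (ℚ._* (a ^ℚ ε ℚ.* b ^ℚ s)) (sym ab≡1)) (interchange a b (a ^ℚ ε) (b ^ℚ s))))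
  (1≤a^*b^ 0≤b 1≤a ab≡1 s≤ε)
  where
  open +-*-Solver
  interchange : ∀ a b x y → a ℚ.* b ℚ.* (x ℚ.* y) ≡ a ℚ.* x ℚ.* (b ℚ.* y)
  interchange = solve 4 (λ a b x y → a :* b :* (x :* y) := a :* x :* (b :* y)) refl

Bounded-mono : ∀ {X truth p h} (T : Tree X) {V V′} → V ℚ.≤ V′ → Bounded truth p h T V → Bounded truth p h T V′
Bounded-mono (ret x)   V≤V′ hx≤V = ℚ.≤-trans hx≤V V≤V′
Bounded-mono (ask j κ) V≤V′ (Vʳ , Vʷ , bʳ , bʷ , le , mix≤V) = Vʳ , Vʷ , bʳ , bʷ , le , ℚ.≤-trans mix≤V V≤V′

module Chances (c w ℓ thr : ℕ) (truth : ℕ → Bool) (p a b κ₀ : ℚ) (M : ℕ)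
  (0≤b : 0ℚ ℚ.≤ b) (1≤a : 1ℚ ℚ.≤ a) (ab≡1 : a ℚ.* b ≡ 1ℚ) (b≤a : b ℚ.≤ a)
  (0≤ρ : 0ℚ ℚ.≤ p ℚ.* a ℚ.+ (1ℚ ℚ.- p) ℚ.* b)
  (Mρ≤1 : ι M ℚ.* (p ℚ.* a ℚ.+ (1ℚ ℚ.- p) ℚ.* b) ^ℚ c ℚ.≤ 1ℚ) (0≤κ₀ : 0ℚ ℚ.≤ κ₀) where

  open Search c w ℓ thr truth

  ρ : ℚ
  ρ = p ℚ.* a ℚ.+ (1ℚ ℚ.- p) ℚ.* b

  private
    0≤a : 0ℚ ℚ.≤ a
    0≤a = ℚ.≤-trans (ℚ.<⇒≤ (ℚ.positive⁻¹ 1ℚ)) 1≤a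

    xor-self : ∀ t → bit (t xor t) ≡ 0
    xor-self true  = refl
    xor-self false = refl

    not-xor : ∀ t → bit (not t xor t) ≡ 1
    not-xor true  = refl
    not-xor false = refl

    open +-*-Solver
    mix : ∀ p a b Q M x y z →
      p ℚ.* (Q ℚ.* (1ℚ ℚ.+ M ℚ.* ((a ℚ.* x) ℚ.* y ℚ.* z))) ℚ.+ (1ℚ ℚ.- p) ℚ.* (Q ℚ.* (1ℚ ℚ.+ M ℚ.* (x ℚ.* (b ℚ.* y) ℚ.* z))) ≡
      Q ℚ.* (1ℚ ℚ.+ M ℚ.* (x ℚ.* y ℚ.* ((p ℚ.* a ℚ.+ (1ℚ ℚ.- p) ℚ.* b) ℚ.* z)))
    mix = solve 8 (λ p a b Q M x y z →
      p :* (Q :* (con 1ℚ :+ M :* ((a :* x) :* y :* z))) :+ (con 1ℚ :- p) :* (Q :* (con 1ℚ :+ M :* (x :* (b :* y) :* z))) :=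
      Q :* (con 1ℚ :+ M :* (x :* y :* ((p :* a :+ (con 1ℚ :- p) :* b) :* z)))) refl
    swap : ∀ b x y → x ℚ.* (b ℚ.* y) ≡ b ℚ.* (x ℚ.* y)
    swap = solve 3 (λ b x y → x :* (b :* y) := b :* (x :* y)) refl

  module _ {X : Set} (h : X → ℚ) where

    -- A Chernoff bound in martingale form. A wrong answer multiplies the weight by `a`, a right one
    -- by `b`, and each pending question counts with their average `ρ`. The summand 1 pays for
    -- unspoiled ends, the weighted summand for spoiled ones.
    poll-bounded : ∀ n j v ε s (κ : ℕ → ℕ → Tree X) Q → 0ℚ ℚ.≤ Q → n ℕ.+ (ε ℕ.+ s) ≡ c →
      (∀ v ε → Bounded truth p h (κ v ε) (Q ℚ.* ι (M ℕ.^ spoiled c ε))) →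
      Bounded truth p h (poll n j v ε κ) (Q ℚ.* (1ℚ ℚ.+ ι M ℚ.* (a ^ℚ ε ℚ.* b ^ℚ s ℚ.* ρ ^ℚ n)))
    poll-bounded zero j v ε s κ Q 0≤Q ε+s≡c bound = Bounded-mono (κ v ε) (*-monoˡ 0≤Q spoil) (bound v ε)
      where
      0≤weight : 0ℚ ℚ.≤ ι M ℚ.* (a ^ℚ ε ℚ.* b ^ℚ s ℚ.* 1ℚ)
      0≤weight = 0≤* (0≤ι M) (0≤* (0≤* (0≤^ ε 0≤a) (0≤^ s 0≤b)) (ℚ.<⇒≤ (ℚ.positive⁻¹ 1ℚ)))
      spoil : ι (M ℕ.^ spoiled c ε) ℚ.≤ 1ℚ ℚ.+ ι M ℚ.* (a ^ℚ ε ℚ.* b ^ℚ s ℚ.* 1ℚ)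
      spoil with c ≤ᵇ ε ℕ.+ ε in eq
      ... | false = p≤p+q 0≤weight
      ... | true  = ℚ.≤-trans (ℚ.≤-reflexive (trans (cong ι (ℕ.*-identityʳ M)) (sym (ℚ.*-identityʳ (ι M)))))
        (ℚ.≤-trans (*-monoˡ (0≤ι M) (subst (1ℚ ℚ.≤_) (sym (ℚ.*-identityʳ _)) (1≤a^*b^ 0≤b 1≤a ab≡1 s≤ε)))
          (subst (ℚ._≤ 1ℚ ℚ.+ ι M ℚ.* (a ^ℚ ε ℚ.* b ^ℚ s ℚ.* 1ℚ)) (ℚ.+-identityˡ weight′) (ℚ.+-monoˡ-≤ weight′ (ℚ.<⇒≤ (ℚ.positive⁻¹ 1ℚ)))))
        where
        weight′ = ι M ℚ.* (a ^ℚ ε ℚ.* b ^ℚ s ℚ.* 1ℚ)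
        s≤ε : s ℕ.≤ ε
        s≤ε = ℕ.+-cancelˡ-≤ ε s ε (subst (ℕ._≤ ε ℕ.+ ε) (sym ε+s≡c) (≤ᵇ-true⁻¹ c (ε ℕ.+ ε) eq))
    poll-bounded (suc n) j v ε s κ Q 0≤Q eq bound =
      Q ℚ.* (1ℚ ℚ.+ ι M ℚ.* (a ^ℚ ε ℚ.* b ^ℚ suc s ℚ.* ρ ^ℚ n)) ,
      Q ℚ.* (1ℚ ℚ.+ ι M ℚ.* (a ^ℚ suc ε ℚ.* b ^ℚ s ℚ.* ρ ^ℚ n)) ,
      right , wrong , right≤wrong ,
      ℚ.≤-reflexive (mix p a b Q (ι M) (a ^ℚ ε) (b ^ℚ s) (ρ ^ℚ n))
      where
      right : Bounded truth p h (poll n (suc j) (v ℕ.+ bit (truth j)) (ε ℕ.+ bit (truth j xor truth j)) κ)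
        (Q ℚ.* (1ℚ ℚ.+ ι M ℚ.* (a ^ℚ ε ℚ.* b ^ℚ suc s ℚ.* ρ ^ℚ n)))
      right rewrite xor-self (truth j) | ℕ.+-identityʳ ε = poll-bounded n (suc j) _ ε (suc s) κ Q 0≤Q
        (trans (cong (n ℕ.+_) (ℕ.+-suc ε s)) (trans (ℕ.+-suc n (ε ℕ.+ s)) eq)) bound
      wrong : Bounded truth p h (poll n (suc j) (v ℕ.+ bit (not (truth j))) (ε ℕ.+ bit (not (truth j) xor truth j)) κ)
        (Q ℚ.* (1ℚ ℚ.+ ι M ℚ.* (a ^ℚ suc ε ℚ.* b ^ℚ s ℚ.* ρ ^ℚ n)))
      wrong rewrite not-xor (truth j) | ℕ.+-comm ε 1 = poll-bounded n (suc j) _ (suc ε) s κ Q 0≤Q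
        (trans (ℕ.+-suc n (ε ℕ.+ s)) eq) bound
      right≤wrong : Q ℚ.* (1ℚ ℚ.+ ι M ℚ.* (a ^ℚ ε ℚ.* b ^ℚ suc s ℚ.* ρ ^ℚ n)) ℚ.≤ Q ℚ.* (1ℚ ℚ.+ ι M ℚ.* (a ^ℚ suc ε ℚ.* b ^ℚ s ℚ.* ρ ^ℚ n))
      right≤wrong = *-monoˡ 0≤Q (ℚ.+-monoʳ-≤ 1ℚ (*-monoˡ (0≤ι M) (*-monoʳ (0≤^ n 0≤ρ)
        (subst₂ ℚ._≤_ (sym (swap b (a ^ℚ ε) (b ^ℚ s))) (sym (ℚ.*-assoc a (a ^ℚ ε) (b ^ℚ s)))
          (*-monoʳ (0≤* (0≤^ ε 0≤a) (0≤^ s 0≤b)) b≤a)))))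

    -- Initially the bound is `1 + M * ρ ^ c`, and `c` is chosen so that the second term is at most
    -- 1.
    test-bounded : ∀ j (κ : ℕ → ℕ → Tree X) Q → 0ℚ ℚ.≤ Q →
      (∀ v ε → Bounded truth p h (κ v ε) (Q ℚ.* ι (M ℕ.^ spoiled c ε))) →
      Bounded truth p h (poll c j 0 0 κ) (Q ℚ.* ι 2)
    test-bounded j κ Q 0≤Q bound = Bounded-mono (poll c j 0 0 κ)
      (*-monoˡ 0≤Q (ℚ.+-monoʳ-≤ 1ℚ (subst (λ x → ι M ℚ.* x ℚ.≤ 1ℚ) (sym (ℚ.*-identityˡ (ρ ^ℚ c))) Mρ≤1)))
      (poll-bounded c j 0 0 0 κ Q 0≤Q (ℕ.+-identityʳ c) bound)

  leaf-value : State × ℕ → ℚ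
  leaf-value (_ , B) = κ₀ ℚ.* ι (M ℕ.^ B)

  private
    split-power : ∀ B s t → κ₀ ℚ.* ι (M ℕ.^ (B ℕ.+ s)) ℚ.* t ≡ κ₀ ℚ.* ι (M ℕ.^ B) ℚ.* t ℚ.* ι (M ℕ.^ s)
    split-power B s t = trans
      (cong (λ x → κ₀ ℚ.* x ℚ.* t) (trans (cong ι (ℕ.^-distribˡ-+-* M B s)) (ι-* (M ℕ.^ B) (M ℕ.^ s))))
      (move-last κ₀ (ι (M ℕ.^ B)) t (ι (M ℕ.^ s)))
      where
      open +-*-Solver
      move-last : ∀ k x t y → k ℚ.* (x ℚ.* y) ℚ.* t ≡ k ℚ.* x ℚ.* t ℚ.* y
      move-last = solve 4 (λ k x t y → k :* (x :* y) :* t := k :* x :* t :* y) refl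

    0≤value : ∀ B {t} → 0ℚ ℚ.≤ t → 0ℚ ℚ.≤ κ₀ ℚ.* ι (M ℕ.^ B) ℚ.* t
    0≤value B 0≤t = 0≤* (0≤* 0≤κ₀ (0≤ι (M ℕ.^ B))) 0≤t

  -- Three tests per step, each costing a factor 2, give the base 8.
  walk-bounded : ∀ t u s B → Bounded truth p leaf-value (walk t u s B) (κ₀ ℚ.* ι (M ℕ.^ B) ℚ.* ι (8 ℕ.^ t))
  walk-bounded zero    u s B = ℚ.≤-reflexive (sym (ℚ.*-identityʳ _))
  walk-bounded (suc t) u s B = subst (Bounded truth p leaf-value (walk (suc t) u s B)) total
    (test-bounded leaf-value _ _ (κ₀ ℚ.* ι (M ℕ.^ B) ℚ.* t₂) (0≤value B 0≤t₂) λ a εa →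
      subst (Bounded truth p leaf-value _) (split-after B (spoiled c εa) t₁)
      (test-bounded leaf-value _ _ (κ₀ ℚ.* ι (M ℕ.^ (B ℕ.+ spoiled c εa)) ℚ.* t₁) (0≤value (B ℕ.+ spoiled c εa) 0≤t₁) λ b εb →
        subst (Bounded truth p leaf-value _) (split-after (B ℕ.+ spoiled c εa) (spoiled c εb) t₀)
        (test-bounded leaf-value _ _ (κ₀ ℚ.* ι (M ℕ.^ (B ℕ.+ spoiled c εa ℕ.+ spoiled c εb)) ℚ.* t₀)
          (0≤value (B ℕ.+ spoiled c εa ℕ.+ spoiled c εb) (0≤ι (8 ℕ.^ t))) λ g εg →
          subst (Bounded truth p leaf-value _) (split-power (B ℕ.+ spoiled c εa ℕ.+ spoiled c εb) (spoiled c εg) t₀)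
          (walk-bounded t _ _ _))))
    where
    t₀ t₁ t₂ : ℚ
    t₀ = ι (8 ℕ.^ t)
    t₁ = t₀ ℚ.* ι 2
    t₂ = t₁ ℚ.* ι 2
    0≤t₁ = 0≤* (0≤ι (8 ℕ.^ t)) (0≤ι 2)
    0≤t₂ = 0≤* 0≤t₁ (0≤ι 2)
    split-after : ∀ B s t → κ₀ ℚ.* ι (M ℕ.^ (B ℕ.+ s)) ℚ.* t ℚ.* ι 2 ≡ κ₀ ℚ.* ι (M ℕ.^ B) ℚ.* (t ℚ.* ι 2) ℚ.* ι (M ℕ.^ s)
    split-after B s t = trans (ℚ.*-assoc (κ₀ ℚ.* ι (M ℕ.^ (B ℕ.+ s))) t (ι 2)) (split-power B s (t ℚ.* ι 2))
    total : κ₀ ℚ.* ι (M ℕ.^ B) ℚ.* t₂ ℚ.* ι 2 ≡ κ₀ ℚ.* ι (M ℕ.^ B) ℚ.* ι (8 ℕ.^ suc t)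
    total = trans (ℚ.*-assoc (κ₀ ℚ.* ι (M ℕ.^ B)) t₂ (ι 2)) (cong (κ₀ ℚ.* ι (M ℕ.^ B) ℚ.*_) (trans (gather t₀ (ι 2))
      (sym (ι-* 8 (8 ℕ.^ t)))))
      where
      open +-*-Solver
      gather : ∀ x y → x ℚ.* y ℚ.* y ℚ.* y ≡ y ℚ.* y ℚ.* y ℚ.* x
      gather = solve 2 (λ x y → x :* y :* y :* y := y :* y :* y :* x) refl

-- Logarithms and constants

⌊n/2⌋-lower : ∀ n → ⌊ n /2⌋ ℕ.+ ⌊ n /2⌋ ℕ.≤ n
⌊n/2⌋-lower n = ℕ.≤-trans (ℕ.+-monoʳ-≤ ⌊ n /2⌋ (ℕ.⌊n/2⌋≤⌈n/2⌉ n)) (ℕ.≤-reflexive (ℕ.⌊n/2⌋+⌈n/2⌉≡n n))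

⌊n/2⌋-upper : ∀ n → n ℕ.≤ suc (⌊ n /2⌋ ℕ.+ ⌊ n /2⌋)
⌊n/2⌋-upper zero          = z≤n
⌊n/2⌋-upper (suc zero)    = s≤s z≤n
⌊n/2⌋-upper (suc (suc n)) = s≤s (subst (suc n ℕ.≤_) (cong suc (sym (ℕ.+-suc ⌊ n /2⌋ ⌊ n /2⌋))) (s≤s (⌊n/2⌋-upper n)))

-- `k` halvings take `n` to 0, the form in which the counting loops of the program meet the
-- logarithm.
HasBits : ℕ → ℕ → Set
HasBits zero    n = n ≡ 0
HasBits (suc k) n = 2 ℕ.^ k ℕ.≤ n × n ℕ.< 2 ℕ.^ suc k

private
  half-< : ∀ {x y} → x ℕ.+ x ℕ.< y ℕ.+ y → x ℕ.< y
  half-< {x} {y} x+x<y+y with x ℕ.<? y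
  ... | yes x<y = x<y
  ... | no  x≮y = contradiction x+x<y+y (ℕ.≤⇒≯ (ℕ.+-mono-≤ (ℕ.≮⇒≥ x≮y) (ℕ.≮⇒≥ x≮y)))

  2^suc : ∀ k → 2 ℕ.^ suc k ≡ 2 ℕ.^ k ℕ.+ 2 ℕ.^ k
  2^suc k = cong (2 ℕ.^ k ℕ.+_) (ℕ.+-identityʳ _)

hasBits-half : ∀ k n → HasBits (suc k) n → HasBits k ⌊ n /2⌋
hasBits-half zero (suc zero) _ = refl
hasBits-half zero (suc (suc n)) (_ , s≤s (s≤s ()))
hasBits-half (suc k) n (lo , hi) =
  ℕ.s≤s⁻¹ (half-< (ℕ.≤-trans (s≤s (subst (ℕ._≤ suc (⌊ n /2⌋ ℕ.+ ⌊ n /2⌋)) (2^suc k) (ℕ.≤-trans lo (⌊n/2⌋-upper n))))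
    (ℕ.≤-reflexive (cong suc (sym (ℕ.+-suc ⌊ n /2⌋ ⌊ n /2⌋)))))) ,
  half-< (ℕ.≤-trans (s≤s (⌊n/2⌋-lower n)) (subst (suc n ℕ.≤_) (2^suc (suc k)) hi))

log-upper : ∀ n → n ℕ.< 2 ℕ.^ suc ⌊log₂ n ⌋
log-upper n with n ℕ.<? 2 ℕ.^ suc ⌊log₂ n ⌋
... | yes n< = n<
... | no  n≮ = contradiction
  (subst (ℕ._≤ ⌊log₂ n ⌋) (⌊log₂[2^n]⌋≡n (suc ⌊log₂ n ⌋)) (⌊log₂⌋-mono-≤ (ℕ.≮⇒≥ n≮))) (ℕ.<⇒≱ ℕ.≤-refl)

log-lower : ∀ n .{{_ : NonZero n}} → 2 ℕ.^ ⌊log₂ n ⌋ ℕ.≤ n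
log-lower n = go ⌊log₂ n ⌋ n refl
  where
  go : ∀ k n .{{_ : NonZero n}} → ⌊log₂ n ⌋ ≡ k → 2 ℕ.^ k ℕ.≤ n
  go zero    n eq = ℕ.>-nonZero⁻¹ n
  go (suc k) (suc zero) eq = contradiction (trans (sym (⌊log₂[2^n]⌋≡n 0)) eq) λ ()
  go (suc k) n@(suc (suc n′)) eq = ℕ.≤-trans (ℕ.≤-reflexive (2^suc k)) (ℕ.≤-trans (ℕ.+-mono-≤ ih ih) (⌊n/2⌋-lower n))
    where
    ih : 2 ℕ.^ k ℕ.≤ ⌊ n /2⌋
    ih = go k ⌊ n /2⌋ (trans (⌊log₂⌊n/2⌋⌋≡⌊log₂n⌋∸1 n) (cong pred eq))

hasBits-log : ∀ n .{{_ : NonZero n}} → HasBits (suc ⌊log₂ n ⌋) n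
hasBits-log n = log-lower n , log-upper n

-- Comparing the natural with the binary logarithm

harmonic-+ : ∀ a l l′ → harmonic a (l ℕ.+ l′) ≡ harmonic a l ℚ.+ harmonic (a ℕ.+ l) l′
harmonic-+ a l zero     = trans (cong (harmonic a) (ℕ.+-identityʳ l)) (sym (ℚ.+-identityʳ _))
harmonic-+ a l (suc l′) = trans (cong (harmonic a) (ℕ.+-suc l l′))
  (trans (cong₂ ℚ._+_ (harmonic-+ a l l′) (cong (λ n → ℤ.+ 1 ℚ./ suc n) (sym (ℕ.+-assoc a l l′))))
    (ℚ.+-assoc (harmonic a l) (harmonic (a ℕ.+ l) l′) _))

0<ι : ∀ n .{{_ : NonZero n}} → 0ℚ ℚ.< ι n
0<ι n = ℚ.<-≤-trans (ℚ.positive⁻¹ 1ℚ) (ι-mono-≤ (ℕ.>-nonZero⁻¹ n))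

1/-anti : ∀ {m n} .{{_ : NonZero m}} .{{_ : NonZero n}} → m ℕ.≤ n → ℤ.+ 1 ℚ./ n ℚ.≤ ℤ.+ 1 ℚ./ m
1/-anti {m} {n} m≤n = ℚ.*-cancelʳ-≤-pos (ι m) {{ℚ.positive (0<ι m)}}
  (ℚ.≤-trans (*-monoˡ (ℚ.nonNegative⁻¹ (ℤ.+ 1 ℚ./ n) {{ℚ.normalize-nonNeg 1 n}}) (ι-mono-≤ m≤n))
    (ℚ.≤-reflexive (trans (1/n*ιn n) (sym (1/n*ιn m)))))

0≤1/ : ∀ n .{{_ : NonZero n}} → 0ℚ ℚ.≤ ℤ.+ 1 ℚ./ n
0≤1/ n = ℚ.nonNegative⁻¹ (ℤ.+ 1 ℚ./ n) {{ℚ.normalize-nonNeg 1 n}}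

harmonic-≥ : ∀ a l n .{{_ : NonZero n}} → a ℕ.+ l ℕ.≤ n → ι l ℚ.* (ℤ.+ 1 ℚ./ n) ℚ.≤ harmonic a l
harmonic-≥ a zero    n _     = ℚ.≤-reflexive (ℚ.*-zeroˡ (ℤ.+ 1 ℚ./ n))
harmonic-≥ a (suc l) n a+l≤n = ℚ.≤-trans
  (ℚ.≤-reflexive (trans (cong (ℚ._* (ℤ.+ 1 ℚ./ n)) (trans (cong ι (ℕ.+-comm 1 l)) (ι-+ l 1)))
    (trans (ℚ.*-distribʳ-+ (ℤ.+ 1 ℚ./ n) (ι l) (ι 1)) (cong (λ x → ι l ℚ.* (ℤ.+ 1 ℚ./ n) ℚ.+ x) (ℚ.*-identityˡ (ℤ.+ 1 ℚ./ n))))))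
  (ℚ.+-mono-≤ (harmonic-≥ a l n (ℕ.≤-trans (ℕ.+-monoʳ-≤ a (ℕ.n≤1+n l)) a+l≤n))
    (1/-anti (ℕ.≤-trans (ℕ.≤-reflexive (sym (ℕ.+-suc a l))) a+l≤n)))

0≤harmonic : ∀ a l → 0ℚ ℚ.≤ harmonic a l
0≤harmonic a zero    = ℚ.≤-refl
0≤harmonic a (suc l) = ℚ.≤-trans (0≤harmonic a l) (p≤p+q (0≤1/ (suc (a ℕ.+ l))))

harmonic-doubling : ∀ a .{{_ : NonZero a}} → ½ ℚ.≤ harmonic a a
harmonic-doubling a@(suc _) = ℚ.≤-trans (ℚ.≤-reflexive (sym a/2a)) (harmonic-≥ a a (a ℕ.+ a) ℕ.≤-refl)
  where
  open +-*-Solver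
  z = ℤ.+ 1 ℚ./ (a ℕ.+ a)
  halve : ∀ x z → x ℚ.* z ≡ ½ ℚ.* (z ℚ.* (x ℚ.+ x))
  halve = solve 2 (λ x z → x :* z := con ½ :* (z :* (x :+ x))) refl
  a/2a : ι a ℚ.* z ≡ ½
  a/2a = trans (halve (ι a) z) (trans (cong (λ x → ½ ℚ.* (z ℚ.* x)) (sym (ι-+ a a)))
    (trans (cong (½ ℚ.*_) (1/n*ιn (a ℕ.+ a))) (ℚ.*-identityʳ ½)))

-- The range from `t` to `2 ^ j * t` consists of `j` doublings, and each contributes at least one
-- half.
harmonic-power : ∀ j t .{{_ : NonZero t}} → ½ ℚ.* ι j ℚ.≤ harmonic t ((2 ℕ.^ j ℕ.∸ 1) ℕ.* t)
harmonic-power zero    t = ℚ.≤-reflexive (ℚ.*-zeroʳ ½)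
harmonic-power (suc j) t = ℚ.≤-trans
  (ℚ.≤-reflexive (trans (cong (½ ℚ.*_) (trans (cong ι (ℕ.+-comm 1 j)) (ι-+ j 1))) (ℚ.*-distribˡ-+ ½ (ι j) (ι 1))))
  (ℚ.≤-trans (ℚ.+-mono-≤ (harmonic-power j t) last)
    (ℚ.≤-reflexive (trans (sym (harmonic-+ t l (2 ℕ.^ j ℕ.* t))) (cong (harmonic t) l+≡))))
  where
  l = (2 ℕ.^ j ℕ.∸ 1) ℕ.* t
  t+l≡ : t ℕ.+ l ≡ 2 ℕ.^ j ℕ.* t
  t+l≡ = cong (ℕ._* t) (ℕ.m+[n∸m]≡n (ℕ.m^n>0 2 j))
  l+≡ : l ℕ.+ 2 ℕ.^ j ℕ.* t ≡ (2 ℕ.^ suc j ℕ.∸ 1) ℕ.* t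
  l+≡ = trans (sym (ℕ.*-distribʳ-+ t (2 ℕ.^ j ℕ.∸ 1) (2 ℕ.^ j)))
    (cong (ℕ._* t) (trans (ℕ.+-comm (2 ℕ.^ j ℕ.∸ 1) (2 ℕ.^ j))
      (trans (sym (ℕ.+-∸-assoc (2 ℕ.^ j) (ℕ.m^n>0 2 j))) (cong (ℕ._∸ 1) (sym (2^suc j))))))
  last : ½ ℚ.* ι 1 ℚ.≤ harmonic (t ℕ.+ l) (2 ℕ.^ j ℕ.* t)
  last = subst (λ n → ½ ℚ.≤ harmonic n (2 ℕ.^ j ℕ.* t)) (sym t+l≡)
    (harmonic-doubling (2 ℕ.^ j ℕ.* t) {{ℕ.m*n≢0 (2 ℕ.^ j) t {{ℕ.m^n≢0 2 j}}}})

-- The Riemann sums of `ln m` are at least `½ * ⌊log₂ m ⌋`. The tolerance is taken to be one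
-- quarter: doubled, it is one half, which vanishes between integers.
log≤2d : ∀ m .{{_ : NonZero m}} d → ln m ≤ℝ fromℕ d → ⌊log₂ m ⌋ ℕ.≤ d ℕ.+ d
log≤2d m d ln≤d with ln≤d (½ ℚ.* ½) (0<½* (0<½* (ℚ.positive⁻¹ 1ℚ)))
... | N , bound with ⌊log₂ m ⌋ ℕ.≤? d ℕ.+ d
...   | yes le = le
...   | no  gt = contradiction (ℚ.≤-trans (ι-mono-≤ (ℕ.≰⇒> gt)) ι≤) too-big
  where
  open +-*-Solver
  j = ⌊log₂ m ⌋
  t = 2 ℕ.^ N
  2^j∸1≤m∸1 : (2 ℕ.^ j ℕ.∸ 1) ℕ.* t ℕ.≤ (m ℕ.∸ 1) ℕ.* t
  2^j∸1≤m∸1 = ℕ.*-monoˡ-≤ t (ℕ.∸-monoˡ-≤ 1 (log-lower m))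
  monotone : ∀ {l l′} → l ℕ.≤ l′ → harmonic t l ℚ.≤ harmonic t l′
  monotone {l} {l′} l≤l′ = subst (harmonic t l ℚ.≤_)
    (trans (sym (harmonic-+ t l (l′ ℕ.∸ l))) (cong (harmonic t) (ℕ.m+[n∸m]≡n l≤l′)))
    (p≤p+q (0≤harmonic (t ℕ.+ l) (l′ ℕ.∸ l)))
  half≤ : ½ ℚ.* ι j ℚ.≤ ι d ℚ.+ ½ ℚ.* ½
  half≤ = ℚ.≤-trans (harmonic-power j t {{ℕ.m^n≢0 2 N}}) (ℚ.≤-trans (monotone 2^j∸1≤m∸1) (bound N ℕ.≤-refl))
  double : ∀ x → ½ ℚ.* x ℚ.+ ½ ℚ.* x ≡ x
  double x = ½*+½* x
  double′ : ∀ y → (y ℚ.+ ½ ℚ.* ½) ℚ.+ (y ℚ.+ ½ ℚ.* ½) ≡ ½ ℚ.+ (y ℚ.+ y)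
  double′ = solve 1 (λ y → (y :+ con (½ ℚ.* ½)) :+ (y :+ con (½ ℚ.* ½)) := con ½ :+ (y :+ y)) refl
  ι≤ : ι j ℚ.≤ ½ ℚ.+ ι (d ℕ.+ d)
  ι≤ = subst₂ ℚ._≤_ (double (ι j)) (trans (double′ (ι d)) (cong (ℚ._+_ ½) (sym (ι-+ d d)))) (ℚ.+-mono-≤ half≤ half≤)
  too-big : ¬ ι (suc (d ℕ.+ d)) ℚ.≤ ½ ℚ.+ ι (d ℕ.+ d)
  too-big le = ℚ.<-irrefl refl (ℚ.<-≤-trans
    (ℚ.+-monoˡ-< (ι (d ℕ.+ d)) {½} {1ℚ} (*<* (ℤ.+<+ (s≤s (s≤s z≤n)))))
    (ℚ.≤-trans (ℚ.≤-reflexive (sym (ι-+ 1 (d ℕ.+ d)))) le))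

-- The number of votes per test

archimedean : ∀ {q} → 0ℚ ℚ.< q → ∃ λ k → 1ℚ ℚ.≤ ι k ℚ.* q
archimedean {q@(mkℚ ℤ.+[1+ n ] d-1 _)} _ = suc d-1 , ℚ.toℚᵘ-cancel-≤
  (ℚᵘ.≤-respʳ-≃ (ℚᵘ.≃-sym (ℚᵘ.≃-trans (ℚ.toℚᵘ-homo-* (ι (suc d-1)) q)
      (ℚᵘ.*-congʳ {toℚᵘ q} (ℚ.toℚᵘ-fromℚᵘ (mkℚᵘ (ℤ.+ suc d-1) 0)))))
    (*≤* (ℤ.+≤+ bound)))
  where
  bound : 1 ℕ.* (1 ℕ.* suc d-1) ℕ.≤ suc d-1 ℕ.* suc n ℕ.* 1
  bound = ℕ.≤-trans (ℕ.≤-reflexive (trans (ℕ.*-identityˡ _) (ℕ.*-identityˡ _)))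
    (ℕ.≤-trans (ℕ.m≤m*n (suc d-1) (suc n)) (ℕ.≤-reflexive (sym (ℕ.*-identityʳ _))))
archimedean {mkℚ (ℤ.+ 0) d c} (*<* (ℤ.+<+ ()))
archimedean {mkℚ ℤ.-[1+ a ] d c} (*<* ())

-- Bernoulli's inequality in reverse: `(1 - δ)(1 + (c + 1)δ)` is `1 + cδ` minus a nonnegative
-- multiple of `δ²`. It yields a suitable exponent without logarithms.
geometric-decay : ∀ {δ} → 0ℚ ℚ.≤ δ → δ ℚ.≤ 1ℚ → ∀ c → (1ℚ ℚ.- δ) ^ℚ c ℚ.* (1ℚ ℚ.+ ι c ℚ.* δ) ℚ.≤ 1ℚ
geometric-decay {δ} 0≤δ δ≤1 zero    = ℚ.≤-reflexive (trans (ℚ.*-identityˡ _)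
  (trans (cong (λ x → 1ℚ ℚ.+ x) (ℚ.*-zeroˡ δ)) (ℚ.+-identityʳ 1ℚ)))
geometric-decay {δ} 0≤δ δ≤1 (suc c) = ℚ.≤-trans
  (ℚ.≤-reflexive (trans (cong (λ x → (1ℚ ℚ.- δ) ℚ.* (1ℚ ℚ.- δ) ^ℚ c ℚ.* (1ℚ ℚ.+ x ℚ.* δ)) (ι-+ 1 c))
    (regroup δ ((1ℚ ℚ.- δ) ^ℚ c) (ι c))))
  (ℚ.≤-trans (*-monoˡ (0≤^ c (p≤q⇒0≤q-p δ≤1)) (drop-square (0≤* (0≤* 0≤δ 0≤δ) 0≤1+c)))
    (geometric-decay 0≤δ δ≤1 c))
  where
  open +-*-Solver
  0≤1+c : 0ℚ ℚ.≤ 1ℚ ℚ.+ ι c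
  0≤1+c = subst (0ℚ ℚ.≤_) (ι-+ 1 c) (0≤ι (suc c))
  regroup : ∀ δ x c → (1ℚ ℚ.- δ) ℚ.* x ℚ.* (1ℚ ℚ.+ (1ℚ ℚ.+ c) ℚ.* δ) ≡ x ℚ.* ((1ℚ ℚ.+ c ℚ.* δ) ℚ.- δ ℚ.* δ ℚ.* (1ℚ ℚ.+ c))
  regroup = solve 3 (λ δ x c → (con 1ℚ :- δ) :* x :* (con 1ℚ :+ (con 1ℚ :+ c) :* δ) :=
    x :* ((con 1ℚ :+ c :* δ) :- δ :* δ :* (con 1ℚ :+ c))) refl
  drop-square : ∀ {x y} → 0ℚ ℚ.≤ y → x ℚ.- y ℚ.≤ x
  drop-square {x} {y} 0≤y = subst (x ℚ.- y ℚ.≤_) (ℚ.+-identityʳ x) (ℚ.+-monoʳ-≤ x (ℚ.neg-antimono-≤ 0≤y))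

exists-power : ∀ {δ} → 0ℚ ℚ.< δ → δ ℚ.≤ 1ℚ → ∀ M → ∃ λ c → ι M ℚ.* (1ℚ ℚ.- δ) ^ℚ c ℚ.≤ 1ℚ
exists-power {δ} 0<δ δ≤1 M with archimedean 0<δ
... | k , 1≤kδ = M ℕ.* k , ℚ.≤-trans (ℚ.≤-reflexive (ℚ.*-comm (ι M) _))
  (ℚ.≤-trans (*-monoˡ (0≤^ (M ℕ.* k) (p≤q⇒0≤q-p δ≤1)) M≤) (geometric-decay (ℚ.<⇒≤ 0<δ) δ≤1 (M ℕ.* k)))
  where
  M≤ : ι M ℚ.≤ 1ℚ ℚ.+ ι (M ℕ.* k) ℚ.* δ
  M≤ = ℚ.≤-trans (ℚ.≤-trans
    (subst₂ ℚ._≤_ (ℚ.*-identityʳ (ι M)) (trans (sym (ℚ.*-assoc (ι M) (ι k) δ)) (cong (ℚ._* δ) (sym (ι-* M k))))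
      (*-monoˡ (0≤ι M) 1≤kδ))
    (ℚ.≤-reflexive (sym (ℚ.+-identityˡ (ι (M ℕ.* k) ℚ.* δ))))) (ℚ.+-monoˡ-≤ (ι (M ℕ.* k) ℚ.* δ) (ℚ.<⇒≤ (ℚ.positive⁻¹ 1ℚ)))

record Constants (q : ℝ) (M : ℕ) : Set where
  field
    c       : ℕ
    p a b   : ℚ
    q≤p     : q ≤ℝ fromℚ p
    0≤p     : 0ℚ ℚ.≤ p
    p≤1     : p ℚ.≤ 1ℚ
    0≤b     : 0ℚ ℚ.≤ b
    1≤a     : 1ℚ ℚ.≤ a
    ab≡1    : a ℚ.* b ≡ 1ℚ
    b≤a     : b ℚ.≤ a
    0≤ρ     : 0ℚ ℚ.≤ p ℚ.* a ℚ.+ (1ℚ ℚ.- p) ℚ.* b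
    Mρᶜ≤1   : ι M ℚ.* (p ℚ.* a ℚ.+ (1ℚ ℚ.- p) ℚ.* b) ^ℚ c ℚ.≤ 1ℚ

-- For p = ½ - η take a = 1 + 2η and b = 1 / a, so that pa + (1 - p)b = 1 - 2η².
constants : ∀ {q} → q <ℝ ½ℝ → ∀ M → Constants q M
constants {q} (ε , 0<ε , N , q+ε≤½) M = record
  { c     = proj₁ power
  ; p     = p
  ; a     = a
  ; b     = b
  ; q≤p   = λ θ 0<θ → N , λ n n≥ → ℚ.≤-trans (q≤ n n≥) (p≤p+q (ℚ.<⇒≤ 0<θ))
  ; 0≤p   = p≤q⇒0≤q-p (ℚ.p⊓q≤q ε ½)
  ; p≤1   = ℚ.≤-trans (subst (p ℚ.≤_) (ℚ.+-identityʳ ½) (ℚ.+-monoʳ-≤ ½ (ℚ.neg-antimono-≤ 0≤η))) ½≤1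
  ; 0≤b   = 0≤b
  ; 1≤a   = 1≤a
  ; ab≡1  = ab≡1
  ; b≤a   = ℚ.≤-trans b≤1 1≤a
  ; 0≤ρ   = subst (0ℚ ℚ.≤_) (sym ρ≡) (p≤q⇒0≤q-p δ≤1)
  ; Mρᶜ≤1 = subst (λ x → ι M ℚ.* x ^ℚ proj₁ power ℚ.≤ 1ℚ) (sym ρ≡) (proj₂ power)
  }
  where
  open +-*-Solver
  η p a δ : ℚ
  -- The gap `ε` below one half may itself exceed one half; the minimum keeps `p` nonnegative.
  η = ε ℚ.⊓ ½
  p = ½ ℚ.- η
  a = 1ℚ ℚ.+ (η ℚ.+ η)
  δ = (η ℚ.+ η) ℚ.* η
  ½≤1 : ½ ℚ.≤ 1ℚ
  ½≤1 = ℚ.<⇒≤ {½} {1ℚ} (*<* (ℤ.+<+ (s≤s (s≤s z≤n))))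
  0<η : 0ℚ ℚ.< η
  0<η with ℚ.⊓-sel ε ½
  ... | inj₁ eq = subst (0ℚ ℚ.<_) (sym eq) 0<ε
  ... | inj₂ eq = subst (0ℚ ℚ.<_) (sym eq) (*<* (ℤ.+<+ (s≤s z≤n)))
  0≤η = ℚ.<⇒≤ 0<η
  0<η+η : 0ℚ ℚ.< η ℚ.+ η
  0<η+η = ℚ.+-mono-< {0ℚ} {η} {0ℚ} {η} 0<η 0<η
  η+η≤1 : η ℚ.+ η ℚ.≤ 1ℚ
  η+η≤1 = ℚ.+-mono-≤ {η} {½} {η} {½} (ℚ.p⊓q≤q ε ½) (ℚ.p⊓q≤q ε ½)
  1≤a : 1ℚ ℚ.≤ a
  1≤a = p≤p+q (ℚ.<⇒≤ 0<η+η)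
  0<a : 0ℚ ℚ.< a
  0<a = ℚ.<-≤-trans (ℚ.positive⁻¹ 1ℚ) 1≤a
  instance
    a-positive : ℚ.Positive a
    a-positive = ℚ.positive 0<a
    a-nonZero : ℚ.NonZero a
    a-nonZero = ℚ.pos⇒nonZero a
  b : ℚ
  b = ℚ.1/ a
  ab≡1 : a ℚ.* b ≡ 1ℚ
  ab≡1 = ℚ.*-inverseʳ a
  0≤b : 0ℚ ℚ.≤ b
  0≤b = ℚ.<⇒≤ (ℚ.positive⁻¹ b {{ℚ.1/pos⇒pos a}})
  b≤1 : b ℚ.≤ 1ℚ
  b≤1 = subst₂ ℚ._≤_ (ℚ.*-identityˡ b) ab≡1 (*-monoʳ 0≤b 1≤a)
  q≤ : ∀ n → N ℕ.≤ n → seq q n ℚ.≤ p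
  q≤ n n≥ = ℚ.≤-trans (subst (ℚ._≤ ½ ℚ.- ε) (cancel (seq q n) ε) (ℚ.+-monoˡ-≤ (ℚ.- ε) (q+ε≤½ n n≥)))
    (ℚ.+-monoʳ-≤ ½ (ℚ.neg-antimono-≤ (ℚ.p⊓q≤p ε ½)))
    where
    cancel : ∀ x y → (x ℚ.+ y) ℚ.- y ≡ x
    cancel = solve 2 (λ x y → (x :+ y) :- y := x) refl
  0<δ : 0ℚ ℚ.< δ
  0<δ = subst (ℚ._< δ) (ℚ.*-zeroʳ (η ℚ.+ η)) (ℚ.*-monoʳ-<-pos (η ℚ.+ η) {{ℚ.positive 0<η+η}} 0<η)
  δ≤1 : δ ℚ.≤ 1ℚ
  δ≤1 = ℚ.≤-trans (*-monoʳ 0≤η η+η≤1) (ℚ.≤-trans (ℚ.≤-reflexive (ℚ.*-identityˡ η)) (ℚ.≤-trans (ℚ.p⊓q≤q ε ½) ½≤1))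
  ρ≡ : p ℚ.* a ℚ.+ (1ℚ ℚ.- p) ℚ.* b ≡ 1ℚ ℚ.- δ
  ρ≡ = trans (cong (λ x → p ℚ.* a ℚ.+ x) (regroup η b)) (trans (cong (λ x → p ℚ.* a ℚ.+ ½ ℚ.* x) ab≡1) (finish η))
    where
    regroup : ∀ η b → (1ℚ ℚ.- (½ ℚ.- η)) ℚ.* b ≡ ½ ℚ.* ((1ℚ ℚ.+ (η ℚ.+ η)) ℚ.* b)
    regroup = solve 2 (λ η b → (con 1ℚ :- (con ½ :- η)) :* b := con ½ :* ((con 1ℚ :+ (η :+ η)) :* b)) refl
    finish : ∀ η → (½ ℚ.- η) ℚ.* (1ℚ ℚ.+ (η ℚ.+ η)) ℚ.+ ½ ℚ.* 1ℚ ≡ 1ℚ ℚ.- (η ℚ.+ η) ℚ.* η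
    finish = solve 1 (λ η → (con ½ :- η) :* (con 1ℚ :+ (η :+ η)) :+ con (½ ℚ.* 1ℚ) := con 1ℚ :- (η :+ η) :* η) refl
  power = exists-power 0<δ δ≤1 M

-- The program

module Execution (o : ℕ → Bool) where

  -- The index is a time budget: `halt` accepts any remainder, so bounds may be generous.
  data Terminates (Q : Memory → Set) : Config → ℕ → Set where
    halt : ∀ {σ n} → Q σ → Terminates Q (config [] σ) n
    tick : ∀ {c cs σ n} → Terminates Q (step o (config (c ∷ cs) σ)) n → Terminates Q (config (c ∷ cs) σ) (suc n)

  Ends : Config → ℕ → (Memory → Set) → Set
  Ends κ n Q = Terminates Q κ n

  run-halted : ∀ n σ → run o n (config [] σ) ≡ config [] σ
  run-halted zero    σ = refl
  run-halted (suc n) σ = run-halted n σ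

  Ends⇒run : ∀ {κ n Q} → Ends κ n Q → ∃ λ σ → run o n κ ≡ config [] σ × Q σ
  Ends⇒run {n = n} (halt {σ} q) = σ , run-halted n σ , q
  Ends⇒run (tick e) = Ends⇒run e

  Ends-mono : ∀ {κ n n′ Q Q′} → n ≤ n′ → (∀ σ → Q σ → Q′ σ) → Ends κ n Q → Ends κ n′ Q′
  Ends-mono _          Q⊆ (halt q) = halt (Q⊆ _ q)
  Ends-mono (s≤s n≤n′) Q⊆ (tick e) = tick (Ends-mono n≤n′ Q⊆ e)

  step-++ : ∀ c cs cs′ σ → let κ = step o (config (c ∷ cs) σ) in
    step o (config (c ∷ cs ++ cs′) σ) ≡ config (pending κ ++ cs′) (memory κ)
  step-++ (a ≔ e)            cs cs′ σ = refl
  step-++ (compare a j)      cs cs′ σ = refl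
  step-++ (branch g cs₁ cs₂) cs cs′ σ = cong (λ cs → config cs σ) (sym (++-assoc (if holds g σ then cs₁ else cs₂) cs cs′))
  step-++ (while g body)     cs cs′ σ with holds g σ
  ... | true  = cong (λ cs → config cs σ) (sym (++-assoc body (while g body ∷ cs) cs′))
  ... | false = refl

  -- The rule for sequential composition: the postcondition of the first part is that the second
  -- part ends.
  Ends-++ : ∀ {cs cs′ σ n n′ Q} → Ends (config cs σ) n (λ σ → Ends (config cs′ σ) n′ Q) →
    Ends (config (cs ++ cs′) σ) (n + n′) Q
  Ends-++ {n = n} {n′} (halt e) = Ends-mono (ℕ.m≤n+m n′ n) (λ _ q → q) e
  Ends-++ {c ∷ cs} {cs′} {σ} {suc n} {n′} {Q} (tick e) =
    tick (subst (λ κ → Ends κ (n + n′) Q) (sym (step-++ c cs cs′ σ)) (Ends-++ e))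

  Ends-≔ : ∀ {a e cs σ n Q α β} → ⟦ a ⟧ σ ≡ α → ⟦ e ⟧ σ ≡ β →
    Ends (config cs (update σ α β)) n Q → Ends (config (a ≔ e ∷ cs) σ) (suc n) Q
  Ends-≔ refl refl e = tick e

  Ends-compare : ∀ {a j cs σ n Q α i} → ⟦ a ⟧ σ ≡ α → ⟦ j ⟧ σ ≡ i →
    Ends (config cs (update σ α (bit (o i)))) n Q → Ends (config (compare a j ∷ cs) σ) (suc n) Q
  Ends-compare refl refl e = tick e

  Ends-branch : ∀ {g cs₁ cs₂ cs σ n Q} → (∀ b → holds g σ ≡ b → Ends (config ((if b then cs₁ else cs₂) ++ cs) σ) n Q) →
    Ends (config (branch g cs₁ cs₂ ∷ cs) σ) (suc n) Q
  Ends-branch e = tick (e _ refl)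

  Ends-while : ∀ {g body cs σ n Q} b → holds g σ ≡ b →
    Ends (config (if b then body ++ while g body ∷ cs else cs) σ) n Q → Ends (config (while g body ∷ cs) σ) (suc n) Q
  Ends-while _ refl e = tick e

update-same : ∀ σ a v → update σ a v a ≡ v
update-same σ a v rewrite ≡ᵇ-refl a = refl

update-other : ∀ σ {a} v {b} → a ≢ b → update σ a v b ≡ σ b
update-other σ {a} v {b} a≢b with a ≡ᵇ b in eq
... | true  = contradiction (≡ᵇ-true⁻¹ a b eq) a≢b
... | false = refl

reg : ℕ → Expr
reg n = mem (lit n)

times : ℕ → Expr → Expr
times zero    e = lit 0
times (suc n) e = e ⊕ times n e

⟦times⟧ : ∀ n e σ → ⟦ times n e ⟧ σ ≡ n * ⟦ e ⟧ σ
⟦times⟧ zero    e σ = refl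
⟦times⟧ (suc n) e σ = cong (⟦ e ⟧ σ +_) (⟦times⟧ n e σ)

queries : ℕ → Program
queries zero    = []
queries (suc n) =
  compare (lit 15) (reg 14 ⊕ reg 16) ∷
  lit 13 ≔ (reg 13 ⊕ reg 15) ∷
  lit 16 ≔ (reg 16 ⊕ lit 1) ∷
  queries n

-- Registers: 0 output, 1 d, 2 loop variable, 3 w, 4 remaining steps, 5 threshold
-- of the histogram, 6 width of the root, 7 address of the top of the stack,
-- 8 and 9 position and width of the current node, 10 width of its children,
-- 11 to 13 votes, 14 position of a test, 15 answer, 16 number of queries so far.
-- The node at depth n of the stack is in cells 20 + 3n and 21 + 3n, and the
-- number of visits to nodes at position y in cell 22 + 3y.
module Code (c : ℕ) where

  pollCode : Expr → Program
  pollCode y = lit 14 ≔ y ∷ lit 13 ≔ lit 0 ∷ queries c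

  visits : Expr
  visits = lit 22 ⊕ times 3 (reg 8)

  prologue push pop decide body countBits rootWidth noisySearch : Program
  prologue =
    lit 4 ≔ (reg 4 ⊖ lit 1) ∷
    lit 8 ≔ mem (reg 7) ∷
    lit 9 ≔ mem (reg 7 ⊕ lit 1) ∷
    branch (reg 3 ⊏ reg 9) (lit 10 ≔ half (reg 9) ∷ []) (lit 10 ≔ lit 0 ∷ []) ∷
    visits ≔ (mem visits ⊕ lit 1) ∷
    branch (reg 5 ⊏ mem visits) (lit 0 ≔ reg 8 ∷ []) [] ∷ []
  push =
    branch (lit c ⊏ (reg 13 ⊕ reg 13))
      ((reg 7 ⊕ lit 3) ≔ ((reg 8 ⊕ reg 10) ⊕ times 3 (reg 3)) ∷ [])
      ((reg 7 ⊕ lit 3) ≔ (reg 8 ⊖ times 3 (reg 3)) ∷ []) ∷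
    (reg 7 ⊕ lit 4) ≔ reg 10 ∷
    lit 7 ≔ (reg 7 ⊕ lit 3) ∷ []
  pop = branch (lit 20 ⊏ reg 7) (lit 7 ≔ (reg 7 ⊖ lit 3) ∷ []) [] ∷ []
  decide =
    -- Near the left border the first vote is overruled by `suc c`, a number that always counts as a
    -- majority.
    branch (times 5 (reg 3) ⊏ reg 8) [] (lit 11 ≔ lit (suc c) ∷ []) ∷
    branch (lit c ⊏ (reg 11 ⊕ reg 11)) (branch (lit c ⊏ (reg 12 ⊕ reg 12)) pop push ∷ []) pop ∷ []
  body =
    prologue ++
    pollCode (reg 8 ⊖ times 5 (reg 3)) ++ lit 11 ≔ reg 13 ∷
    pollCode ((reg 8 ⊕ reg 9) ⊕ times 5 (reg 3)) ++ lit 12 ≔ reg 13 ∷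
    pollCode (reg 8 ⊕ reg 10) ++
    decide
  -- There is no multiplication, so the multiples of `ℓ` are accumulated, one summand for each bit
  -- of `m`.
  countBits =
    lit 2 ≔ half (reg 2) ∷
    lit 3 ≔ (reg 3 ⊕ lit (64 * (c + c + c))) ∷
    lit 4 ≔ (reg 4 ⊕ lit 64) ∷
    lit 5 ≔ (reg 5 ⊕ lit 4) ∷ []
  rootWidth =
    lit 2 ≔ half (reg 2) ∷
    lit 6 ≔ (reg 6 ⊕ reg 6) ∷ []
  noisySearch =
    lit 2 ≔ reg 0 ∷
    lit 3 ≔ (lit 1 ⊕ (reg 1 ⊕ reg 1)) ∷
    while (lit 0 ⊏ reg 2) countBits ∷
    lit 2 ≔ reg 0 ∷
    lit 6 ≔ reg 3 ∷
    while (lit 0 ⊏ reg 2) rootWidth ∷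
    lit 21 ≔ reg 6 ∷
    lit 7 ≔ lit 20 ∷
    while (lit 0 ⊏ reg 4) body ∷ []

  bodyTime : ℕ
  bodyTime = 8 + ((2 + c * 3) + suc ((2 + c * 3) + suc ((2 + c * 3) + 8)))

-- The program carries out the walk

module Simulation (c w ℓ thr : ℕ) .{{_ : NonZero w}} (truth o : ℕ → Bool) where

  open Code c
  open Execution o
  open Search c w ℓ thr truth

  Holds : List Bool → Memory → Set
  Holds p σ = σ (20 + length p * 3) ≡ w * block (node ℓ p) × σ (21 + length p * 3) ≡ w * width (level (node ℓ p))

  Stack : List Bool → Memory → Set
  Stack []      σ = Holds [] σ
  Stack (b ∷ p) σ = Holds (b ∷ p) σ × Stack p σ

  stack-top : ∀ p {σ} → Stack p σ → Holds p σ
  stack-top []      h       = h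
  stack-top (b ∷ p) (h , _) = h

  stack-frame : ∀ p {σ σ′} → (∀ n → n ≤ length p → σ′ (20 + n * 3) ≡ σ (20 + n * 3) × σ′ (21 + n * 3) ≡ σ (21 + n * 3)) →
    Stack p σ → Stack p σ′
  stack-frame []      same (lo , wd) = trans (proj₁ (same 0 z≤n)) lo , trans (proj₂ (same 0 z≤n)) wd
  stack-frame (b ∷ p) same ((lo , wd) , st) =
    (trans (proj₁ (same (suc (length p)) ℕ.≤-refl)) lo , trans (proj₂ (same (suc (length p)) ℕ.≤-refl)) wd) ,
    stack-frame p (λ n n≤ → same n (ℕ.m≤n⇒m≤1+n n≤)) st

  record Ready (s : State) (u t : ℕ) (σ : Memory) : Set where
    field
      out≡  : σ 0 ≡ out s
      w≡    : σ 3 ≡ w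
      t≡    : σ 4 ≡ t
      thr≡  : σ 5 ≡ thr
      sp≡   : σ 7 ≡ 20 + length (path s) * 3
      u≡    : σ 16 ≡ u
      stack : Stack (path s) σ
      table : ∀ k → σ (22 + w * k * 3) ≡ count k (hist s)

  record Loaded (s : State) (u t : ℕ) (σ : Memory) : Set where
    k = block (here s)
    v = level (here s)
    field
      out≡  : σ 0 ≡ record-out k (k ∷ hist s) (out s)
      w≡    : σ 3 ≡ w
      t≡    : σ 4 ≡ t
      thr≡  : σ 5 ≡ thr
      sp≡   : σ 7 ≡ 20 + length (path s) * 3
      lo≡   : σ 8 ≡ w * k
      wd≡   : σ 9 ≡ w * width v
      wd′≡  : σ 10 ≡ w * width (pred v)
      u≡    : σ 16 ≡ u
      stack : Stack (path s) σ
      table : ∀ k′ → σ (22 + w * k′ * 3) ≡ count k′ (k ∷ hist s)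

  Untouched : ℕ → Set
  Untouched a = T ((a <ᵇ 13) ∨ (16 <ᵇ a))

  queries-run : ∀ n {σ y u v} → σ 14 ≡ y → σ 16 ≡ u → σ 13 ≡ v →
    Ends (config (queries n) σ) (n * 3) λ σ′ →
      σ′ 13 ≡ ups o n (y + u) v × σ′ 16 ≡ u + n × (∀ a → Untouched a → σ′ a ≡ σ a)
  queries-run zero    {u = u} y≡ u≡ v≡ = halt (v≡ , trans u≡ (sym (ℕ.+-identityʳ u)) , λ _ _ → refl)
  queries-run (suc n) {σ} {y} {u} {v} y≡ u≡ v≡ =
    Ends-compare {α = 15} {i = y + u} refl (cong₂ _+_ y≡ u≡)
    (Ends-≔ {α = 13} {β = v + bit (o (y + u))} refl (cong (_+ bit (o (y + u))) v≡)
    (Ends-≔ {α = 16} {β = suc u} refl (trans (cong (_+ 1) u≡) (ℕ.+-comm u 1))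
    (Ends-mono ℕ.≤-refl post (queries-run n {σ₃} {y} {suc u} {v + bit (o (y + u))} y≡ refl refl))))
    where
    σ₃ = update (update (update σ 15 (bit (o (y + u)))) 13 (v + bit (o (y + u)))) 16 (suc u)
    post : ∀ σ′ → (σ′ 13 ≡ ups o n (y + suc u) (v + bit (o (y + u))) × σ′ 16 ≡ suc u + n × (∀ a → Untouched a → σ′ a ≡ σ₃ a)) →
      σ′ 13 ≡ ups o n (suc (y + u)) (v + bit (o (y + u))) × σ′ 16 ≡ u + suc n × (∀ a → Untouched a → σ′ a ≡ σ a)
    post σ′ (p , q , same) = trans p (cong (λ j → ups o n j (v + bit (o (y + u)))) (ℕ.+-suc y u)) ,
      trans q (sym (ℕ.+-suc u n)) , λ a un → trans (same a un) (elsewhere a un)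
      where
      elsewhere : ∀ a → Untouched a → σ₃ a ≡ σ a
      elsewhere a un = trans (update-other (update (update σ 15 (bit (o (y + u)))) 13 (v + bit (o (y + u)))) {16} (suc u) {a} λ { refl → un })
        (trans (update-other (update σ 15 (bit (o (y + u)))) {13} (v + bit (o (y + u))) {a} λ { refl → un })
          (update-other σ {15} (bit (o (y + u))) {a} λ { refl → un }))

  poll-run : ∀ {e σ y u} → ⟦ e ⟧ σ ≡ y → σ 16 ≡ u →
    Ends (config (pollCode e) σ) (2 + c * 3) λ σ′ →
      σ′ 13 ≡ ups o c (y + u) 0 × σ′ 16 ≡ u + c × (∀ a → Untouched a → σ′ a ≡ σ a)
  poll-run {e} {σ} {y} {u} e≡ u≡ = Ends-≔ {α = 14} {β = y} refl e≡ (Ends-≔ {α = 13} {β = 0} refl refl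
    (Ends-mono ℕ.≤-refl post (queries-run c {update (update σ 14 y) 13 0} {y} {u} {0} refl u≡ refl)))
    where
    post : ∀ σ′ → (σ′ 13 ≡ ups o c (y + u) 0 × σ′ 16 ≡ u + c × (∀ a → Untouched a → σ′ a ≡ update (update σ 14 y) 13 0 a)) →
      σ′ 13 ≡ ups o c (y + u) 0 × σ′ 16 ≡ u + c × (∀ a → Untouched a → σ′ a ≡ σ a)
    post σ′ (p , q , same) = p , q , λ a un → trans (same a un)
      (trans (update-other (update σ 14 y) {13} 0 {a} λ { refl → un }) (update-other σ {14} y {a} λ { refl → un }))

  loaded-frame : ∀ {s u u′ t σ σ′} → Loaded s u t σ → σ′ 16 ≡ u′ → (∀ a → T ((a <ᵇ 11) ∨ (16 <ᵇ a)) → σ′ a ≡ σ a) → Loaded s u′ t σ′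
  loaded-frame {s} ld u′≡ same = record
    { out≡ = trans (same 0 tt) (Loaded.out≡ ld) ; w≡ = trans (same 3 tt) (Loaded.w≡ ld)
    ; t≡ = trans (same 4 tt) (Loaded.t≡ ld) ; thr≡ = trans (same 5 tt) (Loaded.thr≡ ld)
    ; sp≡ = trans (same 7 tt) (Loaded.sp≡ ld) ; lo≡ = trans (same 8 tt) (Loaded.lo≡ ld)
    ; wd≡ = trans (same 9 tt) (Loaded.wd≡ ld) ; wd′≡ = trans (same 10 tt) (Loaded.wd′≡ ld)
    ; u≡ = u′≡
    ; stack = stack-frame (path s) (λ n _ → same (20 + n * 3) tt , same (21 + n * 3) tt) (Loaded.stack ld)
    ; table = λ k → trans (same (22 + w * k * 3) tt) (Loaded.table ld k)
    }

  -- Positions on the stack, widths on the stack and visit counts live at addresses of different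
  -- residues modulo 3, so the stack and the histogram can grow without bound and never collide.
  residue-≢ : ∀ i j m n → i % 3 ≢ j % 3 → i + m * 3 ≢ j + n * 3
  residue-≢ i j m n i≢j eq = i≢j (trans (sym ([m+kn]%n≡m%n i m 3)) (trans (cong (_% 3) eq) ([m+kn]%n≡m%n j n 3)))

  slot-≢ : ∀ i {m n} → m ≢ n → i + m * 3 ≢ i + n * 3
  slot-≢ i {m} {n} m≢n eq = m≢n (ℕ.*-cancelʳ-≡ m n 3 (ℕ.+-cancelˡ-≡ i (m * 3) (n * 3) eq))

  5w<wk : ∀ k → (5 * w <ᵇ w * k) ≡ not (k ≤ᵇ 5)
  5w<wk k with k ≤ᵇ 5 in eq
  ... | true  = <ᵇ-false (ℕ.≤-trans (ℕ.*-monoʳ-≤ w (≤ᵇ-true⁻¹ k 5 eq)) (ℕ.≤-reflexive (ℕ.*-comm w 5)))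
  ... | false = <ᵇ-true (ℕ.≤-trans (s≤s (ℕ.≤-reflexive (ℕ.*-comm 5 w))) (ℕ.*-monoʳ-< w (≤ᵇ-false⁻¹ k 5 eq)))

  -- The width is halved as long as the result is a multiple of w.
  half-width : ∀ v → (if w <ᵇ w * width v then ⌊ w * width v /2⌋ else 0) ≡ w * width (pred v)
  half-width zero          rewrite ℕ.*-zeroʳ w = refl
  half-width (suc zero)    rewrite ℕ.*-identityʳ w | <ᵇ-false {w} {w} ℕ.≤-refl | ℕ.*-zeroʳ w = refl
  half-width (suc (suc v)) = trans (cong (λ b → if b then ⌊ w * 2 ^ suc v /2⌋ else 0) (<ᵇ-true w<))
    (trans (cong ⌊_/2⌋ (eq (2 ^ v))) (sym (ℕ.n≡⌊n+n/2⌋ (w * 2 ^ v))))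
    where
    eq : ∀ x → w * (x + (x + 0)) ≡ w * x + w * x
    eq x = ring (w ∷ x ∷ [])
    w< : w < w * 2 ^ suc v
    w< = subst (_< w * 2 ^ suc v) (ℕ.*-identityʳ w) (ℕ.*-monoʳ-< w (ℕ.≤-trans (ℕ.m≤m+n 2 0) (ℕ.^-monoʳ-≤ 2 {1} {suc v} (s≤s z≤n))))

  count-∷ : ∀ k k′ H σ → (∀ k → σ (22 + w * k * 3) ≡ count k H) →
    update σ (22 + w * k * 3) (suc (count k H)) (22 + w * k′ * 3) ≡ count k′ (k ∷ H)
  count-∷ k k′ H σ table with k′ ≡ᵇ k in eq
  ... | true  rewrite ≡ᵇ-true⁻¹ k′ k eq = update-same σ (22 + w * k * 3) (suc (count k H))
  ... | false = trans (update-other σ (suc (count k H)) (slot-≢ 22 λ wk≡wk′ → k≢k′ (ℕ.*-cancelˡ-≡ k k′ w wk≡wk′))) (table k′)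
    where
    k≢k′ : k ≢ k′
    k≢k′ refl = contradiction (trans (sym (≡ᵇ-refl k)) eq) λ ()

  prologue-run : ∀ {s u t σ} → Ready s u (suc t) σ → Ends (config prologue σ) 8 (Loaded s u t)
  prologue-run {s} {u} {t} {σ} rd =
    Ends-≔ {α = 4} {β = t} refl (cong (_∸ 1) (Ready.t≡ rd))
    (Ends-≔ {α = 8} {β = w * k} refl (trans (cong σ₁ (Ready.sp≡ rd)) (proj₁ top))
    (Ends-≔ {α = 9} {β = w * width v} refl
      (trans (cong σ₂ (trans (cong (_+ 1) (Ready.sp≡ rd)) (ℕ.+-comm (20 + length p * 3) 1))) (proj₂ top))
    (Ends-branch halve)))
    where
    p = path s
    k = block (here s)
    v = level (here s)
    H = k ∷ hist s
    top = stack-top p (Ready.stack rd)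
    σ₁ = update σ 4 t
    σ₂ = update σ₁ 8 (w * k)
    σ₃ = update σ₂ 9 (w * width v)
    σ₄ = update σ₃ 10 (w * width (pred v))
    σ₅ = update σ₄ (22 + w * k * 3) (suc (count k (hist s)))
    rest = visits ≔ (mem visits ⊕ lit 1) ∷ branch (reg 5 ⊏ mem visits) (lit 0 ≔ reg 8 ∷ []) [] ∷ []

    visits-cell : ∀ {σ′} → σ′ 8 ≡ w * k → ⟦ visits ⟧ σ′ ≡ 22 + w * k * 3
    visits-cell {σ′} lo≡ = cong (22 +_) (trans (⟦times⟧ 3 (reg 8) σ′) (trans (cong (3 *_) lo≡) (ℕ.*-comm 3 (w * k))))

    stack₅ : Stack p σ₅
    stack₅ = stack-frame p (λ n _ → update-other σ₄ _ (residue-≢ 22 20 (w * k) n λ ()) ,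
                                    update-other σ₄ _ (residue-≢ 22 21 (w * k) n λ ())) (Ready.stack rd)

    loaded : ∀ b → (thr <ᵇ count k H) ≡ b → ∀ {x} → x ≡ (if b then w * k else out s) → ∀ {σ′} → σ′ 0 ≡ x →
      (∀ a → σ′ (suc a) ≡ σ₅ (suc a)) → Loaded s u t σ′
    loaded b eq x≡ 0≡ same = record
      { out≡ = trans 0≡ (trans x≡ (cong (λ b → if b then w * k else out s) (sym eq)))
      ; w≡ = trans (same 2) (Ready.w≡ rd) ; t≡ = same 3 ; thr≡ = trans (same 4) (Ready.thr≡ rd)
      ; sp≡ = trans (same 6) (Ready.sp≡ rd) ; lo≡ = same 7 ; wd≡ = same 8 ; wd′≡ = same 9
      ; u≡ = trans (same 15) (Ready.u≡ rd)
      ; stack = stack-frame p (λ n _ → same (19 + n * 3) , same (20 + n * 3)) stack₅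
      ; table = λ k′ → trans (same (21 + w * k′ * 3)) (count-∷ k k′ (hist s) σ₄ (Ready.table rd))
      }

    visit≡ : count k H ≡ suc (count k (hist s))
    visit≡ = cong (λ b → bit b + count k (hist s)) (≡ᵇ-refl k)

    guard≡ : holds (reg 5 ⊏ mem visits) σ₅ ≡ (thr <ᵇ count k H)
    guard≡ = cong₂ _<ᵇ_ (Ready.thr≡ rd) (trans (cong σ₅ (visits-cell {σ₅} refl)) (trans
      (update-same σ₄ (22 + w * k * 3) (suc (count k (hist s)))) (sym visit≡)))

    finish : Ends (config rest σ₄) 3 (Loaded s u t)
    finish = Ends-≔ {α = 22 + w * k * 3} {β = suc (count k (hist s))} (visits-cell {σ₄} refl)
      (trans (cong (_+ 1) (trans (cong σ₄ (visits-cell {σ₄} refl)) (Ready.table rd k))) (ℕ.+-comm (count k (hist s)) 1))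
      (Ends-branch λ
        { true  eq → Ends-≔ {α = 0} {β = w * k} refl refl (halt (loaded true (trans (sym guard≡) eq) refl refl λ _ → refl))
        ; false eq → halt (loaded false (trans (sym guard≡) eq) (Ready.out≡ rd) refl λ _ → refl) })

    guard′≡ : holds (reg 3 ⊏ reg 9) σ₃ ≡ (w <ᵇ w * width v)
    guard′≡ = cong (_<ᵇ w * width v) (Ready.w≡ rd)

    halve : ∀ b → holds (reg 3 ⊏ reg 9) σ₃ ≡ b →
      Ends (config ((if b then lit 10 ≔ half (reg 9) ∷ [] else lit 10 ≔ lit 0 ∷ []) ++ rest) σ₃) 4 (Loaded s u t)
    halve true  eq = Ends-≔ {α = 10} refl (trans (cong (λ b → if b then ⌊ w * width v /2⌋ else 0)
      (trans (sym eq) guard′≡)) (half-width v)) finish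
    halve false eq = Ends-≔ {α = 10} refl (trans (cong (λ b → if b then ⌊ w * width v /2⌋ else 0)
      (trans (sym eq) guard′≡)) (half-width v)) finish

  Untouched-⊇ : ∀ a → T ((a <ᵇ 11) ∨ (16 <ᵇ a)) → Untouched a
  Untouched-⊇ a h with a <ᵇ 11 in eq
  ... | true  rewrite <ᵇ-true {a} {13} (ℕ.≤-trans (<ᵇ-true⁻¹ a 11 eq) (ℕ.m≤m+n 11 2)) = tt
  ... | false = ∨-introʳ (a <ᵇ 13) h
    where
    ∨-introʳ : ∀ b {b′} → T b′ → T (b ∨ b′)
    ∨-introʳ true  _ = tt
    ∨-introʳ false h = h

  visited : State → List Bool → State
  visited s p = state p (block (here s) ∷ hist s) (record-out (block (here s)) (block (here s) ∷ hist s) (out s))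

  pop-run : ∀ {s u t σ} → Loaded s u t σ → Ends (config pop σ) 2 (Ready (visited s (drop 1 (path s))) u t)
  pop-run {s} {u} {t} {σ} ld = Ends-branch (by-path (path s) refl)
    where
    open Loaded ld
    by-path : ∀ p → path s ≡ p → ∀ b → (20 <ᵇ σ 7) ≡ b →
      Ends (config ((if b then lit 7 ≔ (reg 7 ⊖ lit 3) ∷ [] else []) ++ []) σ) 1 (Ready (visited s (drop 1 p)) u t)
    by-path []      refl false _  = halt record
      { out≡ = out≡ ; w≡ = w≡ ; t≡ = t≡ ; thr≡ = thr≡ ; sp≡ = sp≡ ; u≡ = u≡ ; stack = stack ; table = table }
    by-path []      refl true  eq = contradiction (trans (sym (cong (20 <ᵇ_) sp≡)) eq) λ ()
    by-path (b ∷ p) refl true  _  = Ends-≔ {α = 7} {β = 20 + length p * 3} refl (cong (_∸ 3) sp≡) (halt record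
      { out≡ = out≡ ; w≡ = w≡ ; t≡ = t≡ ; thr≡ = thr≡ ; sp≡ = refl ; u≡ = u≡
      ; stack = stack-frame p (λ _ _ → refl , refl) (proj₂ stack) ; table = table })
    by-path (b ∷ p) refl false eq = contradiction (trans (sym (cong (20 <ᵇ_) sp≡)) eq) λ ()

  push-run : ∀ {s u t σ g} → Loaded s u t σ → σ 13 ≡ g → Ends (config push σ) 4 (Ready (visited s (majority c g ∷ path s)) u t)
  push-run {s} {u} {t} {σ} {g} ld g≡ = Ends-branch λ
    { true  eq → Ends-≔ {α = A} address (trans (cong₂ _+_ (cong₂ _+_ lo≡ wd′≡) 3w) right)
        (finish true (trans (sym guard≡) eq))
    ; false eq → Ends-≔ {α = A} address (trans (cong₂ _∸_ lo≡ 3w) left)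
        (finish false (trans (sym guard≡) eq)) }
    where
    open Loaded ld
    p = path s
    A = 20 + suc (length p) * 3
    3w : ⟦ times 3 (reg 3) ⟧ σ ≡ 3 * w
    3w = trans (⟦times⟧ 3 (reg 3) σ) (cong (3 *_) w≡)
    right : w * k + w * width (pred v) + 3 * w ≡ w * (k + width (pred v) + 3)
    right = go (width (pred v))
      where
      go : ∀ h → w * k + w * h + 3 * w ≡ w * (k + h + 3)
      go h = distrib w k h
        where
        distrib : ∀ w k h → w * k + w * h + 3 * w ≡ w * (k + h + 3)
        distrib = solve-∀
    left : w * k ∸ 3 * w ≡ w * (k ∸ 3)
    left = trans (cong (w * k ∸_) (ℕ.*-comm 3 w)) (sym (ℕ.*-distribˡ-∸ w k 3))
    guard≡ : holds (lit c ⊏ (reg 13 ⊕ reg 13)) σ ≡ majority c g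
    guard≡ = cong (λ g → c <ᵇ g + g) g≡
    address : σ 7 + 3 ≡ A
    address = trans (cong (_+ 3) sp≡) (ℕ.+-comm (20 + length p * 3) 3)
    finish : ∀ b → majority c g ≡ b →
      Ends (config ((reg 7 ⊕ lit 4) ≔ reg 10 ∷ lit 7 ≔ (reg 7 ⊕ lit 3) ∷ []) (update σ A (w * block (child b (here s))))) 2
        (Ready (visited s (majority c g ∷ p)) u t)
    finish b refl = Ends-≔ {α = suc A} (trans (cong (_+ 4) sp≡) (ℕ.+-comm (20 + length p * 3) 4)) wd′≡
      (Ends-≔ {α = 7} refl address (halt record
        { out≡ = out≡ ; w≡ = w≡ ; t≡ = t≡ ; thr≡ = thr≡ ; sp≡ = refl ; u≡ = u≡
        ; stack = (trans (update-other σ₁ {suc A} h′ {A} ℕ.1+n≢n) (update-same σ A lo′) ,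
                   trans (update-same σ₁ (suc A) h′) (cong (λ v → w * width v) (sym (level-child b (here s))))) ,
                  stack-frame p (λ n n≤ →
                    trans (update-other σ₁ h′ (residue-≢ 21 20 (suc (length p)) n λ ()))
                      (update-other σ lo′ (slot-≢ 20 (distinct n≤))) ,
                    trans (update-other σ₁ h′ (slot-≢ 21 (distinct n≤)))
                      (update-other σ lo′ (residue-≢ 20 21 (suc (length p)) n λ ()))) stack
        ; table = λ k′ → trans (update-other σ₁ h′ (residue-≢ 21 22 (suc (length p)) (w * k′) λ ()))
            (trans (update-other σ lo′ (residue-≢ 20 22 (suc (length p)) (w * k′) λ ())) (table k′))
        }))
      where
      lo′ = w * block (child b (here s))
      h′  = w * width (pred v)
      σ₁ = update σ A lo′
      distinct : ∀ {n} → n ≤ length p → suc (length p) ≢ n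
      distinct n≤ refl = ℕ.<-irrefl refl n≤

  decide-run : ∀ {s u t σ a b g} → Loaded s u t σ → σ 11 ≡ a → σ 12 ≡ b → σ 13 ≡ g →
    Ends (config decide σ) 8 (Ready (advance s a b g) u t)
  decide-run {s} {u} {t} {σ} {a} {b} {g} ld a≡ b≡ g≡ = Ends-branch λ
    { true  eq → Ends-mono (ℕ.n≤1+n 6) (λ _ q → q)
        (tests σ ld (trans (cong (λ a → c <ᵇ a + a) a≡) (sym (cong (_∨ majority c a) (not-true (trans (sym guard≡) eq))))) b≡ g≡)
    ; false eq → Ends-≔ {α = 11} refl refl (tests (update σ 11 (suc c))
        (loaded-frame ld (Loaded.u≡ ld) λ a un → update-other σ {11} (suc c) {a} λ { refl → un })
        (trans (<ᵇ-true (s≤s (ℕ.m≤m+n c (suc c)))) (sym (cong (_∨ majority c a) (not-false (trans (sym guard≡) eq))))) b≡ g≡) }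
    where
    x = here s
    not-true : ∀ {b} → not b ≡ true → b ≡ false
    not-true {false} _ = refl
    not-false : ∀ {b} → not b ≡ false → b ≡ true
    not-false {true} _ = refl
    guard≡ : holds (times 5 (reg 3) ⊏ reg 8) σ ≡ not (block x ≤ᵇ 5)
    guard≡ = trans (cong₂ _<ᵇ_ (trans (⟦times⟧ 5 (reg 3) σ) (cong (5 *_) (Loaded.w≡ ld))) (Loaded.lo≡ ld)) (5w<wk (block x))
    tests : ∀ σ′ → Loaded s u t σ′ → (c <ᵇ σ′ 11 + σ′ 11) ≡ (block x ≤ᵇ 5) ∨ majority c a → σ′ 12 ≡ b → σ′ 13 ≡ g →
      Ends (config (branch (lit c ⊏ (reg 11 ⊕ reg 11)) (branch (lit c ⊏ (reg 12 ⊕ reg 12)) pop push ∷ []) pop ∷ []) σ′) 6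
        (Ready (advance s a b g) u t)
    tests σ′ ld′ lower b≡′ g≡′ = Ends-branch λ
      { true eq → Ends-branch λ
          { true  eq′ → Ends-mono (ℕ.m≤m+n 2 2) (λ _ q → q) (subst (λ pass → Ends (config pop σ′) 2 (Ready (visited s (move pass (majority c g) (path s))) u t))
              (sym (trans (cong (λ b → ((block x ≤ᵇ 5) ∨ majority c a) ∧ not b) (trans (sym (cong (λ b → c <ᵇ b + b) b≡′)) eq′))
                (∧-false _))) (pop-run ld′))
          ; false eq′ → subst (λ pass → Ends (config push σ′) 4 (Ready (visited s (move pass (majority c g) (path s))) u t))
              (sym (cong₂ (λ l b → l ∧ not b) (trans (sym lower) eq) (trans (sym (cong (λ b → c <ᵇ b + b) b≡′)) eq′)))
              (push-run ld′ g≡′) }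
      ; false eq → Ends-mono (ℕ.m≤m+n 2 3) (λ _ q → q) (subst (λ pass → Ends (config pop σ′) 2 (Ready (visited s (move pass (majority c g) (path s))) u t))
          (sym (cong (_∧ not (majority c b)) (trans (sym lower) eq))) (pop-run ld′)) }
      where
      ∧-false : ∀ b → b ∧ false ≡ false
      ∧-false true  = refl
      ∧-false false = refl

  body-run : ∀ {s u t σ} → Ready s u (suc t) σ → Ends (config body σ) bodyTime (Ready (next o u s) (u + c + c + c) t)
  body-run {s} {u} {t} rd = Ends-++ (Ends-mono ℕ.≤-refl first (prologue-run rd))
    where
    k = block (here s)
    v = level (here s)
    5w : ∀ {σ} → σ 3 ≡ w → ⟦ times 5 (reg 3) ⟧ σ ≡ 5 * w
    5w {σ} w≡ = trans (⟦times⟧ 5 (reg 3) σ) (cong (5 *_) w≡)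
    lower≡ : w * k ∸ 5 * w ≡ w * (k ∸ 5)
    lower≡ = trans (cong (w * k ∸_) (ℕ.*-comm 5 w)) (sym (ℕ.*-distribˡ-∸ w k 5))
    upper≡ : ∀ w k V → w * k + w * V + 5 * w ≡ w * (k + V + 5)
    upper≡ = solve-∀
    third : ∀ σ → Loaded s (u + c + c) t σ → σ 11 ≡ lo-ups o u s → σ 12 ≡ hi-ups o u s →
      Ends (config (pollCode (reg 8 ⊕ reg 10) ++ decide) σ) ((2 + c * 3) + 8) (Ready (next o u s) (u + c + c + c) t)
    third σ ld a≡ b≡ = Ends-++ (Ends-mono ℕ.≤-refl
      (λ { σ′ (g≡ , u≡ , same) → decide-run (loaded-frame ld u≡ λ a un → same a (Untouched-⊇ a un))
        (trans (same 11 tt) a≡) (trans (same 12 tt) b≡) g≡ })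
      (poll-run (trans (cong₂ _+_ (Loaded.lo≡ ld) (Loaded.wd′≡ ld)) (sym (ℕ.*-distribˡ-+ w k (width (pred v))))) (Loaded.u≡ ld)))
    second : ∀ σ → Loaded s (u + c) t σ → σ 11 ≡ lo-ups o u s →
      Ends (config (pollCode ((reg 8 ⊕ reg 9) ⊕ times 5 (reg 3)) ++ lit 12 ≔ reg 13 ∷ pollCode (reg 8 ⊕ reg 10) ++ decide) σ)
        ((2 + c * 3) + suc ((2 + c * 3) + 8)) (Ready (next o u s) (u + c + c + c) t)
    second σ ld a≡ = Ends-++ (Ends-mono ℕ.≤-refl
      (λ { σ′ (b≡ , u≡ , same) → Ends-≔ {α = 12} refl b≡
        (third (update σ′ 12 (hi-ups o u s)) (loaded-frame ld u≡ λ a un →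
            trans (update-other σ′ {12} (hi-ups o u s) {a} λ { refl → un }) (same a (Untouched-⊇ a un)))
          (trans (same 11 tt) a≡) refl) })
      (poll-run (trans (cong₂ _+_ (cong₂ _+_ (Loaded.lo≡ ld) (Loaded.wd≡ ld)) (5w {σ} (Loaded.w≡ ld))) (upper≡ w k (width v))) (Loaded.u≡ ld)))
    first : ∀ σ → Loaded s u t σ →
      Ends (config (pollCode (reg 8 ⊖ times 5 (reg 3)) ++ lit 11 ≔ reg 13 ∷
          pollCode ((reg 8 ⊕ reg 9) ⊕ times 5 (reg 3)) ++ lit 12 ≔ reg 13 ∷ pollCode (reg 8 ⊕ reg 10) ++ decide) σ)
        ((2 + c * 3) + suc ((2 + c * 3) + suc ((2 + c * 3) + 8))) (Ready (next o u s) (u + c + c + c) t)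
    first σ ld = Ends-++ (Ends-mono ℕ.≤-refl
      (λ { σ′ (a≡ , u≡ , same) → Ends-≔ {α = 11} refl a≡
        (second (update σ′ 11 (lo-ups o u s)) (loaded-frame ld u≡ λ a un →
            trans (update-other σ′ {11} (lo-ups o u s) {a} λ { refl → un }) (same a (Untouched-⊇ a un)))
          refl) })
      (poll-run (trans (cong₂ _∸_ (Loaded.lo≡ ld) (5w {σ} (Loaded.w≡ ld))) lower≡) (Loaded.u≡ ld)))

  -- `B` is arbitrary: the machine does not maintain the ghost count, and the output does not depend
  -- on it.
  walk-run : ∀ t {s u σ} B → Ready s u t σ →
    Ends (config (while (lit 0 ⊏ reg 4) body ∷ []) σ) (suc (t * suc bodyTime))
      λ σ′ → σ′ 0 ≡ out (proj₁ (eval (walk t u s B) o))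
  walk-run zero    B rd = Ends-while false (cong (0 <ᵇ_) (Ready.t≡ rd)) (halt (Ready.out≡ rd))
  walk-run (suc t) {s} {u} B rd = Ends-while true (cong (0 <ᵇ_) (Ready.t≡ rd))
    (Ends-mono (ℕ.≤-reflexive time) (λ σ eq → trans eq (cong (λ x → out (proj₁ x)) (sym (eval-walk o t u s B))))
      (Ends-++ (Ends-mono ℕ.≤-refl (λ σ → walk-run t _) (body-run rd))))
    where
    time : bodyTime + suc (t * suc bodyTime) ≡ suc (bodyTime + t * suc bodyTime)
    time = ℕ.+-suc bodyTime (t * suc bodyTime)

totalTime : ℕ → ℕ → ℕ
totalTime ℓ T = 2 + (ℓ * 5 + suc (2 + (ℓ * 3 + suc (2 + suc (ℓ * 64 * suc T)))))

module Initialisation (c m d ℓ : ℕ) (bits : HasBits ℓ m) (truth o : ℕ → Bool) where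

  open Code c
  open Execution o

  -- The block size is the margin `d + d` plus all `ℓ * 64 * 3 * c` questions of the walk; `suc`
  -- keeps it positive.
  queriesPerBit w : ℕ
  queriesPerBit = 64 * (c + c + c)
  w = suc (d + d) + ℓ * queriesPerBit

  open Search c w ℓ (ℓ * 4) truth
  open Simulation c w ℓ (ℓ * 4) truth o

  record Loop (n w t h x : ℕ) (σ : Memory) : Set where
    field
      m≡ : σ 0 ≡ m
      n≡ : σ 2 ≡ n
      w≡ : σ 3 ≡ w
      t≡ : σ 4 ≡ t
      h≡ : σ 5 ≡ h
      x≡ : σ 6 ≡ x
      u≡ : σ 16 ≡ 0
      0≡ : ∀ a → σ (20 + a) ≡ 0

  bits-positive : ∀ k {n} → HasBits (suc k) n → (0 <ᵇ n) ≡ true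
  bits-positive k (2^k≤n , _) = <ᵇ-true (ℕ.≤-trans (ℕ.m^n>0 2 k) 2^k≤n)

  countBits-run : ∀ {cs r Q} k {n W t h x σ} → HasBits k n → Loop n W t h x σ →
    (∀ σ → Loop 0 (W + k * queriesPerBit) (t + k * 64) (h + k * 4) x σ → Ends (config cs σ) r Q) →
    Ends (config (while (lit 0 ⊏ reg 2) countBits ∷ cs) σ) (k * 5 + suc r) Q
  countBits-run zero refl lp rest = Ends-while false (cong (0 <ᵇ_) (Loop.n≡ lp)) (rest _ record
    { m≡ = m≡ ; n≡ = n≡ ; w≡ = trans w≡ (sym (ℕ.+-identityʳ _)) ; t≡ = trans t≡ (sym (ℕ.+-identityʳ _))
    ; h≡ = trans h≡ (sym (ℕ.+-identityʳ _)) ; x≡ = x≡ ; u≡ = u≡ ; 0≡ = 0≡ })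
    where open Loop lp
  countBits-run (suc k) {n} {W} {t} {h} {x} hb lp rest =
    Ends-while true (trans (cong (0 <ᵇ_) n≡) (bits-positive k hb))
    (Ends-≔ {α = 2} {β = ⌊ n /2⌋} refl (cong ⌊_/2⌋ n≡)
    (Ends-≔ {α = 3} {β = W + queriesPerBit} refl (cong (_+ queriesPerBit) w≡)
    (Ends-≔ {α = 4} {β = t + 64} refl (cong (_+ 64) t≡)
    (Ends-≔ {α = 5} {β = h + 4} refl (cong (_+ 4) h≡)
    (countBits-run k (hasBits-half k n hb)
      record { m≡ = m≡ ; n≡ = refl ; w≡ = refl ; t≡ = refl ; h≡ = refl ; x≡ = x≡ ; u≡ = u≡ ; 0≡ = 0≡ }
      (λ σ lp′ → rest σ (shift σ lp′)))))))
    where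
    open Loop lp
    shift : ∀ σ → Loop 0 (W + queriesPerBit + k * queriesPerBit) (t + 64 + k * 64) (h + 4 + k * 4) x σ →
      Loop 0 (W + suc k * queriesPerBit) (t + suc k * 64) (h + suc k * 4) x σ
    shift σ lp′ = record
      { m≡ = L.m≡ ; n≡ = L.n≡ ; w≡ = trans L.w≡ (ℕ.+-assoc W queriesPerBit _)
      ; t≡ = trans L.t≡ (ℕ.+-assoc t 64 _) ; h≡ = trans L.h≡ (ℕ.+-assoc h 4 _)
      ; x≡ = L.x≡ ; u≡ = L.u≡ ; 0≡ = L.0≡ }
      where module L = Loop lp′

  rootWidth-run : ∀ {cs r Q} k {n W t h x σ} → HasBits k n → Loop n W t h x σ →
    (∀ σ → Loop 0 W t h (x * 2 ^ k) σ → Ends (config cs σ) r Q) →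
    Ends (config (while (lit 0 ⊏ reg 2) rootWidth ∷ cs) σ) (k * 3 + suc r) Q
  rootWidth-run zero refl lp rest = Ends-while false (cong (0 <ᵇ_) (Loop.n≡ lp)) (rest _ record
    { m≡ = m≡ ; n≡ = n≡ ; w≡ = w≡ ; t≡ = t≡ ; h≡ = h≡ ; x≡ = trans x≡ (sym (ℕ.*-identityʳ _)) ; u≡ = u≡ ; 0≡ = 0≡ })
    where open Loop lp
  rootWidth-run (suc k) {n} {W} {t} {h} {x} hb lp rest =
    Ends-while true (trans (cong (0 <ᵇ_) n≡) (bits-positive k hb))
    (Ends-≔ {α = 2} {β = ⌊ n /2⌋} refl (cong ⌊_/2⌋ n≡)
    (Ends-≔ {α = 6} {β = x + x} refl (cong₂ _+_ x≡ x≡)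
    (rootWidth-run k (hasBits-half k n hb)
      record { m≡ = m≡ ; n≡ = refl ; w≡ = w≡ ; t≡ = t≡ ; h≡ = h≡ ; x≡ = refl ; u≡ = u≡ ; 0≡ = 0≡ }
      (λ σ lp′ → rest σ (subst (λ x → Loop 0 W t h x σ) (double x (2 ^ k)) lp′)))))
    where
    open Loop lp
    double : ∀ x y → (x + x) * y ≡ x * (y + (y + 0))
    double = solve-∀

  noisySearch-run : Ends (start noisySearch m d) (totalTime ℓ bodyTime)
    λ σ → σ 0 ≡ out (proj₁ (eval (walk (ℓ * 64) 0 (state [] [] m) 0) o))
  noisySearch-run =
    Ends-≔ {α = 2} {β = m} refl refl
    (Ends-≔ {α = 3} {β = suc (d + d)} refl refl
    (countBits-run ℓ bits
      record { m≡ = refl ; n≡ = refl ; w≡ = refl ; t≡ = refl ; h≡ = refl ; x≡ = refl ; u≡ = refl ; 0≡ = λ _ → refl }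
      λ σ lp → let open Loop lp in
    Ends-≔ {α = 2} {β = m} refl m≡
    (Ends-≔ {α = 6} {β = w} refl w≡
    (rootWidth-run ℓ bits
      record { m≡ = m≡ ; n≡ = refl ; w≡ = w≡ ; t≡ = t≡ ; h≡ = h≡ ; x≡ = refl ; u≡ = u≡ ; 0≡ = 0≡ }
      λ σ lp′ → let module L = Loop lp′ in
    Ends-≔ {α = 21} {β = w * 2 ^ ℓ} refl L.x≡
    (Ends-≔ {α = 7} {β = 20} refl refl
    (walk-run (ℓ * 64) 0 record
      -- Cell 0 still holds the input `m`, hence the initial output of the walk. Untouched zero
      -- cells provide the position of the root and the empty histogram.
      { out≡ = L.m≡ ; w≡ = L.w≡ ; t≡ = L.t≡ ; thr≡ = L.h≡ ; sp≡ = refl ; u≡ = L.u≡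
      ; stack = trans (L.0≡ 0) (sym (ℕ.*-zeroʳ w)) , refl
      ; table = λ k → L.0≡ (2 + w * k * 3) }))))))

-- Dislocation

module _ {a p q} {A : Set a} {P : Pred A p} {Q : Pred A q} (P? : Decidable P) (Q? : Decidable Q)
  (P⊆Q : ∀ {x} → P x → Q x) where

  length-filter-mono : ∀ xs → length (filter P? xs) ≤ length (filter Q? xs)
  length-filter-mono []       = z≤n
  length-filter-mono (x ∷ xs) with P? x | Q? x
  ... | yes px | yes _  = s≤s (length-filter-mono xs)
  ... | yes px | no ¬qx = contradiction (P⊆Q px) ¬qx
  ... | no _   | yes _  = ℕ.m≤n⇒m≤1+n (length-filter-mono xs)
  ... | no _   | no _   = length-filter-mono xs

  length-filter-< : ∀ {x xs} → x ∈ xs → Q x → ¬ P x → length (filter P? xs) < length (filter Q? xs)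
  length-filter-< {xs = x ∷ xs} (Any.here refl) qx ¬px with P? x | Q? x
  ... | yes px | _      = contradiction px ¬px
  ... | no _   | yes _  = s≤s (length-filter-mono xs)
  ... | no _   | no ¬qx = contradiction qx ¬qx
  length-filter-< {xs = y ∷ xs} (Any.there x∈xs) qx ¬px with P? y | Q? y
  ... | yes py | yes _  = s≤s (length-filter-< x∈xs qx ¬px)
  ... | yes py | no ¬qy = contradiction (P⊆Q py) ¬qy
  ... | no _   | yes _  = ℕ.m≤n⇒m≤1+n (length-filter-< x∈xs qx ¬px)
  ... | no _   | no _   = length-filter-< x∈xs qx ¬px

module Truth {c ℓ₁ ℓ₂} (O : StrictTotalOrder c ℓ₁ ℓ₂) where
  open StrictTotalOrder O using (_<?_) renaming (_<_ to _≺_; compare to ≺-compare; trans to ≺-trans; irrefl to ≺-irrefl; module Eq to ≈)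
  open Dislocation O

  module _ {m} (S : Fin m → Carrier) (x : Carrier) where

    truth : ℕ → Bool
    truth = answers S x ∅

    below : ℕ
    below = length (filter (λ i → S i <? x) (allFin m))

    below≤m : below ≤ m
    below≤m = ℕ.≤-trans (length-filter (λ i → S i <? x) (allFin m)) (ℕ.≤-reflexive (length-tabulate (λ i → i)))

    answers≡oracle : ∀ e j → answers S x e j ≡ oracle truth e j
    answers≡oracle e j with j ℕ.<? m
    ... | no  _   = refl
    ... | yes j<m rewrite lookup-replicate (fromℕ< j<m) false
                        | xor-identityʳ (does (S (fromℕ< j<m) <? x)) = refl

    truth-in : ∀ {j} (j<m : j < m) → truth j ≡ does (S (fromℕ< j<m) <? x)
    truth-in {j} j<m with j ℕ.<? m
    ... | no  j≮m = contradiction j<m j≮m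
    ... | yes _   rewrite lookup-replicate (fromℕ< j<m) false = xor-identityʳ _

    truth-out : ∀ {j} → ¬ j < m → truth j ≡ false
    truth-out {j} j≮m with j ℕ.<? m
    ... | no  _   = refl
    ... | yes j<m = contradiction j<m j≮m

    module _ (x∉S : ∀ i → ¬ (x ≈ S i)) {d} (disl≤d : disl S ≤ d) where

      dislocation≤d : ∀ i → ℕ.∣ pos i - rank (S i) S ∣ ≤ d
      dislocation≤d i = ℕ.≤-trans (All.lookup (xs≤max 0 _) (∈-map⁺ (λ i → ℕ.∣ pos i - rank (S i) S ∣) (∈-allFin i))) disl≤d

      rank≤ : ∀ i → rank (S i) S ≤ pos i + d
      rank≤ i = ℕ.≤-trans (ℕ.m≤n+∣n-m∣ (rank (S i) S) (pos i)) (ℕ.+-monoʳ-≤ (pos i) (dislocation≤d i))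

      pos≤ : ∀ i → pos i ≤ rank (S i) S + d
      pos≤ i = ℕ.≤-trans (ℕ.m≤n+∣m-n∣ (pos i) (rank (S i) S)) (ℕ.+-monoʳ-≤ (rank (S i) S) (dislocation≤d i))

      -- Were `x` smaller than the element at `j`, all elements below `x` would be below that
      -- element too, and its rank would exceed its position by more than `d`.
      truth-below : ∀ j → j + d < below → truth j ≡ true
      truth-below j j+d<r = trans (truth-in j<m) (by-compare (≺-compare (S i) x))
        where
        j<m : j < m
        j<m = ℕ.<-≤-trans (ℕ.≤-<-trans (ℕ.m≤m+n j d) j+d<r) below≤m
        i = fromℕ< j<m
        by-compare : _ → does (S i <? x) ≡ true
        by-compare (tri< lt _ _) = dec-true (S i <? x) lt
        by-compare (tri≈ _ eq _) = contradiction (≈.sym eq) (x∉S i)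
        by-compare (tri> _ _ gt) = contradiction
          (ℕ.≤-trans (s≤s (length-filter-mono (λ k → S k <? x) (λ k → S k <? S i) (λ k<x → ≺-trans k<x gt) (allFin m)))
            (ℕ.≤-trans (rank≤ i) (ℕ.≤-reflexive (cong (λ j → suc j + d) (Fin.toℕ-fromℕ< j<m)))))
          (ℕ.<⇒≱ (s≤s j+d<r))

      -- If the element at `j` were below `x`, it would itself be one of the elements below `x` but
      -- not of those below it. So its rank would be at most `below`, too far from its position.
      truth-above : ∀ j → below + d ≤ j → truth j ≡ false
      truth-above j r+d≤j = by-cases (j ℕ.<? m)
        where
        by-cases : Dec (j < m) → truth j ≡ false
        by-cases (no  j≮m) = truth-out j≮m
        by-cases (yes j<m) = trans (truth-in j<m) (dec-false (S i <? x) λ i<x → ℕ.<⇒≱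
          (ℕ.≤-trans (s≤s r+d≤j) (ℕ.≤-trans (ℕ.≤-reflexive (cong suc (sym (Fin.toℕ-fromℕ< j<m)))) (pos≤ i)))
          (ℕ.+-monoˡ-≤ d (length-filter-< (λ k → S k <? S i) (λ k → S k <? x) (λ k<i → ≺-trans k<i i<x)
            (∈-allFin i) i<x (≺-irrefl ≈.refl))))
          where
          i = fromℕ< j<m

-- The theorem

-- Markov's inequality.
Pr-≥ : ∀ {n ℓ} {E : Pred (Subset n) ℓ} (q : Fin n → ℝ) (E? : Decidable E) → (∀ i → IsProbability (q i)) →
  ∀ (f : Subset n → ℚ) {v} → (∀ e → 0ℚ ℚ.≤ f e) → (∀ e → ¬ E e → 1ℚ ℚ.≤ f e) →
  Ex q (λ e → fromℚ (f e)) ≤ℝ fromℚ v → 1ℝ -ℝ fromℕ 1 *ℝ fromℚ v ≤ℝ Pr q E?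
Pr-≥ q E? isP f {v} 0≤f 1≤f Ex≤v =
  ≤ℝ-trans {1ℝ -ℝ fromℕ 1 *ℝ fromℚ v} {1ℝ -ℝ F} {Pr q E?} below-expectation
  (≤ℝ-trans {1ℝ -ℝ F} {Ex q (λ e → 1ℝ -ℝ fromℚ (f e))} {Pr q E?}
    (≤ℝ-reflexive {1ℝ -ℝ F} {Ex q (λ e → 1ℝ -ℝ fromℚ (f e))} (λ k → sym (Ex-1- q (λ e → fromℚ (f e)) k)))
  (≤ℝ-trans {Ex q (λ e → 1ℝ -ℝ fromℚ (f e))} {Ex q (λ e → indicator (does (E? e)))} {Pr q E?}
    (Ex-mono isP {λ e → 1ℝ -ℝ fromℚ (f e)} {λ e → indicator (does (E? e))} (λ e → fromℚ-mono-≤ (pointwise e (E? e))))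
    (≤ℝ-reflexive {Ex q (λ e → indicator (does (E? e)))} {Pr q E?} (λ k → sym (Pr≃Ex q E? k)))))
  where
  F = Ex q (λ e → fromℚ (f e))
  below-expectation : 1ℝ -ℝ fromℕ 1 *ℝ fromℚ v ≤ℝ 1ℝ -ℝ F
  below-expectation ε 0<ε = let N , F≤v = Ex≤v ε 0<ε in N , λ n n≥ → subst₂ ℚ._≤_
    (trans (cancel v ε) (cong (λ x → 1ℚ ℚ.- x) (sym (ℚ.*-identityˡ v)))) refl
    (ℚ.+-monoˡ-≤ ε (ℚ.+-monoʳ-≤ 1ℚ (ℚ.neg-antimono-≤ (F≤v n n≥))))
    where
    open +-*-Solver
    cancel : ∀ v ε → (1ℚ ℚ.- (v ℚ.+ ε)) ℚ.+ ε ≡ 1ℚ ℚ.- v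
    cancel = solve 2 (λ v e → (con 1ℚ :- (v :+ e)) :+ e := con 1ℚ :- v) refl
  pointwise : ∀ e (d : Dec _) → 1ℚ ℚ.- f e ℚ.≤ indicatorℚ (does d)
  pointwise e (yes _) = subst (1ℚ ℚ.- f e ℚ.≤_) (ℚ.+-identityʳ 1ℚ) (ℚ.+-monoʳ-≤ 1ℚ (ℚ.neg-antimono-≤ (0≤f e)))
  pointwise e (no ¬E) = subst (1ℚ ℚ.- f e ℚ.≤_) (ℚ.+-inverseʳ 1ℚ) (ℚ.+-monoʳ-≤ 1ℚ (ℚ.neg-antimono-≤ (1≤f e ¬E)))

^-distribʳ-* : ∀ n x y → (x * y) ^ n ≡ x ^ n * y ^ n
^-distribʳ-* zero    x y = refl
^-distribʳ-* (suc n) x y = trans (cong (x * y *_) (^-distribʳ-* n x y)) (interchange x y (x ^ n) (y ^ n))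
  where
  interchange : ∀ x y u v → x * y * (u * v) ≡ x * u * (y * v)
  interchange = solve-∀

-- The factor `x ^ n` per bit of `m` cancels the growth of the expectation over `n` steps, and the
-- surplus `2 ^ 6` per bit covers `m ^ 6`.
power-bound : ∀ x n .{{_ : NonZero x}} {m ℓ B} → m ≤ 2 ^ ℓ → ℓ ≤ B → x ^ (ℓ * n) * m ^ 6 ≤ (x ^ n * 2 ^ 6) ^ B
power-bound x n {m} {ℓ} {B} m≤ ℓ≤B = begin
  x ^ (ℓ * n) * m ^ 6          ≤⟨ ℕ.*-monoʳ-≤ (x ^ (ℓ * n)) (ℕ.^-monoˡ-≤ 6 m≤) ⟩
  x ^ (ℓ * n) * (2 ^ ℓ) ^ 6    ≡⟨ cong₂ _*_ (trans (cong (x ^_) (ℕ.*-comm ℓ n)) (sym (ℕ.^-*-assoc x n ℓ)))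
                                    (trans (ℕ.^-*-assoc 2 ℓ 6) (trans (cong (2 ^_) (ℕ.*-comm ℓ 6)) (sym (ℕ.^-*-assoc 2 6 ℓ)))) ⟩
  (x ^ n) ^ ℓ * (2 ^ 6) ^ ℓ    ≡⟨ ^-distribʳ-* ℓ (x ^ n) (2 ^ 6) ⟨
  (x ^ n * 2 ^ 6) ^ ℓ          ≤⟨ ℕ.^-monoʳ-≤ (x ^ n * 2 ^ 6) {{ℕ.m*n≢0 (x ^ n) (2 ^ 6) {{ℕ.m^n≢0 x n}}}} ℓ≤B ⟩
  (x ^ n * 2 ^ 6) ^ B          ∎
  where open ℕ.≤-Reasoning

-- If a spoiled test has probability at most 1 / spoilWeight, then ℓ spoiled tests
-- among 3 · 64ℓ have probability at most m⁻⁶.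
abstract
  spoilWeight : ℕ
  spoilWeight = 8 ^ 64 * 2 ^ 6

  spoilWeight-large : ∀ {m ℓ B} → m ≤ 2 ^ ℓ → ℓ ≤ B → 8 ^ (ℓ * 64) * m ^ 6 ≤ spoilWeight ^ B
  spoilWeight-large = power-bound 8 64

accuracy timeFactor : ℕ → ℕ
accuracy c   = 15 * (3 + 3 * (64 * (c + c + c)))
timeFactor T = 17 + 64 * suc T

-- For positive `d`, both `suc (d + d)` and `ℓ` are at most `3 * d`, which gives the two threes in
-- `accuracy`.
accuracy-bound : ∀ c ℓ d → ℓ ≤ suc (d + d) → .{{_ : NonZero d}} →
  (suc (d + d) + ℓ * (64 * (c + c + c))) * 15 ≤ accuracy c * d
accuracy-bound c ℓ d ℓ≤ = go (64 * (c + c + c)) (ℕ.>-nonZero⁻¹ d)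
  where
  go : ∀ Q → 1 ≤ d → (suc (d + d) + ℓ * Q) * 15 ≤ 15 * (3 + 3 * Q) * d
  go Q 1≤d = ≤-by _ (15 * (3 + 3 * Q) * d) 0
    (ℕ.+-mono-≤ (ℕ.*-monoʳ-≤ (15 * Q) ℓ≤) (ℕ.*-monoʳ-≤ (15 + 15 * Q) 1≤d)) (eq Q ℓ d)
    where
    eq : ∀ Q l d → (suc (d + d) + l * Q) * 15 + (15 * Q * suc (d + d) + (15 + 15 * Q) * d) + 0 ≡
      15 * (3 + 3 * Q) * d + (15 * Q * l + (15 + 15 * Q) * 1)
    eq = solve-∀

time-bound : ∀ ℓ T → 1 ≤ ℓ → totalTime ℓ T ≤ timeFactor T * ℓ
time-bound ℓ T 1≤ℓ = ≤-by _ (timeFactor T * ℓ) 0 (ℕ.*-monoˡ-≤ 9 1≤ℓ) (eq ℓ (suc T))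
  where
  eq : ∀ l T → 2 + (l * 5 + suc (2 + (l * 3 + suc (2 + suc (l * 64 * T))))) + l * 9 + 0 ≡ (17 + 64 * T) * l + 9
  eq = solve-∀

module Proof {c ℓ₁ ℓ₂} {p : ℝ} {M : ℕ} (K : Constants p M) (O : StrictTotalOrder c ℓ₁ ℓ₂) where
  open Dislocation O
  open Truth O
  open Constants K renaming (c to votes; p to p̂)

  module Input (m : ℕ) .{{_ : NonZero m}} (S : Fin m → Carrier) (d : ℕ) (disl≤d : disl S ≤ d)
    (x : Carrier) (x∉S : ∀ i → ¬ (x ≈ S i))
    (ℓ : ℕ) (bits : HasBits ℓ m) (1≤ℓ : 1 ≤ ℓ) (m<2^ℓ : m < 2 ^ ℓ) (ℓ≤ : ℓ ≤ suc (d + d))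
    (M-large : ∀ {B} → ℓ ≤ B → 8 ^ (ℓ * 64) * m ^ 6 ≤ M ^ B)
    (time : ℕ) (time≥ : totalTime ℓ (Code.bodyTime votes) ≤ time)
    (α : ℕ) (α-large : .{{_ : NonZero d}} → (suc (d + d) + ℓ * (64 * (votes + votes + votes))) * 15 ≤ α * d) where

    module Run (o : ℕ → Bool) = Initialisation votes m d ℓ bits (truth S x) o

    open Initialisation votes m d ℓ bits (truth S x) (truth S x) using (w)
    open Search votes w ℓ (ℓ * 4) (truth S x)

    result : (ℕ → Bool) → State × ℕ
    result o = eval (walk (ℓ * 64) 0 (state [] [] m) 0) o

    final : (ℕ → Bool) → Config
    final o = run o time (start (Code.noisySearch votes) m d)

    final-spec : ∀ o → Halted (final o) × output (final o) ≡ out (proj₁ (result o))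
    final-spec o =
      let σ , run≡ , σ0≡ = Execution.Ends⇒run o (Execution.Ends-mono o time≥ (λ _ q → q) (Run.noisySearch-run o))
      in cong pending run≡ , trans (cong output run≡) σ0≡

    fit : ℓ * 64 * (votes + votes + votes) ≤ w
    fit = ℕ.≤-trans (ℕ.≤-reflexive (ℕ.*-assoc ℓ 64 _)) (ℕ.m≤n+m _ (suc (d + d)))

    result-correct : ∀ o → proj₂ (result o) < ℓ → ∣ out (proj₁ (result o)) - rank x S ∣ ≤ w * 15
    result-correct o B<ℓ = Analysis.walk-correct votes w ℓ (ℓ * 4) (truth S x) d (below S x)
      (ℕ.≤-trans (ℕ.n≤1+n (d + d)) (ℕ.m≤m+n _ _))
      (truth-below S x x∉S disl≤d) (truth-above S x x∉S disl≤d)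
      (ℕ.≤-trans (below≤m S x) (ℕ.≤-trans (ℕ.<⇒≤ m<2^ℓ) (ℕ.m≤n*m (2 ^ ℓ) w)))
      o (ℓ * 64) m fit long few
      where
      -- With threshold `4ℓ` the pigeonhole consumes `60ℓ` steps, so 64 steps per bit suffice.
      long : 15 * (ℓ * 4) < ℓ * 64
      long = ≤-by _ (ℓ * 64) 3 (ℕ.*-monoˡ-≤ 4 1≤ℓ) (eq ℓ)
        where
        eq : ∀ l → suc (15 * (l * 4)) + l * 4 + 3 ≡ l * 64 + 4
        eq = solve-∀
      -- The initial potential and at most `ℓ - 1` spoiled tests at 3 each give `4ℓ - 2`, which
      -- fixes the threshold.
      few : suc ℓ + proj₂ (result o) * 3 ≤ ℓ * 4
      few = ≤-by _ (ℓ * 4) 2 (ℕ.*-monoˡ-≤ 3 B<ℓ) (go ℓ (proj₂ (result o)))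
        where
        go : ∀ l B → suc l + B * 3 + l * 3 + 2 ≡ l * 4 + suc B * 3
        go = solve-∀

    module _ (q : Fin m → ℝ) (0≤q≤p : ∀ i → 0ℝ ≤ℝ q i × q i ≤ℝ p) where

      q≤p̂ : ∀ i → q i ≤ℝ fromℚ p̂
      q≤p̂ i = ≤ℝ-trans {q i} {p} {fromℚ p̂} (proj₂ (0≤q≤p i)) q≤p

      isProbability : ∀ i → IsProbability (q i)
      isProbability i = proj₁ (0≤q≤p i) , ≤ℝ-trans {q i} {fromℚ p̂} {1ℝ} (q≤p̂ i) (fromℚ-mono-≤ p≤1)

      Good? : Decidable (λ e → ∣ output (final (answers S x e)) - rank x S ∣ ≤ α * d)
      Good? e = ∣ output (final (answers S x e)) - rank x S ∣ ≤? α * d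

      instance
        scale-nonZero : NonZero (8 ^ (ℓ * 64) * m ^ 6)
        scale-nonZero = ℕ.m*n≢0 (8 ^ (ℓ * 64)) (m ^ 6) {{ℕ.m^n≢0 8 (ℓ * 64)}} {{ℕ.m^n≢0 m 6}}

      -- Scaled so that the expected leaf value is at most `m ^- 6`, while a leaf with at least `ℓ`
      -- spoiled tests has value at least 1, as Markov's inequality requires.
      κ₀ : ℚ
      κ₀ = ℤ.+ 1 ℚ./ (8 ^ (ℓ * 64) * m ^ 6)

      0≤κ₀ : 0ℚ ℚ.≤ κ₀
      0≤κ₀ = 0≤1/ (8 ^ (ℓ * 64) * m ^ 6)

      open Chances votes w ℓ (ℓ * 4) (truth S x) p̂ a b κ₀ M 0≤b 1≤a ab≡1 b≤a 0≤ρ Mρᶜ≤1 0≤κ₀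
        using (leaf-value; walk-bounded)

      total : κ₀ ℚ.* ι (M ^ 0) ℚ.* ι (8 ^ (ℓ * 64)) ≡ m ^- 6
      total = begin
        κ₀ ℚ.* 1ℚ ℚ.* E                       ≡⟨ cong (ℚ._* E) (ℚ.*-identityʳ κ₀) ⟩
        κ₀ ℚ.* E                              ≡⟨ ℚ.*-identityʳ (κ₀ ℚ.* E) ⟨
        κ₀ ℚ.* E ℚ.* 1ℚ                       ≡⟨ cong (κ₀ ℚ.* E ℚ.*_) (trans (ℚ.*-comm (ι (m ^ 6)) (m ^- 6)) (1/n*ιn (m ^ 6) {{ℕ.m^n≢0 m 6}})) ⟨
        κ₀ ℚ.* E ℚ.* (ι (m ^ 6) ℚ.* (m ^- 6)) ≡⟨ reassoc κ₀ E (ι (m ^ 6)) (m ^- 6) ⟩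
        κ₀ ℚ.* (E ℚ.* ι (m ^ 6)) ℚ.* (m ^- 6) ≡⟨ cong (λ y → κ₀ ℚ.* y ℚ.* (m ^- 6)) (ι-* (8 ^ (ℓ * 64)) (m ^ 6)) ⟨
        κ₀ ℚ.* ι (8 ^ (ℓ * 64) * m ^ 6) ℚ.* (m ^- 6) ≡⟨ cong (ℚ._* (m ^- 6)) (1/n*ιn (8 ^ (ℓ * 64) * m ^ 6)) ⟩
        1ℚ ℚ.* (m ^- 6)                       ≡⟨ ℚ.*-identityˡ (m ^- 6) ⟩
        m ^- 6                                ∎
        where
        open ≡-Reasoning
        E = ι (8 ^ (ℓ * 64))
        reassoc : ∀ a b c d → a ℚ.* b ℚ.* (c ℚ.* d) ≡ a ℚ.* (b ℚ.* c) ℚ.* d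
        reassoc = solve 4 (λ a b c d → a :* b :* (c :* d) := a :* (b :* c) :* d) refl
          where open +-*-Solver

      value : Subset m → ℚ
      value e = leaf-value (result (oracle (truth S x) e))

      expectation : Ex q (λ e → fromℚ (value e)) ≤ℝ fromℚ (m ^- 6)
      expectation = ≤ℝ-trans {Ex q (λ e → fromℚ (value e))} {fromℚ (κ₀ ℚ.* ι (M ^ 0) ℚ.* ι (8 ^ (ℓ * 64)))} {fromℚ (m ^- 6)}
        (Ex≤Bounded (truth S x) leaf-value (_% w) q 0≤p p≤1 (λ i → proj₁ (0≤q≤p i)) q≤p̂
          0 (walk (ℓ * 64) 0 (state [] [] m) 0) (κ₀ ℚ.* ι (M ^ 0) ℚ.* ι (8 ^ (ℓ * 64)))
          (walk-fresh (ℓ * 64) 0 (state [] [] m) 0 fit) (walk-bounded (ℓ * 64) 0 (state [] [] m) 0))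
        (fromℚ-mono-≤ (ℚ.≤-reflexive total))

      0≤value : ∀ e → 0ℚ ℚ.≤ value e
      0≤value e = 0≤* 0≤κ₀ (0≤ι (M ^ proj₂ (result (oracle (truth S x) e))))

      1≤value : .{{_ : NonZero d}} → ∀ e → ¬ ∣ output (final (answers S x e)) - rank x S ∣ ≤ α * d → 1ℚ ℚ.≤ value e
      1≤value e bad = ℚ.≤-trans (ℚ.≤-reflexive (sym (1/n*ιn (8 ^ (ℓ * 64) * m ^ 6))))
        (*-monoˡ 0≤κ₀ (ι-mono-≤ (M-large (ℕ.≮⇒≥ many))))
        where
        same : result (answers S x e) ≡ result (oracle (truth S x) e)
        same = eval-cong (_% w) 0 (walk (ℓ * 64) 0 (state [] [] m) 0)
          (walk-fresh (ℓ * 64) 0 (state [] [] m) 0 fit) (λ j _ → answers≡oracle S x e j)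
        many : ¬ proj₂ (result (oracle (truth S x) e)) < ℓ
        many B<ℓ = bad (subst (λ y → ∣ y - rank x S ∣ ≤ α * d) (sym (proj₂ (final-spec (answers S x e))))
          (ℕ.≤-trans (result-correct (answers S x e) (subst (λ r → proj₂ r < ℓ) (sym same) B<ℓ)) α-large))

      probability : .{{_ : NonZero d}} → 1ℝ -ℝ fromℕ 1 *ℝ fromℚ (m ^- 6) ≤ℝ Pr q Good?
      probability = Pr-≥ q Good? isProbability value {m ^- 6} 0≤value 1≤value expectation

      -- If d = 0 then m = 1, and the bound on the probability is 0.
      trivial-probability : d ≡ 0 → 1ℝ -ℝ fromℕ 1 *ℝ fromℚ (m ^- 6) ≤ℝ Pr q Good?
      trivial-probability refl = Pr-≥ q Good? isProbability (λ _ → 1ℚ) {m ^- 6} (λ _ → 0≤1) (λ _ _ → ℚ.≤-refl)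
        (≤ℝ-trans {Ex q (λ _ → 1ℝ)} {1ℝ} {fromℚ (m ^- 6)} (≤ℝ-reflexive {Ex q (λ _ → 1ℝ)} {1ℝ} (Ex-const q 1ℝ))
          (fromℚ-mono-≤ 1≤m^-6))
        where
        0≤1 : 0ℚ ℚ.≤ 1ℚ
        0≤1 = ℚ.<⇒≤ (ℚ.positive⁻¹ 1ℚ)
        m≤1 : m ≤ 1
        m≤1 = ℕ.s≤s⁻¹ (ℕ.≤-trans m<2^ℓ (ℕ.^-monoʳ-≤ 2 ℓ≤))
        1≤m^-6 : 1ℚ ℚ.≤ m ^- 6
        1≤m^-6 = 1/-anti {m ^ 6} {1} {{ℕ.m^n≢0 m 6}} (ℕ.^-monoˡ-≤ 6 m≤1)

      probability-bound : 1ℝ -ℝ fromℕ 1 *ℝ fromℚ (m ^- 6) ≤ℝ Pr q Good?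
      probability-bound = by-cases d refl
        where
        by-cases : ∀ d′ → d ≡ d′ → 1ℝ -ℝ fromℕ 1 *ℝ fromℚ (m ^- 6) ≤ℝ Pr q Good?
        by-cases zero    eq = trivial-probability eq
        by-cases (suc _) eq = probability {{subst NonZero (sym eq) _}}

module _ {c ℓ₁ ℓ₂} {p : ℝ} (K : Constants p spoilWeight) (O : StrictTotalOrder c ℓ₁ ℓ₂) where
  open Dislocation O

  private
    votes = Constants.c K
    noisySearch = Code.noisySearch votes
    C = timeFactor (Code.bodyTime votes)
    α = accuracy votes

  noisySearch-correct : (m : ℕ) .{{_ : NonZero m}} (S : Fin m → Carrier) (d : ℕ) → disl S ≤ d → ln m ≤ℝ fromℕ d →
    (x : Carrier) → (∀ i → ¬ (x ≈ S i)) → ∀ ℓ → ℓ ≡ 1 + ⌊log₂ m ⌋ →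
    (q : Fin m → ℝ) → (∀ i → 0ℝ ≤ℝ q i × q i ≤ℝ p) →
    (∀ (e : Subset m) → Halted (run (answers S x e) (C * ℓ) (start noisySearch m d))) ×
    1ℝ -ℝ fromℕ 1 *ℝ fromℚ (m ^- 6)
      ≤ℝ Pr q (λ e → ∣ output (run (answers S x e) (C * ℓ) (start noisySearch m d)) - rank x S ∣ ≤? α * d)
  noisySearch-correct m S d disl≤d ln≤d x x∉S ℓ ℓ≡ q 0≤q≤p = (λ e → proj₁ (P.final-spec (answers S x e))) , P.probability-bound q 0≤q≤p
    where
    m<2^ℓ : m < 2 ^ ℓ
    m<2^ℓ = subst (λ ℓ → m < 2 ^ ℓ) (sym ℓ≡) (log-upper m)
    1≤ℓ : 1 ≤ ℓ
    1≤ℓ = subst (1 ≤_) (sym ℓ≡) (s≤s z≤n)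
    ℓ≤ : ℓ ≤ suc (d + d)
    ℓ≤ = subst (_≤ suc (d + d)) (sym ℓ≡) (s≤s (log≤2d m d ln≤d))
    module P = Proof.Input K O m S d disl≤d x x∉S ℓ (subst (λ ℓ → HasBits ℓ m) (sym ℓ≡) (hasBits-log m)) 1≤ℓ m<2^ℓ ℓ≤
      (λ {B} → spoilWeight-large {m} {ℓ} {B} (ℕ.<⇒≤ m<2^ℓ))
      (C * ℓ) (time-bound ℓ (Code.bodyTime votes) 1≤ℓ) α (accuracy-bound votes ℓ d ℓ≤)

theorem4p10 : ∀ {c ℓ₁ ℓ₂} (p : ℝ) → 0ℝ ≤ℝ p → p <ℝ ½ℝ →
    Σ[ α ∈ ℕ ] (2 ≤ α ×
    Σ[ NoisySearch ∈ Program ] Σ[ C ∈ ℕ ] Σ[ K ∈ ℕ ]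
    ((O : StrictTotalOrder c ℓ₁ ℓ₂) →
    let open Dislocation O in
    (m : ℕ) .{{_ : NonZero m}} (S : Fin m → Carrier) → Injective _≡_ _≈_ S →
    (d : ℕ) → disl S ≤ d → ln m ≤ℝ fromℕ d →
    (x : Carrier) → (∀ i → ¬ (x ≈ S i)) →
    (q : Fin m → ℝ) → (∀ i → 0ℝ ≤ℝ q i × q i ≤ℝ p) →
    let T = C * (1 + ⌊log₂ m ⌋)
        final = λ (e : Subset m) → run (answers S x e) T (start NoisySearch m d)
    in
    (∀ e → Halted (final e)) ×
    1ℝ -ℝ fromℕ K *ℝ fromℚ (m ^- 6)
    ≤ℝ Pr q (λ e → ∣ output (final e) - rank x S ∣ ≤? α * d)))
theorem4p10 p _ p<½ =
  accuracy votes , 2≤α , Code.noisySearch votes , timeFactor (Code.bodyTime votes) , 1 ,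
  λ O m S _ d disl≤d ln≤d x x∉S → noisySearch-correct K O m S d disl≤d ln≤d x x∉S (1 + ⌊log₂ m ⌋) refl
  where
  K = constants {p} p<½ spoilWeight
  votes = Constants.c K
  2≤α : 2 ≤ accuracy votes
  2≤α = ℕ.≤-trans (ℕ.m≤m+n 2 43) (ℕ.*-monoʳ-≤ 15 (ℕ.m≤m+n 3 (3 * (64 * (votes + votes + votes)))))
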